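{- Let $S$ be a finite ordered tree and $A=\{x\in S\colon x\text{ is not the root of }S\text{ and }x\text{ has at most one immediate successor in }S\}$. Then for every finite ordered tree $T$ and every integer $r>0$ there is a finite ordered tree $V$ such that for every coloring $\chi\colon\mathrm{Hom}_{PSC}(S,V)\to r$ there is $(t,j)\in\mathrm{Hom}_{PSC}(T,V)$ such that for every $(s,i)\in\mathrm{Hom}_{PSC}(S,T)$, the color $\chi((t,j)\circ(s,i))$ depends only on the set $B=\{x\in A\colon i_s(x)\neq i(x)\}$. In particular, $rd(S)\leq|\mathcal{P}(A)|$ in $PSC$.
   Context: All trees are finite. A tree is a partial order $(T,\sqsubseteq_T)$ with a least element (the root) such that the predecessors of every element are linearly ordered; $v\wedge_T w$ is the largest common predecessor. A tree is ordered if each set of immediate successors carries a linear order; this induces a linear order $\leq_T$ on $T$: $v\leq_T w$ iff $v\sqsubseteq_T w$, or $w\not\sqsubseteq_T v$ and the immediate successor of $v\wedge w$ below $v$ precedes the one below $w$. An embedding $i\colon S\to T$ sends root to root, satisfies $x<_S y\Rightarrow i(x)<_T i(y)$, and $i(x\wedge y)=i(x)\wedge i(y)$. A map $s\colon T\to S$ is a rigid surjection if there is an embedding $i\colon S\to T$ with $s(i(x))=x$ and $i(s(y))\sqsubseteq_T y$ for all $x,y$; then $i=i_s$, $i_s(x)=\bigwedge s^{ -1}(x)$. A connection $(s,i)\colon T\leftrightarrows S$ is a pair with $s\colon T\to S$ a rigid surjection, $i\colon S\to T$ an embedding, and for all $x\in S$: $s(i(x))=x$ and $s(y)\leq_S x$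 for all $y<_T i(x)$. A connection is strong if $i$ sends the $\leq_S$-largest leaf ($\sqsubseteq$-maximal element) of $S$ to the $\leq_T$-largest leaf of $T$. For $v\in T$ let $T^v=\{y\in T\colon y\leq_T v\}$ with the inherited structure (an initial subtree), and for a map $s$ defined on $T$ let $s^v=s\restriction T^v$. $PSC$ is the category whose objects are finite ordered trees, with $\mathrm{Hom}_{PSC}(S,T)=\{(s,i)\colon T^v\leftrightarrows S\mid v\in T,\ (s,i)\text{ a strong connection}\}$; for $(t,j)\colon T^v\leftrightarrows S$ in $\mathrm{Hom}_{PSC}(S,T)$ and $(s,i)\in\mathrm{Hom}_{PSC}(T,V)$ the composite is $(s,i)\circ(t,j)=(t\circ s^{i(v)},\ i^{v}\circ j)$, where $i^v=i\restriction T^v$. Ramsey degree: $rd(A,B)$ is the least $k$ such that for every $r>0$ there is an object $C$ such that every $r$-coloring of $\mathrm{Hom}(A,C)$ admits $f\in\mathrm{Hom}(B,C)$ with at most $k$ colors on $f\circ\mathrm{Hom}(A,B)$; $rd(A)=\sup_B rd(A,B)$. -}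

module Defs where

open import Data.Nat using (ℕ)
open import Data.Fin using (Fin) renaming (_<_ to _<ᶠ_; _≟_ to _≟ᶠ_)
open import Data.List using (List; length; lookup)
open import Data.Product using (Σ; _×_; _,_)
open import Data.Unit using (⊤)
open import Relation.Nullary using (¬_; yes; no)
open import Relation.Binary.PropositionalEquality using (_≡_; _≢_; refl)

-- Finite ordered trees: rose trees; the list of subtrees of a node is
-- the linearly ordered set of its immediate successors.

data Tree : Set where
  node : List Tree → Tree

data Pos : Tree → Set where
  root  : ∀ {ts} → Pos (node ts)
  child : ∀ {ts} (k : Fin (length ts)) → Pos (lookup ts k) → Pos (node ts)

rootOf : (t : Tree) → Pos t
rootOf (node ts) = root

data _⊑_ : {t : Tree} → Pos t → Pos t → Set where
  root⊑  : ∀ {ts} {p : Pos (node ts)} → root ⊑ p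
  child⊑ : ∀ {ts} {k : Fin (length ts)} {p q : Pos (lookup ts k)} →
           p ⊑ q → child {ts} k p ⊑ child k q

_⊏_ : {t : Tree} → Pos t → Pos t → Set
x ⊏ y = x ⊑ y × x ≢ y

data _≤T_ : {t : Tree} → Pos t → Pos t → Set where
  root≤ : ∀ {ts} {p : Pos (node ts)} → root ≤T p
  same≤ : ∀ {ts} {k : Fin (length ts)} {p q : Pos (lookup ts k)} →
          p ≤T q → child {ts} k p ≤T child k q
  diff≤ : ∀ {ts} {k k' : Fin (length ts)} {p : Pos (lookup ts k)}
          {q : Pos (lookup ts k')} → k <ᶠ k' → child {ts} k p ≤T child k' q

_<T_ : {t : Tree} → Pos t → Pos t → Set
x <T y = x ≤T y × x ≢ y

meet : {t : Tree} → Pos t → Pos t → Pos t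
meet (child k p) (child k' q) with k ≟ᶠ k'
... | yes refl = child k (meet p q)
... | no _     = root
meet root _ = root
meet (child _ _) root = root

ImmSucc : {t : Tree} → Pos t → Pos t → Set
ImmSucc x y = x ⊏ y × (∀ z → x ⊏ z → z ⊑ y → z ≡ y)

-- Subtrees given as predicates on Pos T.  T^v is (λ y → y ≤T v); it is
-- closed under predecessors, so root, ⊑, ≤T and ∧ are inherited from T.

Full : {t : Tree} → Pos t → Set
Full _ = ⊤

Initial : {T : Tree} → Pos T → Pos T → Set
Initial v y = y ≤T v

IsLeafIn : {T : Tree} → (Pos T → Set) → Pos T → Set
IsLeafIn D x = D x × (∀ y → D y → x ⊑ y → y ≡ x)

IsLargestLeafIn : {T : Tree} → (Pos T → Set) → Pos T → Set
IsLargestLeafIn D x = IsLeafIn D x × (∀ y → IsLeafIn D y → y ≤T x)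

IsMeetOf : {T : Tree} → (Pos T → Set) → Pos T → Set
IsMeetOf P m = (∀ y → P y → m ⊑ y) × (∀ z → (∀ y → P y → z ⊑ y) → z ⊑ m)

IsEmbedding : {S T : Tree} → (Pos T → Set) → (Pos S → Pos T) → Set
IsEmbedding {S} {T} D i =
  (i (rootOf S) ≡ rootOf T) × (∀ x → D (i x)) ×
  (∀ x y → x <T y → i x <T i y) ×
  (∀ x y → i (meet x y) ≡ meet (i x) (i y))

-- Rigid surjection s : D → S (only the values of s on D matter)
IsRigidSurj : {S T : Tree} → (Pos T → Set) → (Pos T → Pos S) → Set
IsRigidSurj {S} {T} D s =
  Σ (Pos S → Pos T) λ i → IsEmbedding D i ×
    (∀ x → s (i x) ≡ x) × (∀ y → D y → i (s y) ⊑ y)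

IsConnection : {S T : Tree} → (Pos T → Set) → (Pos T → Pos S) → (Pos S → Pos T) → Set
IsConnection D s i =
  IsRigidSurj D s × IsEmbedding D i × (∀ x → s (i x) ≡ x) ×
  (∀ x y → D y → y <T i x → s y ≤T x)

IsStrongConnection : {S T : Tree} → (Pos T → Set) → (Pos T → Pos S) → (Pos S → Pos T) → Set
IsStrongConnection D s i =
  IsConnection D s i × (∀ ℓ → IsLargestLeafIn Full ℓ → IsLargestLeafIn D (i ℓ))

-- Morphisms of PSC.  A morphism S → T is a strong connection
-- (s , i) : T^v ⇄ S.  s is stored as a total function Pos T → Pos S of
-- which only the restriction to T^v is meaningful; morphisms are
-- compared by the setoid equality _≈R_ below.

record RawHom (S T : Tree) : Set where
  constructor raw
  field
    pt  : Pos T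
    sur : Pos T → Pos S          -- s (meaningful on T^v)
    emb : Pos S → Pos T
open RawHom public

_≈R_ : {S T : Tree} → RawHom S T → RawHom S T → Set
h ≈R h' = (pt h ≡ pt h') × (∀ y → y ≤T pt h → sur h y ≡ sur h' y) ×
          (∀ x → emb h x ≡ emb h' x)

Hom : Tree → Tree → Set
Hom S T = Σ (RawHom S T) λ h → IsStrongConnection (Initial (pt h)) (sur h) (emb h)

rawOf : {S T : Tree} → Hom S T → RawHom S T
rawOf (h , _) = h

_≈H_ : {S T : Tree} → Hom S T → Hom S T → Set
h ≈H h' = rawOf h ≈R rawOf h'

-- Composite (t , j) ∘ (s , i) for (s , i) : T^v ⇄ S and
-- (t , j) : V^w ⇄ T :  (s ∘ t^{j(v)} , j^v ∘ i) : V^{j(v)} ⇄ S.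
_∘R_ : {S T V : Tree} → RawHom T V → RawHom S T → RawHom S V
tj ∘R si = raw (emb tj (pt si)) (λ y → sur si (sur tj y)) (λ x → emb tj (emb si x))

SetA : (S : Tree) → Pos S → Set
SetA S x = x ≢ rootOf S × (∀ y z → ImmSucc x y → ImmSucc x z → y ≡ z)

-- B(s , i) = { x ∈ A : i_s(x) ≠ i(x) },  i_s(x) = ⋀ s⁻¹(x) (in T^v).
SetB : {S T : Tree} → Hom S T → Pos S → Set
SetB {S} (h , _) x =
  SetA S x × ¬ IsMeetOf (λ y → y ≤T pt h × sur h y ≡ x) (emb h x)

SameB : {S T : Tree} → Hom S T → Hom S T → Set
SameB si si' = ∀ x → (SetB si x → SetB si' x) × (SetB si' x → SetB si x)

{-# OPTIONS --safe #-}

-- A morphism (s , i) : T^v ⇄ S is determined by the vertex v and a labelling of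
-- the vertices before v in preorder: a vertex y is labelled by s y, and i x gets
-- a label of its own if it differs from i_s x.  The points i_s x and i x form an
-- increasing sequence that ends at v, and all vertices between two consecutive
-- points repeat labels of their ancestors.  So it suffices to find, for a tree T
-- and a colouring of labelled vertices of a large tree, a copy of T (with i equal
-- to i_s) in which the colour at a point depends only on the labelled vertex at
-- the previous point and on the label of the meet of the two points; iterating
-- this along the sequence leaves a dependence only on the set B, which says
-- where i_s x and i x differ.  For each previous point this is a statement about
-- labellings by a fixed finite set of ancestors' labels, and the past of the
-- point is known when the part of the tree after it is chosen, so all points can
-- be handled one after the other.  For labellings by a fixed finite set K, the
-- Hales–Jewett theorem, applied to words read along a path, makes the labels of
-- vertices off the way to v irrelevant.  What remains is a colouring of words over
-- directions times K, to which Hales–Jewett applies again in the manner of the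
-- Carlson–Simpson theorem: the first variable of a combinatorial line becomes a
-- vertex of the copy, and the colour depends on its level only.

module Submission where

open import Defs
open import Data.Bool using (Bool; true; false; if_then_else_; _∧_; not)
import Data.Bool as Bool
open import Data.Nat using (ℕ; zero; suc; _+_; _*_; _^_; _≤_; _<_; z≤n; s≤s)
open import Data.Nat.Properties using (n<1+n; +-suc; m≤m+n; m≤n+m; ≤-trans; ≤-refl)
open import Data.Fin using (Fin; zero; suc; funToFin; finToFun)
open import Data.Fin.Properties using (finToFun-funToFin)
import Data.Fin as Fin
import Data.Fin.Properties as FinP
open import Data.List using (List; []; _∷_; length)
import Data.List as List
open import Data.Maybe using (Maybe; just; nothing; fromMaybe)
import Data.Maybe as Maybe
open import Data.List.Relation.Unary.All as All using (All; []; _∷_)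
import Data.List.Relation.Unary.All.Properties as AllP
open import Data.List.Relation.Unary.AllPairs as AllPairs using (AllPairs; []; _∷_)
import Data.List.Relation.Unary.AllPairs.Properties as AllPairsP
open import Data.List.Membership.Propositional using (_∈_)
open import Data.List.Membership.Propositional.Properties using (∈-map⁺; ∈-++⁺ˡ; ∈-++⁺ʳ)
import Data.List.Relation.Unary.Any as ListAny
open import Data.Vec using (Vec; []; _∷_; map; lookup; allFin; _++_; tabulate)
open import Data.Vec.Properties using (map-∘; map-cong; map-++; map-id; lookup-map; lookup-allFin;
  map-lookup-allFin; lookup∘tabulate)
open import Data.Vec.Relation.Unary.Any using (Any; here; there)
import Data.Vec.Relation.Unary.Any.Properties as AnyP
open import Data.Product using (Σ; _×_; _,_; proj₁; proj₂)
import Data.Product.Properties as ProductP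
open import Data.Sum using (_⊎_; inj₁; inj₂; [_,_]′)
open import Data.Unit using (tt)
open import Data.Empty using (⊥-elim)
open import Function using (_∘_; id)
open import Relation.Nullary using (¬_; Dec; yes; no; does)
open import Relation.Nullary.Decidable using (_×-dec_; _→-dec_; dec-true; dec-false)
open import Relation.Binary.Definitions using (tri<; tri≈; tri>)
open import Relation.Binary.PropositionalEquality

-- The meet of two consecutive points is recorded because it decides which labels are available: on
-- the way from the meet `u ∧ v` to the next point `v`, vertices can only repeat labels of
-- predecessors of `u ∧ v`, so the set K changes with the meet. This adds no dependence in the end.
-- The meet of `i x` with the next canonical point `e y`, where `e` is `i_s`, is `i (x ∧ y)`, and
-- the meet of `e x` with `i x` is `e x`, so all recorded letters can be computed from B. A letter
-- identifies the meet only if no proper predecessor of the meet carries it. The Boolean added to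
-- `s y` ensures this, as it separates `i x` from `e x`; it also lets `i` be recovered from the
-- letters. One morphism has to act on all labellings at once. Its labels outside the copy are
-- therefore positions of ancestors, elements of `Fin n`, and not letters.

private variable
  A B X Y Z : Set
  b b' : Bool
  F F' F'' G G' H H' : List Tree
  σ τ S T : Tree
  k m n r N N' : ℕ

-- Labelled forests, connections between them and their composition

Forest : Set
Forest = List Tree

-- Pre X true F: labellings of F in X.  Pre X false F: a vertex v of F and a
-- labelling of the vertices strictly before v in preorder.
data Pre (X : Set) : Bool → Forest → Set where
  end   : Pre X true []
  here  : Pre X false (node G ∷ F)
  down  : X → Pre X false G → Pre X false (node G ∷ F)
  right : X → Pre X true G → Pre X b F → Pre X b (node G ∷ F)

mapP : (X → Y) → Pre X b F → Pre Y b F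
mapP f end           = end
mapP f here          = here
mapP f (down x p)    = down (f x) (mapP f p)
mapP f (right x l p) = right (f x) (mapP f l) (mapP f p)

mapP-∘ : (f : Y → Z) (g : X → Y) (p : Pre X b F) → mapP f (mapP g p) ≡ mapP (f ∘ g) p
mapP-∘ f g end           = refl
mapP-∘ f g here          = refl
mapP-∘ f g (down x p)    = cong (down _) (mapP-∘ f g p)
mapP-∘ f g (right x l p) = cong₂ (right _) (mapP-∘ f g l) (mapP-∘ f g p)

mapP-cong : {f g : X → Y} → (∀ x → f x ≡ g x) → (p : Pre X b F) → mapP f p ≡ mapP g p
mapP-cong e end           = refl
mapP-cong e here          = refl
mapP-cong e (down x p)    = cong₂ down (e x) (mapP-cong e p)
mapP-cong e (right x l p) =
  trans (cong (λ x → right x _ _) (e x)) (cong₂ (right _) (mapP-cong e l) (mapP-cong e p))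

mapP-id : (p : Pre X b F) → mapP id p ≡ p
mapP-id end           = refl
mapP-id here          = refl
mapP-id (down x p)    = cong (down x) (mapP-id p)
mapP-id (right x l p) = cong₂ (right x) (mapP-id l) (mapP-id p)

val : Vec X n → Pre (Fin n) b F → Pre X b F
val ρ = mapP (lookup ρ)

val-map : (f : X → Y) (ρ : Vec X n) (p : Pre (Fin n) b F) → mapP f (val ρ p) ≡ val (map f ρ) p
val-map f ρ p = trans (mapP-∘ f (lookup ρ) p) (mapP-cong (λ i → sym (lookup-map i f ρ)) p)

val-id : (p : Pre (Fin n) b F) → val (allFin n) p ≡ p
val-id p = trans (mapP-cong lookup-allFin p) (mapP-id p)

-- A connection from a forest F' onto a forest F whose embedding is the canonical
-- one of its rigid surjection; F' sits below n ancestors, whose labels may be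
-- used on the vertices of F' outside the copy of F.
data FMor (n : ℕ) : Forest → Forest → Set where
  nil  : FMor n [] []
  skip : Fin n → Pre (Fin n) true G' → FMor n F' F → FMor n (node G' ∷ F') F
  keep : FMor (suc n) G' G → FMor n F' F → FMor n (node G' ∷ F') (node G ∷ F)
  into : Fin n → FMor n G' (τ ∷ []) → FMor n F' F → FMor n (node G' ∷ F') (τ ∷ F)

-- Composition of a labelled vertex with the connection `t`: labels are pulled back along the
-- surjection and the vertex is moved by the embedding. `into` admits a single tree, because two
-- trees of `F` meet above the forest and therefore cannot share a tree of `F'` when meets are
-- preserved.
pev : Vec X n → FMor n F' F → Pre X b F → Pre X b F'
pev ρ nil          p             = p
pev ρ (skip a l h) p             = right (lookup ρ a) (val ρ l) (pev ρ h p)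
pev ρ (keep g h)   here          = here
pev ρ (keep g h)   (down x p)    = down x (pev (x ∷ ρ) g p)
pev ρ (keep g h)   (right x l p) = right x (pev (x ∷ ρ) g l) (pev ρ h p)
pev ρ (into a g h) here          = down (lookup ρ a) (pev ρ g here)
pev ρ (into a g h) (down x p)    = down (lookup ρ a) (pev ρ g (down x p))
pev ρ (into a g h) (right x l p) = right (lookup ρ a) (pev ρ g (right x l end)) (pev ρ h p)

mapP-pev : (f : X → Y) (ρ : Vec X n) (t : FMor n F' F) (p : Pre X b F) →
           mapP f (pev ρ t p) ≡ pev (map f ρ) t (mapP f p)
mapP-pev f ρ nil p = refl
mapP-pev f ρ (skip a l h) p
  rewrite lookup-map a f ρ | val-map f ρ l | mapP-pev f ρ h p = refl
mapP-pev f ρ (keep g h) here = refl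
mapP-pev f ρ (keep g h) (down x p) = cong (down _) (mapP-pev f (x ∷ ρ) g p)
mapP-pev f ρ (keep g h) (right x l p) =
  cong₂ (right _) (mapP-pev f (x ∷ ρ) g l) (mapP-pev f ρ h p)
mapP-pev f ρ (into a g h) here
  rewrite lookup-map a f ρ | mapP-pev f ρ g here = refl
mapP-pev f ρ (into a g h) (down x p)
  rewrite lookup-map a f ρ | mapP-pev f ρ g (down x p) = refl
mapP-pev f ρ (into a g h) (right x l p)
  rewrite lookup-map a f ρ | mapP-pev f ρ g (right x l end) | mapP-pev f ρ h p = refl

weaken : Vec (Fin n) m → Vec (Fin (suc n)) (suc m)
weaken σ = zero ∷ map suc σ

-- An ancestor seen by `t` need not belong to the copy chosen by `u`; outside it, the ancestor
-- repeats the label of one of the `n` ancestors of `u`. The vector `σ` keeps track of this: `keep`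
-- against `into a` adds `a` to it, while `keep` against `keep` adds a new ancestor.
comp : Vec (Fin n) m → FMor m F'' F' → FMor n F' F → FMor n F'' F
comp σ nil          t               = t
comp σ (skip a l h) t               = skip (lookup σ a) (val σ l) (comp σ h t)
comp σ (keep g h)   (skip a l h')   = skip a (pev (a ∷ σ) g l) (comp σ h h')
comp σ (keep g h)   (keep g' h')    = keep (comp (weaken σ) g g') (comp σ h h')
comp σ (keep g h)   (into a g' h')  = into a (comp (a ∷ σ) g g') (comp σ h h')
comp σ (into a g h) (skip a' l h')  =
  skip (lookup σ a) (pev σ g (right a' l end)) (comp σ h h')
comp σ (into a g h) (keep g' h')    = into (lookup σ a) (comp σ g (keep g' nil)) (comp σ h h')
comp σ (into a g h) (into a' g' h') = into (lookup σ a) (comp σ g (into a' g' nil)) (comp σ h h')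

map-weaken : (x : X) (ρ : Vec X n) (σ : Vec (Fin n) m) →
             map (lookup (x ∷ ρ)) (weaken σ) ≡ x ∷ map (lookup ρ) σ
map-weaken x ρ σ = cong (x ∷_) (sym (map-∘ (lookup (x ∷ ρ)) suc σ))

pev-comp : (ρ : Vec X n) (σ : Vec (Fin n) m) (t : FMor m F'' F') (u : FMor n F' F)
           (p : Pre X b F) →
           pev ρ (comp σ t u) p ≡ pev (map (lookup ρ) σ) t (pev ρ u p)
pev-comp ρ σ nil u p = refl
pev-comp ρ σ (skip a l h) u p
  rewrite lookup-map a (lookup ρ) σ | val-map (lookup ρ) σ l | pev-comp ρ σ h u p = refl
pev-comp ρ σ (keep g h) (skip a l h') p
  rewrite mapP-pev (lookup ρ) (a ∷ σ) g l | pev-comp ρ σ h h' p = refl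
pev-comp ρ σ (keep g h) (keep g' h') here = refl
pev-comp ρ σ (keep g h) (keep g' h') (down x p)
  rewrite pev-comp (x ∷ ρ) (weaken σ) g g' p | map-weaken x ρ σ = refl
pev-comp ρ σ (keep g h) (keep g' h') (right x l p)
  rewrite pev-comp (x ∷ ρ) (weaken σ) g g' l | map-weaken x ρ σ | pev-comp ρ σ h h' p = refl
pev-comp ρ σ (keep g h) (into a g' h') here
  rewrite pev-comp ρ (a ∷ σ) g g' here = refl
pev-comp ρ σ (keep g h) (into a g' h') (down x p)
  rewrite pev-comp ρ (a ∷ σ) g g' (down x p) = refl
pev-comp ρ σ (keep g h) (into a g' h') (right x l p)
  rewrite pev-comp ρ (a ∷ σ) g g' (right x l end) | pev-comp ρ σ h h' p = refl
pev-comp ρ σ (into a g h) (skip a' l h') p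
  rewrite lookup-map a (lookup ρ) σ | mapP-pev (lookup ρ) σ g (right a' l end)
        | pev-comp ρ σ h h' p = refl
pev-comp ρ σ (into a g h) (keep g' h') here
  rewrite lookup-map a (lookup ρ) σ | pev-comp ρ σ g (keep g' nil) here = refl
pev-comp ρ σ (into a g h) (keep g' h') (down x p)
  rewrite lookup-map a (lookup ρ) σ | pev-comp ρ σ g (keep g' nil) (down x p) = refl
pev-comp ρ σ (into a g h) (keep g' h') (right x l p)
  rewrite lookup-map a (lookup ρ) σ | pev-comp ρ σ g (keep g' nil) (right x l end)
        | pev-comp ρ σ h h' p = refl
pev-comp ρ σ (into a g h) (into a' g' h') here
  rewrite lookup-map a (lookup ρ) σ | pev-comp ρ σ g (into a' g' nil) here = refl
pev-comp ρ σ (into a g h) (into a' g' h') (down x p)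
  rewrite lookup-map a (lookup ρ) σ | pev-comp ρ σ g (into a' g' nil) (down x p) = refl
pev-comp ρ σ (into a g h) (into a' g' h') (right x l p)
  rewrite lookup-map a (lookup ρ) σ | pev-comp ρ σ g (into a' g' nil) (right x l end)
        | pev-comp ρ σ h h' p = refl

idM : FMor n F F
idM {F = []}         = nil
idM {F = node G ∷ F} = keep idM idM

pev-id : (ρ : Vec X n) (p : Pre X b F) → pev ρ idM p ≡ p
pev-id ρ end           = refl
pev-id ρ here          = refl
pev-id ρ (down x p)    = cong (down x) (pev-id (x ∷ ρ) p)
pev-id ρ (right x l p) = cong₂ (right x) (pev-id (x ∷ ρ) l) (pev-id ρ p)

_∙_ : FMor n F'' F' → FMor n F' F → FMor n F'' F
_∙_ = comp (allFin _)

pev-∙ : (ρ : Vec X n) (t : FMor n F'' F') (u : FMor n F' F) (p : Pre X b F) →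
        pev ρ (t ∙ u) p ≡ pev ρ t (pev ρ u p)
pev-∙ ρ t u p = trans (pev-comp ρ (allFin _) t u p)
                      (cong (λ ρ' → pev ρ' t (pev ρ u p)) (map-lookup-allFin ρ))

wk : FMor n F' F → FMor (suc n) F' F
wk t = comp (map suc (allFin _)) t idM

pev-wk : (x : X) (ρ : Vec X n) (t : FMor n F' F) (p : Pre X b F) →
         pev (x ∷ ρ) (wk t) p ≡ pev ρ t p
pev-wk x ρ t p =
  trans (pev-comp (x ∷ ρ) _ t idM p)
        (cong₂ (λ ρ' → pev ρ' t)
               (trans (sym (map-∘ (lookup (x ∷ ρ)) suc (allFin _))) (map-lookup-allFin ρ))
               (pev-id (x ∷ ρ) p))

glue : Pre X true (σ ∷ []) → Pre X b H → Pre X b (σ ∷ H)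
glue (right x l _) q = right x l q

lift : Pre X false (σ ∷ []) → Pre X false (σ ∷ H)
lift here       = here
lift (down x p) = down x p

_◂_ : FMor n (σ ∷ []) (τ ∷ []) → FMor n H' H → FMor n (σ ∷ H') (τ ∷ H)
keep g nil   ◂ h = keep g h
into a g nil ◂ h = into a g h

pev-glue : (ρ : Vec X n) (t : FMor n (σ ∷ []) (τ ∷ [])) (h : FMor n H' H)
           (z : Pre X true (τ ∷ [])) (q : Pre X b H) →
           pev ρ (t ◂ h) (glue z q) ≡ glue (pev ρ t z) (pev ρ h q)
pev-glue ρ (keep g nil)   h (right x l end) q = refl
pev-glue ρ (into a g nil) h (right x l end) q = refl

pev-lift : (ρ : Vec X n) (t : FMor n (σ ∷ []) (τ ∷ [])) (h : FMor n H' H)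
           (z : Pre X false (τ ∷ [])) → pev ρ (t ◂ h) (lift z) ≡ lift (pev ρ t z)
pev-lift ρ (keep g nil)   h here       = refl
pev-lift ρ (keep g nil)   h (down x p) = refl
pev-lift ρ (into a g nil) h here       = refl
pev-lift ρ (into a g nil) h (down x p) = refl

constM : Pre (Fin n) true F → FMor n F []
constM end           = nil
constM (right x l p) = skip x l (constM p)

pev-constM : (ρ : Vec X n) (l : Pre (Fin n) true F) → pev ρ (constM l) end ≡ val ρ l
pev-constM ρ end           = refl
pev-constM ρ (right x l p) = cong (right _ _) (pev-constM ρ p)

fill : X → Pre X true F
fill {F = []}         x = end
fill {F = node G ∷ F} x = right x (fill x) (fill x)

-- Finite sets, and functions as colours

record Finite (A : Set) : Set where
  field
    size    : ℕ
    index   : A → Fin size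
    elem    : Fin size → A
    elem-index : ∀ a → elem (index a) ≡ a
open Finite

-- Product colouring: a function of `x` becomes one colour, so that a single use of a Ramsey
-- statement treats all `x` simultaneously.
code : (A : Finite X) → (X → Fin r) → Fin (r ^ size A)
code A f = funToFin (f ∘ elem A)

funToFin-cong : {f g : Fin m → Fin n} → (∀ i → f i ≡ g i) → funToFin f ≡ funToFin g
funToFin-cong {m = zero}  e = refl
funToFin-cong {m = suc m} e = cong₂ Fin.combine (e zero) (funToFin-cong (e ∘ suc))

code-cong : (A : Finite X) {f g : X → Fin r} → (∀ x → f x ≡ g x) → code A f ≡ code A g
code-cong A e = funToFin-cong (e ∘ elem A)

decode : (A : Finite X) → Fin (r ^ size A) → X → Fin r
decode A c x = finToFun c (index A x)

decode-code : (A : Finite X) (f : X → Fin r) (x : X) → decode A (code A f) x ≡ f x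
decode-code A f x = trans (finToFun-funToFin (f ∘ elem A) (index A x)) (cong f (elem-index A x))

retract : Finite Y → (f : X → Y) (g : Y → X) → (∀ x → g (f x) ≡ x) → Finite X
retract A f g gf = record
  { size = size A ; index = index A ∘ f ; elem = g ∘ elem A
  ; elem-index = λ x → trans (cong g (elem-index A (f x))) (gf x) }

finite-Fin : Finite (Fin n)
finite-Fin = record { size = _ ; index = id ; elem = id ; elem-index = λ _ → refl }

finite-Bool : Finite Bool
finite-Bool = retract (finite-Fin {2}) (λ { false → zero ; true → suc zero })
  (λ { zero → false ; (suc _) → true }) (λ { false → refl ; true → refl })

finite-× : Finite X → Finite Y → Finite (X × Y)
finite-× A B = record
  { size = size A * size B
  ; index = λ (x , y) → Fin.combine (index A x) (index B y)
  ; elem = λ i → let (j , k) = Fin.remQuot (size B) i in elem A j , elem B k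
  ; elem-index = λ (x , y) → trans
      (cong (λ (j , k) → elem A j , elem B k) (FinP.remQuot-combine (index A x) (index B y)))
      (cong₂ _,_ (elem-index A x) (elem-index B y)) }

finite-⊎ : Finite X → Finite Y → Finite (X ⊎ Y)
finite-⊎ {X} {Y} A B = record
  { size = size A + size B ; index = to ; elem = from ∘ Fin.splitAt (size A)
  ; elem-index = inv }
  where
  to : X ⊎ Y → Fin (size A + size B)
  to (inj₁ x) = index A x Fin.↑ˡ size B
  to (inj₂ y) = size A Fin.↑ʳ index B y
  from : Fin (size A) ⊎ Fin (size B) → X ⊎ Y
  from (inj₁ i) = inj₁ (elem A i)
  from (inj₂ i) = inj₂ (elem B i)
  inv : ∀ z → from (Fin.splitAt (size A) (to z)) ≡ z
  inv (inj₁ x) = trans (cong from (FinP.splitAt-↑ˡ (size A) (index A x) (size B)))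
                       (cong inj₁ (elem-index A x))
  inv (inj₂ y) = trans (cong from (FinP.splitAt-↑ʳ (size A) (size B) (index B y)))
                       (cong inj₂ (elem-index B y))

finite-Vec : Finite X → Finite (Vec X n)
finite-Vec {n = zero}  A = retract (finite-Fin {1}) (λ _ → zero) (λ _ → []) (λ { [] → refl })
finite-Vec {n = suc n} A = retract (finite-× A (finite-Vec {n = n} A))
  (λ { (x ∷ v) → x , v }) (λ (x , v) → x ∷ v) (λ { (x ∷ v) → refl })

finite-Pre : Finite X → ∀ {b} {F} → Finite (Pre X b F)
finite-Pre A {true} {[]} = retract (finite-Fin {1}) (λ _ → zero) (λ _ → end) (λ { end → refl })
finite-Pre A {false} {[]} = retract (finite-Fin {0}) (λ ()) (λ ()) (λ ())
finite-Pre A {true} {node G ∷ F} =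
  retract (finite-× A (finite-× (finite-Pre A {true} {G}) (finite-Pre A {true} {F})))
  (λ { (right x l p) → x , l , p }) (λ (x , l , p) → right x l p) (λ { (right x l p) → refl })
finite-Pre {X} A {false} {node G ∷ F} =
  retract (finite-⊎ (finite-Fin {1}) (finite-⊎ (finite-× A (finite-Pre A {false} {G}))
            (finite-× A (finite-× (finite-Pre A {true} {G}) (finite-Pre A {false} {F})))))
  (λ { here → inj₁ zero ; (down x p) → inj₂ (inj₁ (x , p))
     ; (right x l p) → inj₂ (inj₂ (x , l , p)) })
  (λ { (inj₁ _) → here ; (inj₂ (inj₁ (x , p))) → down x p
     ; (inj₂ (inj₂ (x , l , p))) → right x l p })
  (λ { here → refl ; (down x p) → refl ; (right x l p) → refl })

-- The Hales–Jewett theorem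

Template : Set → ℕ → Set
Template A = Vec (Maybe A)

-- The wildcard is nothing.
Variable : Template A N → Set
Variable = Any (_≡ nothing)

fillIn : Template A N → A → Vec A N
fillIn w a = map (fromMaybe a) w

MonoLine : ℕ → ℕ → (Vec (Fin k) N → Fin r) → Set
MonoLine {k} {N} _ _ χ =
  Σ (Template (Fin k) N) λ w → Variable w × (∀ a b → χ (fillIn w a) ≡ χ (fillIn w b))

HJ : ℕ → ℕ → Set
HJ k r = Σ ℕ λ N → (χ : Vec (Fin k) N → Fin r) → MonoLine k N χ

constants : Vec A N → Template A N
constants = map just

fillIn-constants : (v : Vec A N) (a : A) → fillIn (constants v) a ≡ v
fillIn-constants []      a = refl
fillIn-constants (x ∷ v) a = cong (x ∷_) (fillIn-constants v a)

fillIn-++ : (w : Template A N) (w' : Template A N') (a : A) →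
            fillIn (w ++ w') a ≡ fillIn w a ++ fillIn w' a
fillIn-++ w w' a = map-++ (fromMaybe a) w w'

-- When a letter is added to the alphabet, `zero` is the new one and the old letters are shifted by
-- `suc`.
extend : Template (Fin k) N → Template (Fin (suc k)) N
extend = map (Maybe.map suc)

fillIn-extend : (w : Template (Fin k) N) (a : Fin k) →
                fillIn (extend w) (suc a) ≡ map suc (fillIn w a)
fillIn-extend []            a = refl
fillIn-extend (nothing ∷ w) a = cong (suc a ∷_) (fillIn-extend w a)
fillIn-extend (just x ∷ w)  a = cong (suc x ∷_) (fillIn-extend w a)

variable-extend : (w : Template (Fin k) N) → Variable w → Variable (extend w)
variable-extend (_ ∷ w) (here refl) = here refl
variable-extend (_ ∷ w) (there v)   = there (variable-extend w v)

module Focusing (k r : ℕ) (hj : ∀ r' → HJ (suc k) r') where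

  -- At the letter zero all lines pass through the same point.
  record Focused (m N : ℕ) (χ : Vec (Fin (suc (suc k))) N → Fin r) : Set where
    field
      focus    : Vec (Fin (suc (suc k))) N
      line     : Fin m → Template (Fin (suc (suc k))) N
      is-line  : ∀ i → Variable (line i)
      at-zero  : ∀ i → fillIn (line i) zero ≡ focus
      colour   : Fin m → Fin r
      at-suc   : ∀ i a → χ (fillIn (line i) (suc a)) ≡ colour i
      distinct : ∀ i j → i Fin.< j → colour i ≢ colour j

  FocusStep : ℕ → Set
  FocusStep m = Σ ℕ λ N → (χ : Vec (Fin (suc (suc k))) N → Fin r) →
    MonoLine (suc (suc k)) N χ ⊎ Focused m N χ

  close : ∀ {N} {χ : Vec (Fin (suc (suc k))) N → Fin r} (f : Focused m N χ) i →
          χ (Focused.focus f) ≡ Focused.colour f i → MonoLine (suc (suc k)) N χ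
  close {χ = χ} f i e = line i , is-line i , λ a b → trans (all a) (sym (all b))
    where
    open Focused f
    all : ∀ a → χ (fillIn (line i) a) ≡ colour i
    all zero    = trans (cong χ (at-zero i)) e
    all (suc a) = at-suc i a

  -- Colour focusing. A word of the first block is coloured by the colouring that it induces on the
  -- whole second block. A line that is monochromatic on the old letters therefore leaves one
  -- colouring `χ'` of the second block, in which `m` focused lines or a monochromatic line exist
  -- already.
  focusing : ∀ m → FocusStep m
  focusing zero = 0 , λ χ → inj₂ record
    { focus = [] ; line = λ () ; is-line = λ () ; at-zero = λ () ; colour = λ ()
    ; at-suc = λ () ; distinct = λ () }
  focusing (suc m) with focusing m
  ... | N₂ , foc with finite-Vec {n = N₂} (finite-Fin {suc (suc k)})
  ... | FV with hj (r ^ Finite.size FV)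
  ... | N₁ , hj₁ = N₁ + N₂ , go
    where
    go : (χ : Vec (Fin (suc (suc k))) (N₁ + N₂) → Fin r) →
         MonoLine (suc (suc k)) (N₁ + N₂) χ ⊎ Focused (suc m) (N₁ + N₂) χ
    go χ with hj₁ (λ v → code FV (λ z → χ (map suc v ++ z)))
    ... | w , w-var , w-mono = result
      where
      L : Template (Fin (suc (suc k))) N₁
      L = extend w
      χ' : Vec (Fin (suc (suc k))) N₂ → Fin r
      χ' z = χ (fillIn L (suc zero) ++ z)
      unify : ∀ a z → χ (fillIn L (suc a) ++ z) ≡ χ' z
      unify a z = begin
        χ (fillIn L (suc a) ++ z)       ≡⟨ cong (λ v → χ (v ++ z)) (fillIn-extend w a) ⟩
        χ (map suc (fillIn w a) ++ z)   ≡⟨ decode-code FV _ z ⟨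
        decode FV _ z                   ≡⟨ cong (λ c → decode FV c z) (w-mono a zero) ⟩
        decode FV _ z                   ≡⟨ decode-code FV _ z ⟩
        χ (map suc (fillIn w zero) ++ z) ≡⟨ cong (λ v → χ (v ++ z)) (fillIn-extend w zero) ⟨
        χ' z                            ∎
        where open ≡-Reasoning
      L-var : Variable L
      L-var = variable-extend w w-var
      mono : MonoLine (suc (suc k)) N₂ χ' → MonoLine (suc (suc k)) (N₁ + N₂) χ
      mono (u , u-var , u-mono) = constants v ++ u , AnyP.++⁺ʳ (constants v) u-var ,
        λ a b → trans (cong χ (eq a)) (trans (u-mono a b) (cong χ (sym (eq b))))
        where
        v = fillIn L (suc zero)
        eq : ∀ a → fillIn (constants v ++ u) a ≡ v ++ fillIn u a
        eq a = trans (fillIn-++ (constants v) u a) (cong (_++ fillIn u a) (fillIn-constants v a))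
      grow : (f : Focused m N₂ χ') → (∀ i → χ' (Focused.focus f) ≢ Focused.colour f i) →
             Focused (suc m) (N₁ + N₂) χ
      grow f new = record
        { focus = fillIn L zero ++ focus
        ; line = lines
        ; is-line = λ { zero → AnyP.++⁺ˡ L-var ; (suc i) → AnyP.++⁺ˡ L-var }
        ; at-zero = λ { zero → trans (fillIn-++ L (constants focus) zero)
                                 (cong (fillIn L zero ++_) (fillIn-constants focus zero))
                      ; (suc i) → trans (fillIn-++ L (line i) zero)
                                 (cong (fillIn L zero ++_) (at-zero i)) }
        ; colour = colours
        ; at-suc = λ { zero a → trans (cong χ (trans (fillIn-++ L (constants focus) (suc a))
                                  (cong (fillIn L (suc a) ++_) (fillIn-constants focus (suc a)))))
                                  (unify a focus)
                     ; (suc i) a → trans (cong χ (fillIn-++ L (line i) (suc a)))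
                                  (trans (unify a (fillIn (line i) (suc a))) (at-suc i a)) }
        ; distinct = λ { zero (suc j) _ → new j ; (suc i) (suc j) (s≤s i<j) → distinct i j i<j } }
        where
        open Focused f
        -- The new line moves in the first block only, the old ones now move in both blocks. All of
        -- them still meet at the letter `zero`, in `fillIn L zero ++ focus`.
        lines : Fin (suc m) → Template (Fin (suc (suc k))) (N₁ + N₂)
        lines zero    = L ++ constants focus
        lines (suc i) = L ++ line i
        colours : Fin (suc m) → Fin r
        colours zero    = χ' focus
        colours (suc i) = colour i
      result : MonoLine (suc (suc k)) (N₁ + N₂) χ ⊎ Focused (suc m) (N₁ + N₂) χ
      result with foc χ'
      ... | inj₁ line = inj₁ (mono line)
      ... | inj₂ f with FinP.any? (λ i → χ' (Focused.focus f) Fin.≟ Focused.colour f i)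
      ...   | yes (i , e) = inj₁ (mono (close f i e))
      ...   | no ¬e       = inj₂ (grow f (λ i e → ¬e (i , e)))

  hales-jewett-step : HJ (suc (suc k)) r
  -- With `r` colours, `suc r` focused lines cannot have distinct colours, so the alternative of a
  -- monochromatic line must have occurred.
  hales-jewett-step with focusing (suc r)
  ... | N , foc = N , λ χ → finish χ (foc χ)
    where
    finish : ∀ χ → MonoLine (suc (suc k)) N χ ⊎ Focused (suc r) N χ → MonoLine (suc (suc k)) N χ
    finish χ (inj₁ line) = line
    finish χ (inj₂ f) with FinP.pigeonhole (n<1+n r) (Focused.colour f)
    ... | i , j , i<j , e = ⊥-elim (Focused.distinct f i j i<j e)

hales-jewett : ∀ k r → HJ (suc k) r
hales-jewett zero    r = 1 , λ χ → nothing ∷ [] , here refl , λ { zero zero → refl }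
hales-jewett (suc k) r = Focusing.hales-jewett-step k r (hales-jewett k)

-- Labels off the way to a vertex

mapP-glue : (f : X → Y) (z : Pre X true (σ ∷ [])) (q : Pre X b H) →
            mapP f (glue z q) ≡ glue (mapP f z) (mapP f q)
mapP-glue f (right x l end) q = refl

skipTree : Pre (Fin n) true (σ ∷ []) → FMor n H' H → FMor n (σ ∷ H') H
skipTree (right a l end) h = skip a l h

pev-skipTree : (ρ : Vec X n) (z : Pre (Fin n) true (σ ∷ [])) (h : FMor n H' H) (q : Pre X b H) →
               pev ρ (skipTree z h) q ≡ glue (val ρ z) (pev ρ h q)
pev-skipTree ρ (right a l end) h q = refl

instantiate : Maybe (Fin n) → Fin (suc n)
instantiate nothing  = zero
instantiate (just a) = suc a

lookup-instantiate : (x : Fin n) (a : Maybe (Fin n)) →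
                     lookup (x ∷ allFin n) (instantiate a) ≡ fromMaybe x a
lookup-instantiate x nothing  = refl
lookup-instantiate x (just a) = lookup-allFin a

-- The coloured labellings use positions of ancestors, the same set from which `t` takes its labels
-- outside the copy. This is the case of a fixed set K.
KillsLabels : ℕ → Forest → ℕ → Set
KillsLabels n F r = Σ Forest λ F' → (ω : Pre (Fin n) true F' → Fin r) →
  Σ (FMor n F' F) λ t → Σ (Fin r) λ c → ∀ l → ω (pev (allFin n) t l) ≡ c

KillsTreeLabels : ℕ → Forest → ℕ → Set
KillsTreeLabels n G r = Σ Tree λ Z → (ω : Pre (Fin n) true (Z ∷ []) → Fin r) →
  Σ (FMor n (Z ∷ []) (node G ∷ [])) λ t → Σ (Fin r) λ c → ∀ l → ω (pev (allFin n) t l) ≡ c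

-- A path of N vertices carrying copies of G, whose labels have been made
-- irrelevant one after the other: only the word on the path matters.
PathOf : ℕ → Forest → ℕ → ℕ → Set
PathOf n G N r = Σ Tree λ Z → (ω : Pre (Fin n) true (Z ∷ []) → Fin r) →
  Σ (Vec (Fin n) N → Fin r) λ col →
    (∀ (w : Vec (Fin (suc n)) N) → Σ (Pre (Fin (suc n)) true (Z ∷ [])) λ z →
      ∀ x → ω (val (x ∷ allFin n) z) ≡ col (map (lookup (x ∷ allFin n)) w)) ×
    (∀ (w : Template (Fin n) N) → Variable w → Σ (FMor n (Z ∷ []) (node G ∷ [])) λ t →
      ∀ x l → ω (pev (allFin n) t (right x l end)) ≡ col (fillIn w x))

-- Induction on the length, with the shorter path `Z` and a forest `G'` placed below the new vertex.
-- The two parts of `PathOf` answer to the two possibilities for that vertex: if the root of the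
-- copy lies further along, `Z` has to supply a morphism; if the new vertex is itself the root, `Z`
-- lies outside the copy and only has to be labelled.
path : (∀ r → KillsLabels (suc n) G r) → ∀ N r → PathOf (suc n) G N r
path {n} {G} kill zero r = node [] , λ ω → (λ _ → ω (right zero end end)) ,
  (λ { [] → right (suc zero) end end , λ x → refl }) , (λ { [] () })
path {n} {G} kill (suc N) r
  with finite-Fin {suc n}
... | FK with path {n} {G} kill N (r ^ Finite.size FK)
... | Z , IH with finite-× FK (finite-Pre FK {true} {Z ∷ []})
... | FA with kill (r ^ Finite.size FA)
... | G' , killG = node (Z ∷ G') , go
  where
  ι : Vec (Fin (suc n)) (suc n)
  ι = allFin (suc n)
  go : (ω : Pre (Fin (suc n)) true (node (Z ∷ G') ∷ []) → Fin r) → _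
  -- The labels of `G'` are made irrelevant for every label `x` of the new vertex and every
  -- labelling `z` of `Z` at once; what remains colours the pairs `(x , z)`.
  go ω with killG (λ l → code FA (λ (x , z) → ω (right x (glue z l) end)))
  ... | tG , cG , kG with IH (λ z → code FK (λ x → decode FA cG (x , z)))
  ... | col' , lab , lin = col , labels , lines
    where
    col : Vec (Fin (suc n)) (suc N) → Fin r
    col (x ∷ w) = decode FK (col' w) x
    key : ∀ x z l {w} → code FK (λ x → decode FA cG (x , z)) ≡ col' w →
          ω (right x (glue z (pev ι tG l)) end) ≡ col (x ∷ w)
    key x z l {w} e = begin
      ω (right x (glue z (pev ι tG l)) end)
        ≡⟨ decode-code FA (λ (x , z) → ω (right x (glue z (pev ι tG l)) end)) (x , z) ⟨
      decode FA _ (x , z)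
        ≡⟨ cong (λ c → decode FA c (x , z)) (kG l) ⟩
      decode FA cG (x , z)
        ≡⟨ decode-code FK (λ x → decode FA cG (x , z)) x ⟨
      decode FK _ x
        ≡⟨ cong (λ c → decode FK c x) e ⟩
      col (x ∷ w) ∎
      where open ≡-Reasoning
    -- `G'` is always labelled through `tG`, since `kG` controls no other labellings.
    rest : Pre (Fin (suc n)) true G'
    rest = pev ι tG (fill zero)
    labels : ∀ (w : Vec (Fin (suc (suc n))) (suc N)) →
      Σ (Pre (Fin (suc (suc n))) true (node (Z ∷ G') ∷ [])) λ z →
        ∀ x → ω (val (x ∷ ι) z) ≡ col (map (lookup (x ∷ ι)) w)
    labels (a ∷ w) with lab w
    ... | z , zc = right a (glue z (mapP suc rest)) end , λ x →
      trans (cong (λ q → ω (right _ q end))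
              (trans (mapP-glue (lookup (x ∷ ι)) z (mapP suc rest))
                (cong (glue _) (trans (mapP-∘ (lookup (x ∷ ι)) suc rest) (val-id rest)))))
            (key _ _ _ (zc x))
    lines : ∀ (w : Template (Fin (suc n)) (suc N)) → Variable w →
      Σ (FMor (suc n) (node (Z ∷ G') ∷ []) (node G ∷ [])) λ t →
        ∀ x l → ω (pev ι t (right x l end)) ≡ col (fillIn w x)
    -- First wildcard: the new vertex becomes the root. The later wildcards of the path repeat its
    -- label, which is the ancestor `zero` from there on, and `G` is found in `G'`.
    lines (nothing ∷ w) _ with lab (map instantiate w)
    ... | z , zc = keep (skipTree z (wk tG)) nil , λ x l →
      trans (cong (λ q → ω (right x q end))
              (trans (pev-skipTree (x ∷ ι) z (wk tG) l)
                (cong (glue _) (pev-wk x ι tG l))))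
            (key x _ l (trans (zc x) (cong col'
              (trans (sym (map-∘ (lookup (x ∷ ι)) instantiate w))
                     (map-cong (lookup-instantiate x) w)))))
    -- Constant letter: the new vertex stays outside the copy with label `a`, and the copy lies in
    -- `Z`.
    lines (just a ∷ w) (there v) with lin w v
    ... | t , tc = into a (t ◂ constM rest) nil , λ x l →
      trans (cong (λ q → ω (right _ q end))
              (trans (pev-glue ι t (constM rest) (right x l end) end)
                (cong (glue _) (trans (pev-constM ι rest) (val-id rest)))))
            (trans (key _ _ _ (tc x l)) (cong (λ a → col (a ∷ fillIn w x)) (lookup-allFin a)))

-- After `path` the label `x` of the root is all that the colour may still depend on, and the colour
-- is that of the word `fillIn w x`. A monochromatic line removes this dependence.
killsTreeLabels : (∀ r → KillsLabels (suc n) G r) → ∀ r → KillsTreeLabels (suc n) G r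
killsTreeLabels {n} {G} kill r with hales-jewett n r
... | N , hj with path {n} {G} kill N r
... | Z , p = Z , go
  where
  go : (ω : Pre (Fin (suc n)) true (Z ∷ []) → Fin r) → _
  go ω with p ω
  ... | col , _ , lin with hj col
  ... | w , v , mono with lin w v
  ... | t , tc = t , col (fillIn w zero) , λ { (right x l end) → trans (tc x l) (mono x zero) }

killsLabels : ∀ n F r → KillsLabels (suc n) F r
killsLabels n []           r = [] , λ ω → nil , ω end , λ { end → refl }
killsLabels n (node G ∷ F) r with killsLabels n F r
... | F' , killF with finite-Pre (finite-Fin {suc n}) {true} {F'}
... | FA with killsTreeLabels {n} {G} (killsLabels n G) (r ^ Finite.size FA)
... | Z , killZ = Z ∷ F' , go
  where
  ι : Vec (Fin (suc n)) (suc n)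
  ι = allFin (suc n)
  go : (ω : Pre (Fin (suc n)) true (Z ∷ F') → Fin r) → _
  -- The first tree is treated for all labellings `q` of the remaining trees at once, which leaves a
  -- colouring of those trees alone.
  go ω with killZ (λ z → code FA (λ q → ω (glue z q)))
  ... | tZ , cZ , kZ with killF (decode FA cZ)
  ... | tF , cF , kF = tZ ◂ tF , cF , λ { (right x l q) → begin
      ω (pev ι (tZ ◂ tF) (right x l q))
        ≡⟨ cong ω (pev-glue ι tZ tF (right x l end) q) ⟩
      ω (glue (pev ι tZ (right x l end)) (pev ι tF q))
        ≡⟨ decode-code FA (λ q → ω (glue (pev ι tZ (right x l end)) q)) (pev ι tF q) ⟨
      decode FA _ (pev ι tF q)
        ≡⟨ cong (λ c → decode FA c (pev ι tF q)) (kZ (right x l end)) ⟩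
      decode FA cZ (pev ι tF q)
        ≡⟨ kF q ⟩
      cF ∎ }
    where open ≡-Reasoning

-- Colourings determined by the chain of predecessors of a vertex

-- Equality of the words of directions and labels read along the way to the vertex. Labels in the
-- trees passed on the left are free.
data _~_ {X : Set} : Pre X false F → Pre X false F → Set where
  here~  : here {G = G} {F = F} ~ here
  down~  : ∀ {x} {p p' : Pre X false G} → p ~ p' → down {F = F} x p ~ down x p'
  right~ : ∀ {x x'} {l l' : Pre X true G} {p p' : Pre X false F} →
           p ~ p' → right x l p ~ right x' l' p'

~-refl : {p : Pre X false F} → p ~ p
~-refl {p = here}        = here~
~-refl {p = down x p}    = down~ ~-refl
~-refl {p = right x l p} = right~ ~-refl

~-reflexive : {p q : Pre X false F} → p ≡ q → p ~ q
~-reflexive refl = ~-refl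

~-trans : {p q s : Pre X false F} → p ~ q → q ~ s → p ~ s
~-trans here~      here~       = here~
~-trans (down~ e)  (down~ e')  = down~ (~-trans e e')
~-trans (right~ e) (right~ e') = right~ (~-trans e e')

pev-~ : (ρ : Vec X n) (t : FMor n F' F) {p q : Pre X false F} → p ~ q → pev ρ t p ~ pev ρ t q
pev-~ ρ nil          ()
pev-~ ρ (skip a l h) e          = right~ (pev-~ ρ h e)
pev-~ ρ (keep g h)   here~      = here~
pev-~ ρ (keep g h)   (down~ e)  = down~ (pev-~ _ g e)
pev-~ ρ (keep g h)   (right~ e) = right~ (pev-~ ρ h e)
pev-~ ρ (into a g h) here~      = ~-refl
pev-~ ρ (into a g h) (down~ e)  = down~ (pev-~ ρ g (down~ e))
pev-~ ρ (into a g h) (right~ e) = right~ (pev-~ ρ h e)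

lift-~ : {p q : Pre X false (σ ∷ [])} → p ~ q → lift {H = H} p ~ lift q
lift-~ here~       = here~
lift-~ (down~ e)   = down~ e
lift-~ (right~ {p = ()} e)

Invariant : (Pre X false F → Fin r) → Set
Invariant χ = ∀ {p q} → p ~ q → χ p ≡ χ q

-- For a vertex beyond the first tree, all labels of that tree lie off the way and are killed at
-- once. For a vertex inside it, the label of the root lies on the way and is kept as an argument of
-- the coded colour, while the recursion deals with the rest.
toChains : ∀ n F r → Σ Forest λ F' → (χ : Pre (Fin (suc n)) false F' → Fin r) →
  Σ (FMor (suc n) F' F) λ t → Invariant (λ p → χ (pev (allFin (suc n)) t p))
toChains n []           r = [] , λ χ → nil , λ {}
toChains n (node G ∷ F) r with toChains n F r
... | F' , chF with finite-Fin {suc n}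
... | FK with toChains n G (r ^ Finite.size FK)
... | G' , chG with finite-Pre FK {false} {F'}
... | FA with killsTreeLabels {n} {G'} (killsLabels n G') (r ^ Finite.size FA)
... | Z , killZ = Z ∷ F' , go
  where
  ι : Vec (Fin (suc n)) (suc n)
  ι = allFin (suc n)
  go : (χ : Pre (Fin (suc n)) false (Z ∷ F') → Fin r) →
    Σ (FMor (suc n) (Z ∷ F') (node G ∷ F)) λ t → Invariant (λ p → χ (pev ι t p))
  go χ with killZ (λ z → code FA (λ q → χ (glue z q)))
  ... | tZ , cZ , kZ with chF (decode FA cZ)
  ... | tF , iF with chG (λ p → code FK (λ x → χ (lift (pev ι tZ (down x p)))))
  ... | tG , iG = tT ◂ tF , inv
    where
    open ≡-Reasoning
    -- `tG` has to serve every root label `x`; `wk` places it below the root without using that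
    -- label.
    tT : FMor (suc n) (Z ∷ []) (node G ∷ [])
    tT = tZ ∙ keep (wk tG) nil
    below : ∀ x p → χ (pev ι (tT ◂ tF) (down x p)) ≡
            decode FK (code FK (λ x → χ (lift (pev ι tZ (down x (pev ι tG p)))))) x
    below x p = begin
      χ (pev ι (tT ◂ tF) (down x p))
        ≡⟨ cong χ (pev-lift ι tT tF (down x p)) ⟩
      χ (lift (pev ι tT (down x p)))
        ≡⟨ cong (χ ∘ lift) (pev-∙ ι tZ (keep (wk tG) nil) (down x p)) ⟩
      χ (lift (pev ι tZ (down x (pev (x ∷ ι) (wk tG) p))))
        ≡⟨ cong (λ q → χ (lift (pev ι tZ (down x q)))) (pev-wk x ι tG p) ⟩
      χ (lift (pev ι tZ (down x (pev ι tG p))))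
        ≡⟨ decode-code FK _ x ⟨
      decode FK (code FK (λ x → χ (lift (pev ι tZ (down x (pev ι tG p)))))) x ∎
    beyond : ∀ x l p → χ (pev ι (tT ◂ tF) (right x l p)) ≡ decode FA cZ (pev ι tF p)
    beyond x l p = begin
      χ (pev ι (tT ◂ tF) (right x l p))
        ≡⟨ cong χ (pev-glue ι tT tF (right x l end) p) ⟩
      χ (glue (pev ι tT (right x l end)) (pev ι tF p))
        ≡⟨ cong (λ z → χ (glue z (pev ι tF p))) (pev-∙ ι tZ (keep (wk tG) nil) (right x l end)) ⟩
      χ (glue (pev ι tZ (pev ι (keep (wk tG) nil) (right x l end))) (pev ι tF p))
        ≡⟨ decode-code FA (λ q → χ (glue (pev ι tZ (right x (pev (x ∷ ι) (wk tG) l) end)) q)) (pev ι tF p) ⟨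
      decode FA _ (pev ι tF p)
        ≡⟨ cong (λ c → decode FA c (pev ι tF p)) (kZ (right x (pev (x ∷ ι) (wk tG) l) end)) ⟩
      decode FA cZ (pev ι tF p) ∎
    inv : Invariant (λ p → χ (pev ι (tT ◂ tF) p))
    inv here~ = refl
    inv (down~ {x = x} {p} {p'} e) =
      trans (below x p) (trans (cong (λ c → decode FK c x) (iG e)) (sym (below x p')))
    inv (right~ {x = x} {x'} {l} {l'} {p} {p'} e) =
      trans (beyond x l p) (trans (iF e) (sym (beyond x' l' p')))

-- Labels and directions on the way to a vertex

data Sel {r} (c : Fin r) : Vec (Fin r) N → ℕ → Set where
  done : Sel c [] 0
  take : ∀ {cs : Vec (Fin r) N} → Sel c cs m → Sel c (c ∷ cs) (suc m)
  drop : ∀ {x} {cs : Vec (Fin r) N} → Sel c cs m → Sel c (x ∷ cs) m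

select-none : {c : Fin r} (cs : Vec (Fin r) N) → Sel c cs 0
select-none []       = done
select-none (x ∷ cs) = drop (select-none cs)

-- Each entry lowers either the number `a` of zeros still wanted or the number `k` of other entries
-- still wanted. Selections from the collected list `ds`, whose colours are shifted down by one,
-- lift back to `cs`.
select-zero : ∀ a k → a + k ≤ N → (cs : Vec (Fin (suc r)) N) →
  Sel zero cs a ⊎ Σ (Vec (Fin r) k) λ ds → ∀ c m → Sel c ds m → Sel (suc c) cs m
select-zero zero    k       _       cs = inj₁ (select-none cs)
select-zero (suc a) zero    _       cs = inj₂ ([] , λ { c .0 done → select-none cs })
select-zero (suc a) (suc k) (s≤s h) (zero ∷ cs) with select-zero a (suc k) h cs
... | inj₁ s        = inj₁ (take s)
... | inj₂ (ds , f) = inj₂ (ds , λ c m s → drop (f c m s))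
select-zero (suc a) (suc k) (s≤s {n = N} h) (suc x ∷ cs)
  with select-zero (suc a) k (subst (_≤ N) (+-suc a k) h) cs
... | inj₁ s        = inj₁ (drop s)
... | inj₂ (ds , f) = inj₂ (x ∷ ds , λ { c m (drop s) → drop (f c m s)
                                       ; c (suc m) (take s) → take (f c m s) })

pigeonhole : ∀ r m → Σ ℕ λ N → (cs : Vec (Fin r) N) → Σ (Fin r) λ c → Sel c cs m
pigeonhole zero    m = 1 , λ { (() ∷ _) }
pigeonhole (suc r) m with pigeonhole r m
... | N , ph = m + N , λ cs → pick cs (select-zero m N ≤-refl cs)
  where
  pick : ∀ cs → Sel zero cs m ⊎ (Σ (Vec (Fin r) N) λ ds → ∀ c k → Sel c ds k → Sel (suc c) cs k) →
         Σ (Fin (suc r)) λ c → Sel c cs m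
  pick cs (inj₁ s)        = zero , s
  pick cs (inj₂ (ds , f)) = suc (proj₁ (ph ds)) , f _ m (proj₂ (ph ds))

rep : ℕ → Tree → Forest
rep = List.replicate

fillT : X → Pre X true (σ ∷ [])
fillT {σ = node G} x = right x (fill x) end

glue-~ : {z z' : Pre X true (σ ∷ [])} {p q : Pre X false H} → p ~ q → glue z p ~ glue z' q
glue-~ {z = right _ _ _} {right _ _ _} e = right~ e

lift-self : (z : Pre X false (σ ∷ [])) → lift z ≡ z
lift-self here       = refl
lift-self (down x p) = refl

-- The label `d` fills the trees to the left of the `i`-th one. Up to `_~_` its choice is
-- immaterial, and only the direction `i` is left.
atTree : X → Fin m → Pre X false (σ ∷ []) → Pre X false (rep m σ)
atTree d zero    z = lift z
atTree d (suc i) z = glue (fillT d) (atTree d i z)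

atTree-~ : (d d' : X) (i : Fin m) {z z' : Pre X false (σ ∷ [])} → z ~ z' →
           atTree d i z ~ atTree d' i z'
atTree-~ d d' zero    e = lift-~ e
atTree-~ d d' (suc i) e = glue-~ (atTree-~ d d' i e)

classify : (d : X) (p : Pre X false (rep m σ)) →
           Σ (Fin m) λ i → Σ (Pre X false (σ ∷ [])) λ z → p ~ atTree d i z
classify {m = zero}  d ()
classify {m = suc m} d here          = zero , here , here~
classify {m = suc m} d (down x p)    = zero , down x p , ~-refl
classify {m = suc m} d (right x l p) with classify d p
... | i , z , e = suc i , z , right~ e

allM : (Fin m → FMor n (σ ∷ []) (τ ∷ [])) → FMor n (rep m σ) (rep m τ)
allM {m = zero}  f = nil
allM {m = suc m} f = f zero ◂ allM (f ∘ suc)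

pev-allM : (ρ : Vec X n) (f : Fin m → FMor n (σ ∷ []) (τ ∷ [])) (d : X) (i : Fin m)
           (z : Pre X false (τ ∷ [])) →
           pev ρ (allM f) (atTree d i z) ~ atTree d i (pev ρ (f i) z)
pev-allM ρ f d zero    z = ~-reflexive (pev-lift ρ (f zero) (allM (f ∘ suc)) z)
pev-allM ρ f d (suc i) z =
  ~-trans (~-reflexive (pev-glue ρ (f zero) (allM (f ∘ suc)) (fillT d) (atTree d i z)))
          (glue-~ (pev-allM ρ (f ∘ suc) d i z))

oneM : Fin m → FMor (suc n) (σ ∷ []) (τ ∷ []) → FMor (suc n) (rep m σ) (τ ∷ [])
oneM zero    t = t ◂ constM (fill zero)
oneM (suc i) t = skipTree (fillT zero) (oneM i t)

pev-oneM : (ρ : Vec X (suc n)) (d : X) (i : Fin m) (t : FMor (suc n) (σ ∷ []) (τ ∷ []))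
           (z : Pre X false (τ ∷ [])) → pev ρ (oneM i t) z ~ atTree d i (pev ρ t z)
pev-oneM ρ d zero    t z = ~-reflexive
  (trans (cong (pev ρ (t ◂ constM (fill zero))) (sym (lift-self z)))
         (pev-lift ρ t (constM (fill zero)) z))
pev-oneM ρ d (suc i) t z =
  ~-trans (~-reflexive (pev-skipTree ρ (fillT zero) (oneM i t) z)) (glue-~ (pev-oneM ρ d i t z))

pev-into : (ρ : Vec X n) (a : Fin n) (g : FMor n G' (τ ∷ [])) (z : Pre X false (τ ∷ [])) →
           pev ρ (into a g nil) z ≡ down (lookup ρ a) (pev ρ g z)
pev-into ρ a g here       = refl
pev-into ρ a g (down x p) = refl

-- The `k`-ary tree with `N` levels of branching and a copy of `σ` at each end. Its ends are the
-- words of `N` directions, so `along` reads a word over directions times labels.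
block : ℕ → ℕ → Tree → Tree
block k zero    σ = σ
block k (suc N) σ = node (rep k (block k N σ))

along : X → Vec (Fin k × X) N → Pre X false (σ ∷ []) → Pre X false (block k N σ ∷ [])
along d []            z = z
along d ((i , x) ∷ w) z = down x (atTree d i (along d w z))

along-~ : (d : X) (w : Vec (Fin k × X) N) {z z' : Pre X false (σ ∷ [])} → z ~ z' →
          along d w z ~ along d w z'
along-~ d []            e = e
along-~ d ((i , x) ∷ w) e = down~ (atTree-~ d d i (along-~ d w e))

valLetter : Vec X n → Fin k × Fin n → Fin k × X
valLetter ρ (i , a) = i , lookup ρ a

blockM : Vec (Fin k × Fin (suc n)) N → FMor (suc n) (σ ∷ []) (τ ∷ []) →
         FMor (suc n) (block k N σ ∷ []) (τ ∷ [])
blockM []            t = t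
blockM ((i , a) ∷ w) t = into a (oneM i (blockM w t)) nil

pev-blockM : (ρ : Vec X (suc n)) (d : X) (w : Vec (Fin k × Fin (suc n)) N)
             (t : FMor (suc n) (σ ∷ []) (τ ∷ [])) (z : Pre X false (τ ∷ [])) →
             pev ρ (blockM w t) z ~ along d (map (valLetter ρ) w) (pev ρ t z)
pev-blockM ρ d []            t z = ~-refl
pev-blockM ρ d ((i , a) ∷ w) t z =
  ~-trans (~-reflexive (pev-into ρ a (oneM i (blockM w t)) z))
    (down~ (~-trans (pev-oneM ρ d i (blockM w t) z) (atTree-~ d d i (pev-blockM ρ d w t z))))

-- Below the root of a copy, a wildcard follows the branch `i` in which it lies and repeats the
-- label of that root, which is the ancestor `zero`.
direct : Fin k → Maybe (Fin k × Fin n) → Fin k × Fin (suc n)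
direct i nothing        = i , zero
direct i (just (j , a)) = j , suc a

valLetter-direct : (x : Fin n) (i : Fin k) (l : Maybe (Fin k × Fin n)) →
                   valLetter (x ∷ allFin n) (direct i l) ≡ fromMaybe (i , x) l
valLetter-direct x i nothing        = refl
valLetter-direct x i (just (j , a)) = cong (j ,_) (lookup-allFin a)

-- The first wildcard of the template carries the root of the copy.
lineM : (w : Template (Fin k × Fin (suc n)) N) → Variable w →
        (∀ {N'} → Template (Fin k × Fin (suc n)) N' → FMor (suc (suc n)) (rep k (block k N' σ)) H) →
        FMor (suc n) (block k N σ ∷ []) (node H ∷ [])
lineM (nothing ∷ w)      v         f = keep (f w) nil
lineM (just (i , a) ∷ w) (there v) f = into a (oneM i (lineM w v f)) nil

firstWildcard : (w : Template (Fin k × Fin (suc n)) N) → Variable w →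
                Pre (Fin (suc n)) false (block k N σ ∷ [])
firstWildcard (nothing ∷ w)      v         = here
firstWildcard (just (i , a) ∷ w) (there v) = down a (atTree zero i (firstWildcard w v))

down≡~ : {x y : X} {p q : Pre X false G} → x ≡ y → p ~ q →
         down {F = F} x p ~ down y q
down≡~ refl e = down~ e

pev-lineM-here : (w : Template (Fin k × Fin (suc n)) N) (v : Variable w)
  (f : ∀ {N'} → Template (Fin k × Fin (suc n)) N' → FMor (suc (suc n)) (rep k (block k N' σ)) H) →
  pev (allFin (suc n)) (lineM {σ = σ} {H = H} w v f) here ~ firstWildcard w v
pev-lineM-here (nothing ∷ w)      v         f = here~
pev-lineM-here (just (i , a) ∷ w) (there v) f =
  down≡~ (lookup-allFin a)
    (~-trans (pev-oneM _ zero i (lineM w v f) here) (atTree-~ zero zero i (pev-lineM-here w v f)))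

branches : FMor (suc n) (σ ∷ []) (τ ∷ []) → Template (Fin k × Fin (suc n)) N →
           FMor (suc (suc n)) (rep k (block k N σ)) (rep k τ)
branches t w = allM (λ i → blockM (map (direct i) w) (wk t))

-- In the `i`-th branch every wildcard position, the root included, carries the letter `(i , x)`. A
-- vertex there is thus reached along a single point of the combinatorial line, whatever `i` and `x`
-- are.
pev-lineM-down : (w : Template (Fin k × Fin (suc n)) N) (v : Variable w)
  (t : FMor (suc n) (σ ∷ []) (τ ∷ [])) (x : Fin (suc n)) {p : Pre (Fin (suc n)) false (rep k τ)}
  (i : Fin k) (z : Pre (Fin (suc n)) false (τ ∷ [])) → p ~ atTree zero i z →
  pev (allFin (suc n)) (lineM w v (branches t)) (down x p) ~
  along zero (fillIn w (i , x)) (pev (allFin (suc n)) t z)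
pev-lineM-down {n = n} (nothing ∷ w) v t x i z e = down~
  (~-trans (pev-~ (x ∷ ι) (branches t w) e)
  (~-trans (pev-allM (x ∷ ι) (λ i → blockM (map (direct i) w) (wk t)) zero i z)
  (atTree-~ zero zero i
    (~-trans (pev-blockM (x ∷ ι) zero (map (direct i) w) (wk t) z)
      (~-reflexive (cong₂ (along zero)
        (trans (sym (map-∘ (valLetter (x ∷ ι)) (direct i) w)) (map-cong (valLetter-direct x i) w))
        (pev-wk x ι t z)))))))
  where ι = allFin (suc n)
pev-lineM-down (just (j , a) ∷ w) (there v) t x i z e =
  down≡~ (lookup-allFin a)
    (~-trans (pev-oneM _ zero j (lineM w v (branches t)) (down x _))
             (atTree-~ zero zero j (pev-lineM-down w v t x i z e)))

hales-jewett-× : ∀ k n r → Σ ℕ λ N → (χ : Vec (Fin (suc k) × Fin (suc n)) N → Fin r) →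
  Σ (Template (Fin (suc k) × Fin (suc n)) N) λ w →
    Variable w × (∀ a b → χ (fillIn w a) ≡ χ (fillIn w b))
hales-jewett-× k n r with hales-jewett (n + k * suc n) r
... | N , hj = N , go
  where
  Letter = Fin (suc k) × Fin (suc n)
  letter : Fin (suc k * suc n) → Letter
  letter = Fin.remQuot (suc n)
  fill-map : ∀ {M} (w : Template (Fin (suc k * suc n)) M) i →
             fillIn (map (Maybe.map letter) w) (letter i) ≡ map letter (fillIn w i)
  fill-map []            i = refl
  fill-map (nothing ∷ w) i = cong (_ ∷_) (fill-map w i)
  fill-map (just _ ∷ w)  i = cong (_ ∷_) (fill-map w i)
  var-map : ∀ {M} (w : Template (Fin (suc k * suc n)) M) → Variable w →
            Variable (map (Maybe.map letter) w)
  var-map (_ ∷ w) (here refl) = here refl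
  var-map (_ ∷ w) (there v)   = there (var-map w v)
  go : (χ : Vec Letter N → Fin r) → Σ (Template Letter N) λ w →
       Variable w × (∀ a b → χ (fillIn w a) ≡ χ (fillIn w b))
  go χ with hj (χ ∘ map letter)
  ... | w , v , mono = map (Maybe.map letter) w , var-map w v ,
    λ a b → trans (at a) (trans (mono _ _) (sym (at b)))
    where
    at : ∀ a → χ (fillIn (map (Maybe.map letter) w) a) ≡
               χ (map letter (fillIn w (Fin.combine (proj₁ a) (proj₂ a))))
    at (i , x) = cong χ (trans
      (cong (fillIn (map (Maybe.map letter) w)) (sym (FinP.remQuot-combine i x)))
      (fill-map w (Fin.combine i x)))

regular : ℕ → ℕ → Forest
regular k zero    = []
regular k (suc d) = rep k (node (regular k d))

-- The vector lists the colours of the D levels of a copy of a regular tree on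
-- which only the level matters.
carlson-simpson : ∀ n k D r → Σ Tree λ V → (χ : Pre (Fin (suc n)) false (V ∷ []) → Fin r) →
  Invariant χ → Σ (Vec (Fin r) D) λ cs → ∀ c d → Sel c cs (suc d) →
  Σ (FMor (suc n) (V ∷ []) (node (regular (suc k) d) ∷ [])) λ t →
    ∀ p → χ (pev (allFin (suc n)) t p) ≡ c
carlson-simpson n k zero    r = node [] , λ χ _ → [] , λ c d ()
carlson-simpson n k (suc D) r with carlson-simpson n k D r
... | V , IH with finite-Pre (finite-Fin {suc n}) {false} {V ∷ []}
... | FV with hales-jewett-× k n (r ^ Finite.size FV)
... | N , hj = block (suc k) N V , go
  where
  ι : Vec (Fin (suc n)) (suc n)
  ι = allFin (suc n)
  go : (χ : Pre (Fin (suc n)) false (block (suc k) N V ∷ []) → Fin r) → Invariant χ →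
    Σ (Vec (Fin r) (suc D)) λ cs → ∀ c d → Sel c cs (suc d) →
    Σ (FMor (suc n) (block (suc k) N V ∷ []) (node (regular (suc k) d) ∷ [])) λ t →
      ∀ p → χ (pev ι t p) ≡ c
  -- A word is coloured by the whole colouring that it induces on the tree `V` at its end.
  go χ inv with hj (λ w → code FV (λ z → χ (along zero w z)))
  ... | w , v , mono with IH (λ z → χ (along zero (fillIn w (zero , zero)) z))
                             (λ e → inv (along-~ zero (fillIn w (zero , zero)) e))
  -- Only constant letters precede the first wildcard, so the colour of the vertex there does not
  -- depend on the letter filled in. It is the colour of the new level; the levels below come from
  -- the colouring of `V` shared by the whole line.
  ... | cs , sel = χ (firstWildcard w v) ∷ cs , result
    where
    w₀ : Vec (Fin (suc k) × Fin (suc n)) N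
    w₀ = fillIn w (zero , zero)
    same : ∀ a z → χ (along zero (fillIn w a) z) ≡ χ (along zero w₀ z)
    same a z = trans (sym (decode-code FV (λ z → χ (along zero (fillIn w a) z)) z))
      (trans (cong (λ c → decode FV c z) (mono a (zero , zero)))
             (decode-code FV (λ z → χ (along zero w₀ z)) z))
    val-w₀ : map (valLetter ι) w₀ ≡ w₀
    val-w₀ = trans (map-cong (λ (i , a) → cong (i ,_) (lookup-allFin a)) w₀) (map-id w₀)
    result : ∀ c d → Sel c (χ (firstWildcard w v) ∷ cs) (suc d) →
      Σ (FMor (suc n) (block (suc k) N V ∷ []) (node (regular (suc k) d) ∷ [])) λ t →
        ∀ p → χ (pev ι t p) ≡ c
    -- If the new level is not selected, the copy lies entirely at the end of the word `w₀`.
    result c d (drop s) with sel c d s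
    ... | t , tc = blockM w₀ t , λ p → trans
      (inv (~-trans (pev-blockM ι zero w₀ t p)
             (~-reflexive (cong (λ w → along zero w (pev ι t p)) val-w₀))))
      (tc p)
    result c zero (take s) = lineM w v (λ _ → constM (fill zero)) ,
      λ { here → inv (pev-lineM-here w v _) ; (down x ()) }
    result c (suc d) (take s) with sel c d s
    ... | t , tc = lineM w v (branches t) , colour
      where
      colour : ∀ p → χ (pev ι (lineM w v (branches t)) p) ≡ c
      colour here       = inv (pev-lineM-here w v _)
      colour (down x p) with classify zero p
      ... | i , z , e =
        trans (inv (pev-lineM-down w v t x i z e)) (trans (same (i , x) (pev ι t z)) (tc z))

-- By invariance the colour of a vertex does not see the labels of the trees to its left, so a tree
-- of the wrong colour can be skipped with any labels.
pickTrees : (χ : Pre (Fin (suc n)) false (rep N σ) → Fin r) → Invariant χ →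
  (t : FMor (suc n) (σ ∷ []) (τ ∷ [])) {cs : Vec (Fin r) N} →
  (∀ i z → χ (atTree zero i (pev (allFin (suc n)) t z)) ≡ lookup cs i) →
  ∀ {c} → Sel c cs m → Σ (FMor (suc n) (rep N σ) (rep m τ)) λ u →
    ∀ p → χ (pev (allFin (suc n)) u p) ≡ c
pickTrees χ inv t e done = nil , λ ()
pickTrees {n = n} {σ = σ} {τ = node G} χ inv t e (take s)
  with pickTrees (λ q → χ (glue (fillT zero) q)) (λ e → inv (glue-~ e)) t (λ i z → e (suc i) z) s
... | u , uc = t ◂ u , colour
  where
  ι = allFin (suc n)
  colour : ∀ p → χ (pev ι (t ◂ u) p) ≡ _
  colour here          = trans (cong χ (pev-lift ι t u here)) (e zero here)
  colour (down x p)    = trans (cong χ (pev-lift ι t u (down x p))) (e zero (down x p))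
  colour (right x l p) = trans (cong χ (pev-glue ι t u (right x l end) p))
                               (trans (inv (glue-~ ~-refl)) (uc p))
pickTrees {n = n} χ inv t e (drop s)
  with pickTrees (λ q → χ (glue (fillT zero) q)) (λ e → inv (glue-~ e)) t (λ i z → e (suc i) z) s
... | u , uc = skipTree (fillT zero) u , λ p →
  trans (cong χ (pev-skipTree (allFin (suc n)) (fillT zero) u p))
        (trans (inv (glue-~ ~-refl)) (uc p))

-- Monochromatic copies of arbitrary forests over a fixed set of labels

∥_∥ : Forest → ℕ
∥ [] ∥         = 0
∥ node G ∷ F ∥ = suc (∥ G ∥ + ∥ F ∥)

∥∥≤0 : ∀ F → ∥ F ∥ ≤ 0 → F ≡ []
∥∥≤0 []           _  = refl
∥∥≤0 (node G ∷ F) ()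

-- The number of vertices is a crude bound for the number of trees, the branching and the height,
-- each of which has to fit. The bound is `suc d` because the root of `node (regular k d)` is a
-- level of its own.
intoRegular : ∀ F k d → ∥ F ∥ ≤ m → ∥ F ∥ ≤ k → ∥ F ∥ ≤ suc d →
              FMor (suc n) (rep m (node (regular k d))) F
intoRegular []           k d       _       _ _ = constM (fill zero)
intoRegular (node G ∷ F) k d (s≤s hm) hk (s≤s hd) =
  keep (below d (≤-trans (m≤m+n ∥ G ∥ ∥ F ∥) hd))
       (intoRegular F k d (≤-trans (m≤n+m ∥ F ∥ ∥ G ∥) hm)
         (≤-trans (m≤n+m ∥ F ∥ (suc ∥ G ∥)) hk) (≤-trans (m≤n+m ∥ F ∥ (suc ∥ G ∥)) (s≤s hd)))
  where
  G≤k : ∥ G ∥ ≤ k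
  G≤k = ≤-trans (m≤m+n ∥ G ∥ ∥ F ∥) (≤-trans (m≤n+m _ 1) hk)
  below : ∀ d → ∥ G ∥ ≤ d → FMor (suc (suc _)) (regular k d) G
  below zero    h = subst (FMor _ []) (sym (∥∥≤0 G h)) nil
  below (suc d) h = intoRegular G k d G≤k G≤k h

-- All `M` trees are coloured together: a vertex `z` of `V` gets the vector of its colours in the
-- `M` trees, hence `suc r ^ M`. `D` levels contain `suc ∥ F ∥` levels with the same vector, as many
-- as the regular tree has, and `M` trees contain `∥ F ∥` trees with the same entry of that vector.
killsVertices : ∀ n F r → Σ Forest λ F' → (χ : Pre (Fin (suc n)) false F' → Fin (suc r)) →
  Σ (FMor (suc n) F' F) λ t → Σ (Fin (suc r)) λ c → ∀ p → χ (pev (allFin (suc n)) t p) ≡ c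
killsVertices n F r with pigeonhole (suc r) ∥ F ∥
... | M , ph with pigeonhole (suc r ^ M) (suc ∥ F ∥)
... | D , ph' with carlson-simpson n ∥ F ∥ D (suc r ^ M)
... | V , cs with toChains n (rep M V) (suc r)
... | F' , chains = F' , go
  where
  ι : Vec (Fin (suc n)) (suc n)
  ι = allFin (suc n)
  FM : Finite (Fin M)
  FM = finite-Fin
  go : (χ : Pre (Fin (suc n)) false F' → Fin (suc r)) →
    Σ (FMor (suc n) F' F) λ t → Σ (Fin (suc r)) λ c → ∀ p → χ (pev ι t p) ≡ c
  go χ with chains χ
  ... | t₁ , inv with cs (λ z → code FM (λ i → χ (pev ι t₁ (atTree zero i z))))
                         (λ e → code-cong FM (λ i → inv (atTree-~ zero zero i e)))
  ... | levels , choose with ph' levels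
  ... | c , s with choose c ∥ F ∥ s
  ... | t₂ , mono with ph (tabulate (decode FM c))
  ... | c' , s' with pickTrees (λ q → χ (pev ι t₁ q)) inv t₂
    (λ i z → trans (sym (decode-code FM (λ i → χ (pev ι t₁ (atTree zero i (pev ι t₂ z)))) i))
      (trans (cong (λ c → decode FM c i) (mono z)) (sym (lookup∘tabulate (decode FM c) i)))) s'
  ... | t₃ , mono₃ = t₁ ∙ (t₃ ∙ t₄) , c' , λ p →
    trans (cong χ (trans (pev-∙ ι t₁ (t₃ ∙ t₄) p) (cong (pev ι t₁) (pev-∙ ι t₃ t₄ p)))) (mono₃ _)
    where
    t₄ : FMor (suc n) (rep ∥ F ∥ (node (regular (suc ∥ F ∥) ∥ F ∥))) F
    t₄ = intoRegular F (suc ∥ F ∥) ∥ F ∥ ≤-refl (m≤n+m _ 1) (m≤n+m _ 1)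

Kills : ℕ → Forest → ℕ → Set
Kills n F r = Σ Forest λ F' → (χ : ∀ b → Pre (Fin n) b F' → Fin r) →
  Σ (FMor n F' F) λ t → Σ (Bool → Fin r) λ c → ∀ b p → χ b (pev (allFin n) t p) ≡ c b

-- Without ancestors no label is available, so there is at most one object to colour. Otherwise
-- complete labellings and labelled vertices are treated in turn, as a constant colour stays
-- constant on a smaller copy.
kills : ∀ n F r → Kills n F r
kills zero [] r = [] , λ χ → nil , (λ _ → χ true end) , λ { true end → refl }
kills zero (node G ∷ F) r = node G ∷ F , λ χ → idM , (λ _ → χ false here) ,
  λ { false here → refl ; false (down () _) ; false (right () _ _) ; true (right () _ _) }
kills (suc n) F zero = F , λ χ → ⊥-elim (FinP.¬Fin0 (χ true (fill zero)))
kills (suc n) F (suc r) with killsVertices n F r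
... | F₁ , kv with killsLabels n F₁ (suc r)
... | F' , kl = F' , go
  where
  ι : Vec (Fin (suc n)) (suc n)
  ι = allFin (suc n)
  go : (χ : ∀ b → Pre (Fin (suc n)) b F' → Fin (suc r)) →
    Σ (FMor (suc n) F' F) λ t → Σ (Bool → Fin (suc r)) λ c → ∀ b p → χ b (pev ι t p) ≡ c b
  go χ with kl (χ true)
  ... | t₁ , c₁ , mono₁ with kv (λ p → χ false (pev ι t₁ p))
  ... | t₂ , c₂ , mono₂ = t₁ ∙ t₂ , (λ { true → c₁ ; false → c₂ }) ,
    λ { true  p → trans (cong (χ true) (pev-∙ ι t₁ t₂ p)) (mono₁ _)
      ; false p → trans (cong (χ false) (pev-∙ ι t₁ t₂ p)) (mono₂ p) }

-- Fusion along sequences of points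

Fresh : X → Vec X n → Set
Fresh x ρ = ∀ i → lookup ρ i ≢ x

Const : Vec X n → Pre X b F → Set
Const {n = n} ρ q = Σ (Pre (Fin n) _ _) λ c → q ≡ val ρ c

-- p is a vertex u of F with labels before it, and q extends p: u gets the label
-- y, the vertices after u get labels of ancestors of u that are their ancestors,
-- too.  If q ends at a vertex v of F, then the meet w of u and v is recorded by
-- its label, which has to differ from those of the proper ancestors of w; this
-- record is nothing if there is no such w in F.
data Next {X : Set} {n : ℕ} (ρ : Vec X n) :
       ∀ {b F} → Pre X false F → X → Maybe X → Pre X b F → Set where
  below-here : ∀ {y} {q : Pre X false G} → Fresh y ρ → Const (y ∷ ρ) q →
               Next ρ (here {F = F}) y (just y) (down y q)
  past-here  : ∀ {y} {l : Pre X true G} {q : Pre X b F} → Const (y ∷ ρ) l → Const ρ q →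
               Next ρ here y nothing (right y l q)
  in-down    : ∀ {x y z} {p q : Pre X false G} → Next (x ∷ ρ) p y (just z) q →
               Next ρ (down {F = F} x p) y (just z) (down x q)
  at-down    : ∀ {x y} {p q : Pre X false G} → Fresh x ρ → Next (x ∷ ρ) p y nothing q →
               Next ρ (down {F = F} x p) y (just x) (down x q)
  past-down  : ∀ {x y} {p : Pre X false G} {l : Pre X true G} {q : Pre X b F} →
               Next (x ∷ ρ) p y nothing l → Const ρ q → Next ρ (down x p) y nothing (right x l q)
  in-right   : ∀ {x y o} {l : Pre X true G} {p : Pre X false F} {q : Pre X b F} →
               Next ρ p y o q → Next ρ (right x l p) y o (right x l q)

next-fresh : ∀ {ρ : Vec X n} {p : Pre X false F} {q : Pre X b F} {y z} →
             Next ρ p y (just z) q → Fresh z ρ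
next-fresh (below-here f _) = f
next-fresh (in-down s)      = λ i → next-fresh s (suc i)
next-fresh (at-down f _)    = f
next-fresh (in-right s)     = next-fresh s

-- `Const` and `Fresh` depend only on the set of entries of `ρ`. A vertex outside the copy lengthens
-- `ρ` by a letter already present, as in `same-dup`.
record SameEntries {X : Set} (ρ : Vec X m) (ρ' : Vec X n) : Set where
  field
    to      : Fin m → Fin n
    from    : Fin n → Fin m
    to-eq   : ∀ i → lookup ρ' (to i) ≡ lookup ρ i
    from-eq : ∀ j → lookup ρ (from j) ≡ lookup ρ' j
open SameEntries

same-∷ : ∀ {x : X} {ρ : Vec X m} {ρ' : Vec X n} → SameEntries ρ ρ' →
         SameEntries (x ∷ ρ) (x ∷ ρ')
same-∷ s = record
  { to = λ { zero → zero ; (suc i) → suc (to s i) }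
  ; from = λ { zero → zero ; (suc i) → suc (from s i) }
  ; to-eq = λ { zero → refl ; (suc i) → to-eq s i }
  ; from-eq = λ { zero → refl ; (suc i) → from-eq s i } }

same-dup : (a : Fin n) {ρ : Vec X n} → SameEntries ρ (lookup ρ a ∷ ρ)
same-dup a = record
  { to = suc ; from = λ { zero → a ; (suc i) → i }
  ; to-eq = λ _ → refl ; from-eq = λ { zero → refl ; (suc i) → refl } }

const-resp : ∀ {ρ : Vec X m} {ρ' : Vec X n} {q : Pre X b F} → SameEntries ρ ρ' →
             Const ρ q → Const ρ' q
const-resp s (c , e) = mapP (to s) c ,
  trans e (trans (mapP-cong (λ i → sym (to-eq s i)) c) (sym (mapP-∘ _ (to s) c)))

fresh-resp : ∀ {x : X} {ρ : Vec X m} {ρ' : Vec X n} → SameEntries ρ ρ' → Fresh x ρ → Fresh x ρ'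
fresh-resp s f j e = f (from s j) (trans (from-eq s j) e)

next-resp : ∀ {ρ : Vec X m} {ρ' : Vec X n} {p : Pre X false F} {q : Pre X b F} {y o} →
            SameEntries ρ ρ' → Next ρ p y o q → Next ρ' p y o q
next-resp s (below-here f c) = below-here (fresh-resp s f) (const-resp (same-∷ s) c)
next-resp s (past-here c c') = past-here (const-resp (same-∷ s) c) (const-resp s c')
next-resp s (in-down d)      = in-down (next-resp (same-∷ s) d)
next-resp s (at-down f d)    = at-down (fresh-resp s f) (next-resp (same-∷ s) d)
next-resp s (past-down d c)  = past-down (next-resp (same-∷ s) d) (const-resp s c)
next-resp s (in-right d)     = in-right (next-resp s d)

pev-val : (ρ : Vec X n) (t : FMor n F' F) (c : Pre (Fin n) b F) →
          pev ρ t (val ρ c) ≡ val ρ (pev (allFin n) t c)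
pev-val ρ t c = sym (trans (mapP-pev (lookup ρ) (allFin _) t c)
  (cong (λ ρ' → pev ρ' t (val ρ c)) (map-lookup-allFin ρ)))

pev-const : (ρ : Vec X n) (t : FMor n F' F) {q : Pre X b F} → Const ρ q → Const ρ (pev ρ t q)
pev-const ρ t (c , refl) = pev (allFin _) t c , pev-val ρ t c

-- Vertices on the way that do not belong to the copy repeat letters of ancestors. A recorded
-- letter, being fresh, is never theirs, so both `y` and `o` survive the passage to a copy.
pev-next : (ρ : Vec X n) (t : FMor n F' F) {p : Pre X false F} {q : Pre X b F} {y : X}
           {o : Maybe X} → Next ρ p y o q → Next ρ (pev ρ t p) y o (pev ρ t q)
pev-next ρ nil          {p = ()}
pev-next ρ (skip a l h) d                = in-right (pev-next ρ h d)
pev-next ρ (keep g h)   (below-here f c) = below-here f (pev-const _ g c)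
pev-next ρ (keep g h)   (past-here c c') = past-here (pev-const _ g c) (pev-const ρ h c')
pev-next ρ (keep g h)   (in-down d)      = in-down (pev-next _ g d)
pev-next ρ (keep g h)   (at-down f d)    = at-down f (pev-next _ g d)
pev-next ρ (keep g h)   (past-down d c)  = past-down (pev-next _ g d) (pev-const ρ h c)
pev-next ρ (keep g h)   (in-right d)     = in-right (pev-next ρ h d)
pev-next ρ (into a g h) (below-here f c) =
  in-down (next-resp (same-dup a) (pev-next ρ g (below-here f c)))
pev-next ρ (into a g h) (past-here c c') =
  past-down (next-resp (same-dup a) (pev-next ρ g (past-here c (end , refl)))) (pev-const ρ h c')
pev-next ρ (into a g h) (in-down d)      =
  in-down (next-resp (same-dup a) (pev-next ρ g (in-down d)))
pev-next ρ (into a g h) (at-down f d)    =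
  in-down (next-resp (same-dup a) (pev-next ρ g (at-down f d)))
pev-next ρ (into a g h) (past-down d c)  =
  past-down (next-resp (same-dup a) (pev-next ρ g (past-down d (end , refl)))) (pev-const ρ h c)
pev-next ρ (into a g h) (in-right d)     = in-right (pev-next ρ h d)

AnyPre : Set → Forest → Set
AnyPre X F = Σ Bool λ b → Pre X b F

some-pre : AnyPre X F
some-pre {F = []}         = true , end
some-pre {F = node G ∷ F} = false , here

finite-AnyPre : Finite X → Finite (AnyPre X F)
finite-AnyPre A = retract (finite-⊎ (finite-Pre A {false}) (finite-Pre A {true}))
  (λ { (false , p) → inj₁ p ; (true , p) → inj₂ p })
  [ (false ,_) , (true ,_) ]′ (λ { (false , p) → refl ; (true , p) → refl })

-- A step records the letter put on the last vertex and the letter of the meet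
-- with the next one; the latest step comes first.
Script : Set → Set
Script X = List (X × X)

data Follows {X : Set} : Script X → Pre X false F → Set where
  start : Follows [] (here {G = G} {F = []})
  step  : ∀ {sc y z} {p q : Pre X false F} → Follows sc p → Next [] p y (just z) q →
          Follows ((y , z) ∷ sc) q

pev-follows : ∀ {sc} (t : FMor 0 F' F) {p : Pre X false F} → Follows sc p →
              Follows sc (pev [] t p)
pev-follows (keep g nil) start      = start
pev-follows t            (step s d) = step (pev-follows t s) (pev-next [] t d)

module Fusion {X : Set} (FX : Finite X) (_≟_ : (x y : X) → Dec (x ≡ y)) where

  -- The colouring may depend on the actual letters `ρ` of the ancestors, but one `t` has to serve
  -- all `ρ`. The point is that `col` takes the previous labelled vertex `p` as an argument and not
  -- `q`.
  Fuses : ℕ → Forest → ℕ → Set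
  Fuses n F r = Σ Forest λ F' → (χ : Vec X n → ∀ b → Pre X b F' → Fin r) →
    Σ (FMor n F' F) λ t → Σ (Vec X n → Bool → Pre X false F → X → Maybe X → Fin r) λ col →
      ∀ ρ {b} {p y o} {q : Pre X b F} → Next ρ p y o q → χ ρ b (pev ρ t q) ≡ col ρ b p y o

  -- Translates the record of the meet from a tree with root label `x` to the forest below the root.
  -- A recorded letter differs from those of all proper predecessors of the meet, so it equals `x`
  -- exactly when the meet is the root, which the forest does not contain.
  demote : X → X → Maybe X
  demote x z with z ≟ x
  ... | yes _ = nothing
  ... | no _  = just z

  demote-refl : ∀ x → demote x x ≡ nothing
  demote-refl x with x ≟ x
  ... | yes _ = refl
  ... | no ¬e = ⊥-elim (¬e refl)

  demote-≢ : ∀ {x z} → x ≢ z → demote x z ≡ just z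
  demote-≢ {x} {z} ne with z ≟ x
  ... | yes e = ⊥-elim (ne (sym e))
  ... | no _  = refl

  -- F is amplified before G, because the labels of G are in the past of F; then
  -- both are amplified once more for the sake of the steps from a vertex of the
  -- first tree into G or into F.
  fuses : ∀ n F r → Fuses n F r
  fuses n [] r = [] , λ χ → nil , (λ _ _ ()) , λ { ρ {p = ()} _ }
  fuses n (node G ∷ F) r
    with finite-× FX (finite-Pre FX {true} {G})
  ... | FJ with fuses n F (r ^ Finite.size FJ)
  ... | F₁ , fuseF with finite-Vec {n = suc n} FX
  -- The possible pasts of a step that leaves the first tree: its last vertex is the root, known by
  -- the letters of the root and its ancestors, or a vertex of `G` given by `p` and its letter `y`.
  ... | FW with finite-⊎ FW (finite-× FW (finite-× (finite-Pre FX {false} {G}) FX))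
  ... | FI with kills n F₁ (r ^ Finite.size FI)
  ... | F₂ , killF with finite-AnyPre {F = F₂} FX
  ... | FA with fuses (suc n) G (r ^ Finite.size FA)
  ... | G₁ , fuseG with kills (suc n) G₁ ((r ^ Finite.size FA) ^ Finite.size FW)
  ... | G₂ , killG = node G₂ ∷ F₂ , go
    where
    go : (χ : Vec X n → ∀ b → Pre X b (node G₂ ∷ F₂) → Fin r) →
      Σ (FMor n (node G₂ ∷ F₂) (node G ∷ F)) λ t →
      Σ (Vec X n → Bool → Pre X false (node G ∷ F) → X → Maybe X → Fin r) λ col →
      ∀ ρ {b} {p y o} {q : Pre X b (node G ∷ F)} → Next ρ p y o q →
      χ ρ b (pev ρ t q) ≡ col ρ b p y o
    go χ = goG (killG λ b c → code FW λ w → ψ w b (val w c))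
      where
      open ≡-Reasoning
      ψ : Vec X (suc n) → ∀ b → Pre X b G₂ → Fin (r ^ Finite.size FA)
      -- Vertices in `G` and complete labellings of `G` need the same set of colours. For a vertex
      -- in `G` nothing comes after it, so a constant function is coded, to be read at `some-pre`.
      ψ (x ∷ ρ) false p = code FA λ _ → χ ρ false (down x p)
      ψ (x ∷ ρ) true  l = code FA λ (b , q) → χ ρ b (right x l q)
      goG : Σ (FMor (suc n) G₂ G₁) (λ t → Σ (Bool → Fin ((r ^ Finite.size FA) ^ Finite.size FW))
              λ c → ∀ b p → code FW (λ w → ψ w b (val w (pev (allFin (suc n)) t p))) ≡ c b) → _
      goG (t₂ , c₂ , k₂) = goF (fuseG λ w b p → ψ w b (pev w t₂ p))
        where
        const-G : ∀ w b {q : Pre X b G₁} → Const w q → ψ w b (pev w t₂ q) ≡ decode FW (c₂ b) w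
        const-G w b (c , refl) = begin
          ψ w b (pev w t₂ (val w c))
            ≡⟨ cong (ψ w b) (pev-val w t₂ c) ⟩
          ψ w b (val w (pev (allFin (suc n)) t₂ c))
            ≡⟨ decode-code FW (λ w → ψ w b (val w (pev (allFin (suc n)) t₂ c))) w ⟨
          decode FW (code FW (λ w → ψ w b (val w (pev (allFin (suc n)) t₂ c)))) w
            ≡⟨ cong (λ c → decode FW c w) (k₂ b c) ⟩
          decode FW (c₂ b) w ∎
        goF : Σ (FMor (suc n) G₁ G) (λ t →
                Σ (Vec X (suc n) → Bool → Pre X false G → X → Maybe X → Fin (r ^ Finite.size FA))
                λ col → ∀ w {b} {p y o} {q : Pre X b G} → Next w p y o q →
                ψ w b (pev w t₂ (pev w t q)) ≡ col w b p y o) → _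
        goF (t₁ , colG , f₁) = goF₂ (killF λ b c → code FI λ i → κ i b c)
          where
          past : Vec X (suc n) ⊎ (Vec X (suc n) × Pre X false G × X) → Fin (r ^ Finite.size FA)
          -- What the labels of the first tree leave behind once it has been passed: a colouring of
          -- the remaining forest that depends on the past alone.
          past (inj₁ w)           = decode FW (c₂ true) w
          past (inj₂ (w , p , y)) = colG w true p y nothing
          tail-of : Vec X (suc n) ⊎ (Vec X (suc n) × Pre X false G × X) → Vec X n
          tail-of (inj₁ (x ∷ ρ))       = ρ
          tail-of (inj₂ (x ∷ ρ , _ , _)) = ρ
          κ : Vec X (suc n) ⊎ (Vec X (suc n) × Pre X false G × X) → ∀ b → Pre (Fin n) b F₂ → Fin r
          κ i b c = decode FA (past i) (b , val (tail-of i) c)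
          goF₂ : Σ (FMor n F₂ F₁) (λ t → Σ (Bool → Fin (r ^ Finite.size FI)) λ c →
                   ∀ b p → code FI (λ i → κ i b (pev (allFin n) t p)) ≡ c b) → _
          goF₂ (s₂ , d₂ , k₂') = finish (fuseF λ ρ b q → code FJ λ (x , l) →
                                   χ ρ b (right x (pev (x ∷ ρ) (t₂ ∙ t₁) l) (pev ρ s₂ q)))
            where
            const-F : ∀ i b {q : Pre X b F₁} → Const (tail-of i) q →
                      decode FA (past i) (b , pev (tail-of i) s₂ q) ≡ decode FI (d₂ b) i
            const-F i b (c , refl) = begin
              decode FA (past i) (b , pev (tail-of i) s₂ (val (tail-of i) c))
                ≡⟨ cong (λ q → decode FA (past i) (b , q)) (pev-val (tail-of i) s₂ c) ⟩
              κ i b (pev (allFin n) s₂ c)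
                ≡⟨ decode-code FI (λ i → κ i b (pev (allFin n) s₂ c)) i ⟨
              decode FI (code FI (λ i → κ i b (pev (allFin n) s₂ c))) i
                ≡⟨ cong (λ c → decode FI c i) (k₂' b c) ⟩
              decode FI (d₂ b) i ∎
            finish : Σ (FMor n F₁ F) (λ t →
                Σ (Vec X n → Bool → Pre X false F → X → Maybe X → Fin (r ^ Finite.size FJ))
                λ col → ∀ ρ {b} {p y o} {q : Pre X b F} → Next ρ p y o q →
                code FJ (λ (x , l) →
                  χ ρ b (right x (pev (x ∷ ρ) (t₂ ∙ t₁) l) (pev ρ s₂ (pev ρ t q))))
                ≡ col ρ b p y o) → _
            finish (s₁ , colF , f₁') = keep (t₂ ∙ t₁) (s₂ ∙ s₁) , col , correct
              where
              col : Vec X n → Bool → Pre X false (node G ∷ F) → X → Maybe X → Fin r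
              col ρ b here          y (just _) = decode FA (decode FW (c₂ false) (y ∷ ρ)) some-pre
              col ρ b here          y nothing  = decode FI (d₂ b) (inj₁ (y ∷ ρ))
              col ρ b (down x p)    y (just z) =
                decode FA (colG (x ∷ ρ) false p y (demote x z)) some-pre
              col ρ b (down x p)    y nothing  = decode FI (d₂ b) (inj₂ (x ∷ ρ , p , y))
              col ρ b (right x l p) y o        = decode FJ (colF ρ b p y o) (x , l)
              downwards : ∀ ρ x {p y o z} {q : Pre X false G} → demote x z ≡ o →
                Next (x ∷ ρ) p y o q →
                χ ρ false (down x (pev (x ∷ ρ) (t₂ ∙ t₁) q)) ≡ col ρ false (down x p) y (just z)
              downwards ρ x {p} {y} {q = q} refl d = begin
                χ ρ false (down x (pev (x ∷ ρ) (t₂ ∙ t₁) q))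
                  ≡⟨ cong (χ ρ false ∘ down x) (pev-∙ (x ∷ ρ) t₂ t₁ q) ⟩
                χ ρ false (down x (pev (x ∷ ρ) t₂ (pev (x ∷ ρ) t₁ q)))
                  ≡⟨ decode-code FA
                       (λ _ → χ ρ false (down x (pev (x ∷ ρ) t₂ (pev (x ∷ ρ) t₁ q)))) some-pre ⟨
                decode FA (ψ (x ∷ ρ) false (pev (x ∷ ρ) t₂ (pev (x ∷ ρ) t₁ q))) some-pre
                  ≡⟨ cong (λ c → decode FA c some-pre) (f₁ (x ∷ ρ) d) ⟩
                decode FA (colG (x ∷ ρ) false p y _) some-pre ∎
              beyond : ∀ ρ x b {l : Pre X true G} {q : Pre X b F} (i : _) → tail-of i ≡ ρ →
                ψ (x ∷ ρ) true (pev (x ∷ ρ) t₂ (pev (x ∷ ρ) t₁ l)) ≡ past i → Const ρ q →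
                χ ρ b (right x (pev (x ∷ ρ) (t₂ ∙ t₁) l) (pev ρ (s₂ ∙ s₁) q))
                ≡ decode FI (d₂ b) i
              beyond ρ x b {l} {q} i refl e c = begin
                χ ρ b (right x (pev (x ∷ ρ) (t₂ ∙ t₁) l) (pev ρ (s₂ ∙ s₁) q))
                  ≡⟨ cong₂ (λ l q → χ ρ b (right x l q))
                       (pev-∙ (x ∷ ρ) t₂ t₁ l) (pev-∙ ρ s₂ s₁ q) ⟩
                χ ρ b (right x (pev (x ∷ ρ) t₂ (pev (x ∷ ρ) t₁ l)) (pev ρ s₂ (pev ρ s₁ q)))
                  ≡⟨ decode-code FA
                       (λ (b , q) → χ ρ b (right x (pev (x ∷ ρ) t₂ (pev (x ∷ ρ) t₁ l)) q))
                       (b , pev ρ s₂ (pev ρ s₁ q)) ⟨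
                decode FA (ψ (x ∷ ρ) true (pev (x ∷ ρ) t₂ (pev (x ∷ ρ) t₁ l)))
                  (b , pev ρ s₂ (pev ρ s₁ q))
                  ≡⟨ cong (λ c → decode FA c (b , pev ρ s₂ (pev ρ s₁ q))) e ⟩
                decode FA (past i) (b , pev ρ s₂ (pev ρ s₁ q))
                  ≡⟨ const-F i b (pev-const ρ s₁ c) ⟩
                decode FI (d₂ b) i ∎
              correct : ∀ ρ {b} {p y o} {q : Pre X b (node G ∷ F)} → Next ρ p y o q →
                χ ρ b (pev ρ (keep (t₂ ∙ t₁) (s₂ ∙ s₁)) q) ≡ col ρ b p y o
              correct ρ (below-here {y = y} {q} _ c) = begin
                χ ρ false (down y (pev (y ∷ ρ) (t₂ ∙ t₁) q))
                  ≡⟨ cong (χ ρ false ∘ down y) (pev-∙ (y ∷ ρ) t₂ t₁ q) ⟩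
                χ ρ false (down y (pev (y ∷ ρ) t₂ (pev (y ∷ ρ) t₁ q)))
                  ≡⟨ decode-code FA
                       (λ _ → χ ρ false (down y (pev (y ∷ ρ) t₂ (pev (y ∷ ρ) t₁ q)))) some-pre ⟨
                decode FA (ψ (y ∷ ρ) false (pev (y ∷ ρ) t₂ (pev (y ∷ ρ) t₁ q))) some-pre
                  ≡⟨ cong (λ c → decode FA c some-pre)
                       (const-G (y ∷ ρ) false (pev-const (y ∷ ρ) t₁ c)) ⟩
                decode FA (decode FW (c₂ false) (y ∷ ρ)) some-pre ∎
              correct ρ {b} (past-here {y = y} c c') =
                beyond ρ y b (inj₁ (y ∷ ρ)) refl
                  (const-G (y ∷ ρ) true (pev-const (y ∷ ρ) t₁ c)) c'
              correct ρ (in-down {x = x} d) =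
                downwards ρ x (demote-≢ (next-fresh d zero)) d
              correct ρ (at-down {x = x} _ d) = downwards ρ x (demote-refl x) d
              correct ρ {b} (past-down {x = x} {y} {p} d c) =
                beyond ρ x b (inj₂ (x ∷ ρ , p , y)) refl (f₁ (x ∷ ρ) d) c
              correct ρ {b} (in-right {x = x} {y} {o} {l} {p} {q} d) = begin
                χ ρ b (right x (pev (x ∷ ρ) (t₂ ∙ t₁) l) (pev ρ (s₂ ∙ s₁) q))
                  ≡⟨ cong (λ q → χ ρ b (right x (pev (x ∷ ρ) (t₂ ∙ t₁) l) q)) (pev-∙ ρ s₂ s₁ q) ⟩
                χ ρ b (right x (pev (x ∷ ρ) (t₂ ∙ t₁) l) (pev ρ s₂ (pev ρ s₁ q)))
                  ≡⟨ decode-code FJ (λ (x , l) → χ ρ b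
                       (right x (pev (x ∷ ρ) (t₂ ∙ t₁) l) (pev ρ s₂ (pev ρ s₁ q)))) (x , l) ⟨
                decode FJ (code FJ (λ (x , l) → χ ρ b
                       (right x (pev (x ∷ ρ) (t₂ ∙ t₁) l) (pev ρ s₂ (pev ρ s₁ q))))) (x , l)
                  ≡⟨ cong (λ c → decode FJ c (x , l)) (f₁' ρ d) ⟩
                decode FJ (colF ρ b p y o) (x , l) ∎

  -- The last step is fused first. For fixed letters `y` and `z` this turns the colour of the last
  -- vertex into a colouring of the vertex before it, to which the shorter script applies.
  fuse-script : ∀ sc F r → Σ Forest λ F' → (χ : Pre X false F' → Fin (suc r)) →
    Σ (FMor 0 F' F) λ t → Σ (Fin (suc r)) λ c → ∀ {p} → Follows sc p → χ (pev [] t p) ≡ c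
  fuse-script [] [] r = [] , λ χ → nil , zero , λ { {()} }
  fuse-script [] (node G ∷ F) r = node G ∷ F , λ χ → idM , χ here , λ { start → refl }
  fuse-script ((y , z) ∷ sc) F r with fuse-script sc F r
  ... | F₁ , ih with fuses 0 F₁ (suc r)
  ... | F' , fuse = F' , go
    where
    go : (χ : Pre X false F' → Fin (suc r)) → Σ (FMor 0 F' F) λ t → Σ (Fin (suc r)) λ c →
         ∀ {p} → Follows ((y , z) ∷ sc) p → χ (pev [] t p) ≡ c
    -- Scripts end at a vertex, so complete labellings receive a dummy colour.
    go χ with fuse (λ { _ false p → χ p ; _ true _ → zero })
    ... | t , col , eq with ih (λ p → col [] false p y (just z))
    ... | t' , c , eq' = t ∙ t' , c , λ { {q} (step {p = p} s d) →
      trans (cong χ (pev-∙ [] t t' q)) (trans (eq [] (pev-next [] t' d)) (eq' s)) }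

  fuse-scripts : ∀ K (sc : Fin K → Script X) F r →
    Σ Forest λ F' → (χ : Pre X false F' → Fin (suc r)) →
    Σ (FMor 0 F' F) λ t → Σ (Fin K → Fin (suc r)) λ c →
      ∀ k {p} → Follows (sc k) p → χ (pev [] t p) ≡ c k
  fuse-scripts zero    sc F r = F , λ χ → idM , (λ ()) , λ ()
  fuse-scripts (suc K) sc F r with fuse-scripts K (sc ∘ suc) F r
  ... | F₁ , ih with fuse-script (sc zero) F₁ r
  ... | F' , fuse = F' , go
    where
    go : (χ : Pre X false F' → Fin (suc r)) → Σ (FMor 0 F' F) λ t →
      Σ (Fin (suc K) → Fin (suc r)) λ c → ∀ k {p} → Follows (sc k) p → χ (pev [] t p) ≡ c k
    go χ with fuse χ
    ... | t , c , eq with ih (λ p → χ (pev [] t p))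
    ... | t' , c' , eq' = t ∙ t' , (λ { zero → c ; (suc k) → c' k }) ,
      λ { zero {p} s → trans (cong χ (pev-∙ [] t t' p)) (eq (pev-follows t' s))
        ; (suc k) {p} s → trans (cong χ (pev-∙ [] t t' p)) (eq' k s) }

-- Vertices and labellings

record V (F : Forest) : Set where
  constructor _▹_
  field
    tree : Fin (length F)
    spot : Pos (List.lookup F tree)

infix 5 _▹_

≤T-refl : {x : Pos T} → x ≤T x
≤T-refl {x = root}      = root≤
≤T-refl {x = child k p} = same≤ ≤T-refl

≤T-trans : {x y z : Pos T} → x ≤T y → y ≤T z → x ≤T z
≤T-trans root≤     _         = root≤
≤T-trans (same≤ h) (same≤ g) = same≤ (≤T-trans h g)
≤T-trans (same≤ h) (diff≤ g) = diff≤ g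
≤T-trans (diff≤ h) (same≤ g) = diff≤ h
≤T-trans (diff≤ h) (diff≤ g) = diff≤ (FinP.<-trans h g)

≤T-antisym : {x y : Pos T} → x ≤T y → y ≤T x → x ≡ y
≤T-antisym root≤     root≤     = refl
≤T-antisym (same≤ h) (same≤ g) = cong (child _) (≤T-antisym h g)
≤T-antisym (same≤ h) (diff≤ g) = ⊥-elim (FinP.<-irrefl refl g)
≤T-antisym (diff≤ h) (same≤ g) = ⊥-elim (FinP.<-irrefl refl h)
≤T-antisym (diff≤ h) (diff≤ g) = ⊥-elim (FinP.<-asym h g)

≤T-total : (x y : Pos T) → x ≤T y ⊎ y ≤T x
≤T-total root        y    = inj₁ root≤
≤T-total (child k p) root = inj₂ root≤
≤T-total (child k p) (child k' q) with FinP.<-cmp k k'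
... | tri< h _ _ = inj₁ (diff≤ h)
... | tri> _ _ h = inj₂ (diff≤ h)
... | tri≈ _ refl _ with ≤T-total p q
...   | inj₁ h = inj₁ (same≤ h)
...   | inj₂ h = inj₂ (same≤ h)

child-injective : ∀ {ts} {k : Fin (length ts)} {p q : Pos (List.lookup ts k)} →
                  child {ts} k p ≡ child k q → p ≡ q
child-injective refl = refl

_≟P_ : (x y : Pos T) → Dec (x ≡ y)
root      ≟P root       = yes refl
root      ≟P child k p  = no λ ()
child k p ≟P root       = no λ ()
child k p ≟P child k' q with k Fin.≟ k'
... | no ne = no λ { refl → ne refl }
... | yes refl with p ≟P q
...   | yes refl = yes refl
...   | no ne    = no (ne ∘ child-injective)

<T-trans : {x y z : Pos T} → x <T y → y <T z → x <T z
<T-trans (h , ne) (g , _) = ≤T-trans h g , λ { refl → ne (≤T-antisym h g) }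

<≤T-trans : {x y z : Pos T} → x <T y → y ≤T z → x <T z
<≤T-trans (h , ne) g = ≤T-trans h g , λ { refl → ne (≤T-antisym h g) }

<T-irrefl : {x : Pos T} → ¬ (x <T x)
<T-irrefl (_ , ne) = ne refl

≤⇒≯ : {x y : Pos T} → x ≤T y → ¬ (y <T x)
≤⇒≯ h (g , ne) = ne (≤T-antisym g h)

≮⇒≥ : (x y : Pos T) → ¬ (x <T y) → y ≤T x
≮⇒≥ x y h with ≤T-total y x
... | inj₁ g = g
... | inj₂ g with x ≟P y
...   | yes refl = ≤T-refl
...   | no ne    = ⊥-elim (h (g , ne))

_≤T?_ : (x y : Pos T) → Dec (x ≤T y)
x ≤T? y with ≤T-total x y
... | inj₁ h = yes h
... | inj₂ h with x ≟P y
...   | yes refl = yes h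
...   | no ne    = no λ g → ne (≤T-antisym g h)

_<T?_ : (x y : Pos T) → Dec (x <T y)
x <T? y with x ≤T? y | x ≟P y
... | yes h | no ne = yes (h , ne)
... | no h  | _     = no (h ∘ proj₁)
... | _     | yes e = no λ (_ , ne) → ne e

⊑-refl : {x : Pos T} → x ⊑ x
⊑-refl {x = root}      = root⊑
⊑-refl {x = child k p} = child⊑ ⊑-refl

⊑-trans : {x y z : Pos T} → x ⊑ y → y ⊑ z → x ⊑ z
⊑-trans root⊑      _          = root⊑
⊑-trans (child⊑ h) (child⊑ g) = child⊑ (⊑-trans h g)

⊑⇒≤ : {x y : Pos T} → x ⊑ y → x ≤T y
⊑⇒≤ root⊑      = root≤
⊑⇒≤ (child⊑ h) = same≤ (⊑⇒≤ h)

⊑-antisym : {x y : Pos T} → x ⊑ y → y ⊑ x → x ≡ y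
⊑-antisym h g = ≤T-antisym (⊑⇒≤ h) (⊑⇒≤ g)

⊑-linear : {x y z : Pos T} → x ⊑ z → y ⊑ z → x ⊑ y ⊎ y ⊑ x
⊑-linear root⊑      _          = inj₁ root⊑
⊑-linear (child⊑ _) root⊑      = inj₂ root⊑
⊑-linear (child⊑ h) (child⊑ g) with ⊑-linear h g
... | inj₁ e = inj₁ (child⊑ e)
... | inj₂ e = inj₂ (child⊑ e)

_⊑?_ : (x y : Pos T) → Dec (x ⊑ y)
root      ⊑? y    = yes root⊑
child k p ⊑? root = no λ ()
child k p ⊑? child k' q with k Fin.≟ k'
... | no ne = no λ { (child⊑ _) → ne refl }
... | yes refl with p ⊑? q
...   | yes h = yes (child⊑ h)
...   | no h  = no λ { (child⊑ g) → h g }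

meet-same : ∀ {ts} (k : Fin (length ts)) (p q : Pos (List.lookup ts k)) →
            meet (child {ts} k p) (child k q) ≡ child k (meet p q)
meet-same k p q with k Fin.≟ k
... | yes refl = refl
... | no ne    = ⊥-elim (ne refl)

meet-⊑ˡ : (x y : Pos T) → meet x y ⊑ x
meet-⊑ˡ root        y    = root⊑
meet-⊑ˡ (child k p) root = root⊑
meet-⊑ˡ (child k p) (child k' q) with k Fin.≟ k'
... | yes refl = child⊑ (meet-⊑ˡ p q)
... | no _     = root⊑

meet-⊑ʳ : (x y : Pos T) → meet x y ⊑ y
meet-⊑ʳ root        y    = root⊑
meet-⊑ʳ (child k p) root = root⊑
meet-⊑ʳ (child k p) (child k' q) with k Fin.≟ k'
... | yes refl = child⊑ (meet-⊑ʳ p q)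
... | no _     = root⊑

meet-greatest : {x y z : Pos T} → z ⊑ x → z ⊑ y → z ⊑ meet x y
meet-greatest root⊑ _ = root⊑
meet-greatest (child⊑ {k = k} {q = p} h) (child⊑ {q = q} g) =
  subst (_ ⊑_) (sym (meet-same k p q)) (child⊑ (meet-greatest h g))

⊑⇒meet : {x y : Pos T} → x ⊑ y → meet x y ≡ x
⊑⇒meet {x = x} {y} h = ⊑-antisym (meet-⊑ˡ x y) (meet-greatest ⊑-refl h)

-- The forest is put under a new root, so that its orders and meets are those of a tree. A meet
-- equal to `root` means that two vertices lie in different trees.
toPos : V F → Pos (node F)
toPos (k ▹ p) = child k p

top : V (node G ∷ F)
top = zero ▹ root

inChild : V G → V (node G ∷ F)
inChild (k ▹ p) = zero ▹ child k p

later : V F → V (τ ∷ F)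
later (k ▹ p) = suc k ▹ p

inHead : V (τ ∷ []) → V (τ ∷ F)
inHead (zero ▹ p) = zero ▹ p

image : FMor n F' F → V F → V F'
image (skip a l h) x                    = later (image h x)
image (keep g h)   (zero ▹ root)        = top
image (keep g h)   (zero ▹ child k p)   = inChild (image g (k ▹ p))
image (keep g h)   (suc k ▹ p)          = later (image h (k ▹ p))
image (into a g h) (zero ▹ p)           = inChild (image g (zero ▹ p))
image (into a g h) (suc k ▹ p)          = later (image h (k ▹ p))

at : Pre X true F → V F → X
at (right x l q) (zero ▹ root)      = x
at (right x l q) (zero ▹ child k p) = at l (k ▹ p)
at (right x l q) (suc k ▹ p)        = at q (k ▹ p)

induced : FMor n F' F → Vec X n → (V F → X) → V F' → X
induced (skip a l h) ρ f (zero ▹ p)         = at (right (lookup ρ a) (val ρ l) end) (zero ▹ p)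
induced (skip a l h) ρ f (suc k ▹ p)        = induced h ρ f (k ▹ p)
induced (keep g h)   ρ f (zero ▹ root)      = f top
induced (keep g h)   ρ f (zero ▹ child k p) = induced g (f top ∷ ρ) (f ∘ inChild) (k ▹ p)
induced (keep g h)   ρ f (suc k ▹ p)        = induced h ρ (f ∘ later) (k ▹ p)
induced (into a g h) ρ f (zero ▹ root)      = lookup ρ a
induced (into a g h) ρ f (zero ▹ child k p) = induced g ρ (f ∘ inHead) (k ▹ p)
induced (into a g h) ρ f (suc k ▹ p)        = induced h ρ (f ∘ later) (k ▹ p)

at-mapP : (f : X → Y) (l : Pre X true F) (z : V F) → at (mapP f l) z ≡ f (at l z)
at-mapP f (right x l q) (zero ▹ root)      = refl
at-mapP f (right x l q) (zero ▹ child k p) = at-mapP f l (k ▹ p)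
at-mapP f (right x l q) (suc k ▹ p)        = at-mapP f q (k ▹ p)

induced-image : (t : FMor n F' F) (ρ : Vec X n) (f : V F → X) (x : V F) → induced t ρ f (image t x) ≡ f x
induced-image (skip a l h) ρ f x                  = induced-image h ρ f x
induced-image (keep g h)   ρ f (zero ▹ root)      = refl
induced-image (keep g h)   ρ f (zero ▹ child k p) = induced-image g (f top ∷ ρ) (f ∘ inChild) (k ▹ p)
induced-image (keep g h)   ρ f (suc k ▹ p)        = induced-image h ρ (f ∘ later) (k ▹ p)
induced-image (into a g h) ρ f (zero ▹ p)         = induced-image g ρ (f ∘ inHead) (zero ▹ p)
induced-image (into a g h) ρ f (suc k ▹ p)        = induced-image h ρ (f ∘ later) (k ▹ p)

induced-map : (u : X → Y) (t : FMor n F' F) (ρ : Vec X n) (f : V F → X) (z : V F') →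
          u (induced t ρ f z) ≡ induced t (map u ρ) (u ∘ f) z
induced-map u (skip a l h) ρ f (zero ▹ root)      = sym (lookup-map a u ρ)
induced-map u (skip a l h) ρ f (zero ▹ child k p) =
  trans (sym (at-mapP u (val ρ l) (k ▹ p))) (cong (λ l → at l (k ▹ p)) (val-map u ρ l))
induced-map u (skip a l h) ρ f (suc k ▹ p)        = induced-map u h ρ f (k ▹ p)
induced-map u (keep g h)   ρ f (zero ▹ root)      = refl
induced-map u (keep g h)   ρ f (zero ▹ child k p) = induced-map u g (f top ∷ ρ) (f ∘ inChild) (k ▹ p)
induced-map u (keep g h)   ρ f (suc k ▹ p)        = induced-map u h ρ (f ∘ later) (k ▹ p)
induced-map u (into a g h) ρ f (zero ▹ root)      = sym (lookup-map a u ρ)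
induced-map u (into a g h) ρ f (zero ▹ child k p) = induced-map u g ρ (f ∘ inHead) (k ▹ p)
induced-map u (into a g h) ρ f (suc k ▹ p)        = induced-map u h ρ (f ∘ later) (k ▹ p)

later-⊑ : {x y : V F} → toPos x ⊑ toPos y → toPos (later {τ = τ} x) ⊑ toPos (later y)
later-⊑ (child⊑ h) = child⊑ h

inChild-⊑ : {x y : V G} → toPos x ⊑ toPos y → toPos (inChild {F = F} x) ⊑ toPos (inChild y)
inChild-⊑ h = child⊑ h

at-val : (ρ : Vec X n) (l : Pre (Fin n) true F) (z : V F) → Σ (Fin n) λ a → at (val ρ l) z ≡ lookup ρ a
at-val ρ l z = at l z , at-mapP (lookup ρ) l z

-- The form that the condition `i (s y) ⊑ y` of a rigid surjection takes below ancestors; with no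
-- ancestors only the second alternative is possible.
source : (t : FMor n F' F) (ρ : Vec X n) (f : V F → X) (y : V F') →
         (Σ (Fin n) λ a → induced t ρ f y ≡ lookup ρ a) ⊎
         (Σ (V F) λ x → induced t ρ f y ≡ f x × toPos (image t x) ⊑ toPos y)
source (skip a l h) ρ f (zero ▹ root)      = inj₁ (a , refl)
source (skip a l h) ρ f (zero ▹ child k p) = inj₁ (at-val ρ l (k ▹ p))
source (skip a l h) ρ f (suc k ▹ p) with source h ρ f (k ▹ p)
... | inj₁ e           = inj₁ e
... | inj₂ (x , e , h') = inj₂ (x , e , later-⊑ h')
source (keep g h) ρ f (zero ▹ root) = inj₂ (top , refl , ⊑-refl)
source (keep g h) ρ f (zero ▹ child k p) with source g (f top ∷ ρ) (f ∘ inChild) (k ▹ p)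
... | inj₁ (zero , e)   = inj₂ (top , e , child⊑ root⊑)
... | inj₁ (suc a , e)  = inj₁ (a , e)
... | inj₂ (x , e , h') = inj₂ (inChild x , e , inChild-⊑ h')
source (keep g h) ρ f (suc k ▹ p) with source h ρ (f ∘ later) (k ▹ p)
... | inj₁ e            = inj₁ e
... | inj₂ (x , e , h') = inj₂ (later x , e , later-⊑ h')
source (into a g h) ρ f (zero ▹ root) = inj₁ (a , refl)
source (into a g h) ρ f (zero ▹ child k p) with source g ρ (f ∘ inHead) (k ▹ p)
... | inj₁ e                     = inj₁ e
... | inj₂ ((zero ▹ x) , e , h') = inj₂ ((zero ▹ x) , e , inChild-⊑ h')
source (into a g h) ρ f (suc k ▹ p) with source h ρ (f ∘ later) (k ▹ p)
... | inj₁ e            = inj₁ e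
... | inj₂ (x , e , h') = inj₂ (later x , e , later-⊑ h')

later-≤ : {x y : V F} → toPos x ≤T toPos y → toPos (later {τ = τ} x) ≤T toPos (later y)
later-≤ (same≤ h) = same≤ h
later-≤ (diff≤ h) = diff≤ (s≤s h)

image-mono : (t : FMor n F' F) {x y : V F} → toPos x ≤T toPos y → toPos (image t x) ≤T toPos (image t y)
image-mono (skip a l h) e = later-≤ (image-mono h e)
image-mono (keep g h) {zero ▹ root}      {zero ▹ root}       e = ≤T-refl
image-mono (keep g h) {zero ▹ root}      {zero ▹ child k q}  e = same≤ root≤
image-mono (keep g h) {zero ▹ child k p} {zero ▹ root}       (same≤ ())
image-mono (keep g h) {zero ▹ child k p} {zero ▹ child k' q} (same≤ e) = same≤ (image-mono g e)
image-mono (keep g h) {zero ▹ root}      {suc k' ▹ q}        e = diff≤ (s≤s z≤n)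
image-mono (keep g h) {zero ▹ child k p} {suc k' ▹ q}        e = diff≤ (s≤s z≤n)
image-mono (keep g h) {suc k ▹ p}        {suc .k ▹ q}        (same≤ e) = later-≤ (image-mono h (same≤ e))
image-mono (keep g h) {suc k ▹ p}        {suc k' ▹ q}        (diff≤ (s≤s e)) =
  later-≤ (image-mono h (diff≤ e))
image-mono (into a g h) {zero ▹ p}  {zero ▹ q}   (same≤ e) = same≤ (image-mono g (same≤ e))
image-mono (into a g h) {zero ▹ p}  {suc k' ▹ q} e = diff≤ (s≤s z≤n)
image-mono (into a g h) {suc k ▹ p} {suc .k ▹ q} (same≤ e) = later-≤ (image-mono h (same≤ e))
image-mono (into a g h) {suc k ▹ p} {suc k' ▹ q} (diff≤ (s≤s e)) = later-≤ (image-mono h (diff≤ e))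

image₀ : FMor n F' F → Pos (node F) → Pos (node F')
image₀ t root        = root
image₀ t (child k p) = toPos (image t (k ▹ p))

later₀ : Pos (node F) → Pos (node (τ ∷ F))
later₀ root        = root
later₀ (child k p) = child (suc k) p

meet-later : (x y : V F) →
             meet (toPos (later {τ = τ} x)) (toPos (later y)) ≡ later₀ (meet (toPos x) (toPos y))
meet-later (k ▹ p) (k' ▹ q) with k Fin.≟ k'
... | yes refl = refl
... | no _     = refl

image₀-later-keep : (g : FMor (suc n) G' G) (h : FMor n F' F) (x : Pos (node F)) →
                image₀ (keep g h) (later₀ x) ≡ later₀ (image₀ h x)
image₀-later-keep g h root        = refl
image₀-later-keep g h (child k p) = refl

image₀-later-into : (a : Fin n) (g : FMor n G' (τ ∷ [])) (h : FMor n F' F) (x : Pos (node F)) →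
                image₀ (into a g h) (later₀ x) ≡ later₀ (image₀ h x)
image₀-later-into a g h root        = refl
image₀-later-into a g h (child k p) = refl

image₀-skip : (a : Fin n) (l : Pre (Fin n) true G') (h : FMor n F' F) (x : Pos (node F)) →
          image₀ (skip a l h) x ≡ later₀ (image₀ h x)
image₀-skip a l h root        = refl
image₀-skip a l h (child k p) = refl

image₀-child : (g : FMor (suc n) G' G) (h : FMor n F' F) (x : Pos (node G)) →
           image₀ (keep g h) (child zero x) ≡ child zero (image₀ g x)
image₀-child g h root        = refl
image₀-child g h (child k p) = refl

image-meet : (t : FMor n F' F) (x y : V F) →
         image₀ t (meet (toPos x) (toPos y)) ≡ meet (toPos (image t x)) (toPos (image t y))
image-meet (skip a l h) x y =
  trans (image₀-skip a l h (meet (toPos x) (toPos y)))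
    (trans (cong later₀ (image-meet h x y)) (sym (meet-later (image h x) (image h y))))
image-meet (keep g h) (zero ▹ root)      (zero ▹ root)       = refl
image-meet (keep g h) (zero ▹ root)      (zero ▹ child k q)  = refl
image-meet (keep g h) (zero ▹ child k p) (zero ▹ root)       = refl
image-meet (keep g h) (zero ▹ child k p) (zero ▹ child k' q) =
  trans (image₀-child g h (meet (child k p) (child k' q))) (cong (child zero) (image-meet g (k ▹ p) (k' ▹ q)))
image-meet (keep g h) (zero ▹ root)      (suc k' ▹ q) = refl
image-meet (keep g h) (zero ▹ child k p) (suc k' ▹ q) = refl
image-meet (keep g h) (suc k ▹ p) (zero ▹ root)       = refl
image-meet (keep g h) (suc k ▹ p) (zero ▹ child k' q) = refl
image-meet (keep g h) (suc k ▹ p) (suc k' ▹ q) =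
  trans (cong (image₀ (keep g h)) (meet-later (k ▹ p) (k' ▹ q)))
    (trans (image₀-later-keep g h (meet (child k p) (child k' q)))
      (trans (cong later₀ (image-meet h (k ▹ p) (k' ▹ q))) (sym (meet-later (image h (k ▹ p)) (image h (k' ▹ q))))))
image-meet (into a g h) (zero ▹ p) (zero ▹ q) =
  cong (child zero) (trans (cong (image₀ g) (sym (meet-same zero p q))) (image-meet g (zero ▹ p) (zero ▹ q)))
image-meet (into a g h) (zero ▹ p)  (suc k' ▹ q) = refl
image-meet (into a g h) (suc k ▹ p) (zero ▹ q)   = refl
image-meet (into a g h) (suc k ▹ p) (suc k' ▹ q) =
  trans (cong (image₀ (into a g h)) (meet-later (k ▹ p) (k' ▹ q)))
    (trans (image₀-later-into a g h (meet (child k p) (child k' q)))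
      (trans (cong later₀ (image-meet h (k ▹ p) (k' ▹ q))) (sym (meet-later (image h (k ▹ p)) (image h (k' ▹ q))))))

full : (V F → X) → Pre X true F
full {F = []}         f = end
full {F = node G ∷ F} f = right (f top) (full (f ∘ inChild)) (full (f ∘ later))

tab : (V F → X) → V F → Pre X false F
tab {F = node G ∷ F} f (zero ▹ root)      = here
tab {F = node G ∷ F} f (zero ▹ child k p) = down (f top) (tab (f ∘ inChild) (k ▹ p))
tab {F = node G ∷ F} f (suc k ▹ p)        =
  right (f top) (full (f ∘ inChild)) (tab (f ∘ later) (k ▹ p))

full-cong : {f g : V F → X} → (∀ z → f z ≡ g z) → full f ≡ full g
full-cong {F = []}         e = refl
full-cong {F = node G ∷ F} e =
  trans (cong (λ x → right x _ _) (e top))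
        (cong₂ (right _) (full-cong (e ∘ inChild)) (full-cong (e ∘ later)))

tab-cong : {f g : V F → X} → (∀ z → f z ≡ g z) → ∀ v → tab f v ≡ tab g v
tab-cong {F = node G ∷ F} e (zero ▹ root)      = refl
tab-cong {F = node G ∷ F} e (zero ▹ child k p) = cong₂ down (e top) (tab-cong (e ∘ inChild) (k ▹ p))
tab-cong {F = node G ∷ F} e (suc k ▹ p)        =
  trans (cong (λ x → right x _ _) (e top))
        (cong₂ (right _) (full-cong (e ∘ inChild)) (tab-cong (e ∘ later) (k ▹ p)))

full-at : (l : Pre X true F) → full (at l) ≡ l
full-at end           = refl
full-at (right x l q) = cong₂ (right x) (full-at l) (full-at q)

pev-full : (t : FMor n F' F) (ρ : Vec X n) (f : V F → X) → pev ρ t (full f) ≡ full (induced t ρ f)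
pev-full nil ρ f = refl
pev-full (skip a l h) ρ f = cong₂ (right _) (sym (full-at (val ρ l))) (pev-full h ρ f)
pev-full (keep g h) ρ f =
  cong₂ (right _) (pev-full g (f top ∷ ρ) (f ∘ inChild)) (pev-full h ρ (f ∘ later))
pev-full {F = node G ∷ F} (into a g h) ρ f =
  cong₂ (right _) (pev-full g ρ (f ∘ inHead)) (pev-full h ρ (f ∘ later))

pev-tab : (t : FMor n F' F) (ρ : Vec X n) (f : V F → X) (v : V F) →
          pev ρ t (tab f v) ≡ tab (induced t ρ f) (image t v)
pev-tab (skip a l h) ρ f v = cong₂ (right _) (sym (full-at (val ρ l))) (pev-tab h ρ f v)
pev-tab (keep g h) ρ f (zero ▹ root)      = refl
pev-tab (keep g h) ρ f (zero ▹ child k p) =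
  cong (down _) (pev-tab g (f top ∷ ρ) (f ∘ inChild) (k ▹ p))
pev-tab (keep g h) ρ f (suc k ▹ p) =
  cong₂ (right _) (pev-full g (f top ∷ ρ) (f ∘ inChild)) (pev-tab h ρ (f ∘ later) (k ▹ p))
pev-tab (into a g h) ρ f (zero ▹ root)      = cong (down _) (pev-tab g ρ (f ∘ inHead) (zero ▹ root))
pev-tab (into a g h) ρ f (zero ▹ child k p) =
  cong (down _) (pev-tab g ρ (f ∘ inHead) (zero ▹ child k p))
pev-tab {F = node G ∷ F} (into a g h) ρ f (suc k ▹ p) =
  cong₂ (right _) (pev-full g ρ (f ∘ inHead)) (pev-tab h ρ (f ∘ later) (k ▹ p))

const-full : (ρ : Vec X n) (f : V F → X) → (∀ z → Σ (Fin n) λ i → f z ≡ lookup ρ i) →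
             Const ρ (full f)
const-full {F = []}         ρ f h = end , refl
const-full {F = node G ∷ F} ρ f h
  with h top | const-full ρ (f ∘ inChild) (h ∘ inChild) | const-full ρ (f ∘ later) (h ∘ later)
... | i , e | l , el | q , eq =
  right i l q , trans (cong (λ x → right x _ _) e) (cong₂ (right _) el eq)

inChild-< : {z v : V G} → toPos z <T toPos v → toPos (inChild {F = F} z) <T toPos (inChild v)
inChild-< (h , ne) = same≤ h , ne ∘ child-injective

inChild-<⁻ : {z v : V G} → toPos (inChild {F = F} z) <T toPos (inChild v) → toPos z <T toPos v
inChild-<⁻ (same≤ h , ne) = h , ne ∘ cong (child zero)

later-≤⁻ : {z v : V F} → toPos (later {τ = τ} z) ≤T toPos (later v) → toPos z ≤T toPos v
later-≤⁻ (same≤ h)       = same≤ h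
later-≤⁻ (diff≤ (s≤s h)) = diff≤ h

later-< : {z v : V F} → toPos z <T toPos v → toPos (later {τ = τ} z) <T toPos (later v)
later-< {z = z} {v} (h , ne) = later-≤ {x = z} {v} h , λ { refl → ne refl }

later-<⁻ : {z v : V F} → toPos (later {τ = τ} z) <T toPos (later v) → toPos z <T toPos v
later-<⁻ {z = z} {v} (h , ne) = later-≤⁻ {z = z} {v} h , λ { refl → ne refl }

top<inChild : {z : V G} → toPos (top {F = F}) <T toPos (inChild z)
top<inChild = same≤ root≤ , λ ()

head<later : {p : Pos τ} {z : V F} → toPos (zero ▹ p) <T toPos (later {τ = τ} z)
head<later = diff≤ (s≤s z≤n) , λ ()

const-tab : (ρ : Vec X n) (f : V F → X) (v : V F) →
            (∀ z → toPos z <T toPos v → Σ (Fin n) λ i → f z ≡ lookup ρ i) → Const ρ (tab f v)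
const-tab {F = node G ∷ F} ρ f (zero ▹ root)      h = here , refl
const-tab {F = node G ∷ F} ρ f (zero ▹ child k p) h
  with h top top<inChild | const-tab ρ (f ∘ inChild) (k ▹ p) (λ z lt → h (inChild z) (inChild-< lt))
... | i , e | q , eq = down i q , cong₂ down e eq
const-tab {F = node G ∷ F} ρ f (suc k ▹ p) h
  with h top head<later | const-full ρ (f ∘ inChild) (λ z → h (inChild z) head<later)
     | const-tab ρ (f ∘ later) (k ▹ p) (λ z lt → h (later z) (later-< lt))
... | i , e | l , el | q , eq =
  right i l q , trans (cong (λ x → right x _ _) e) (cong₂ (right _) el eq)

-- The condition on labels after `u` in `Next`, for labellings given as functions: a label comes
-- from an ancestor in `ρ` or from a predecessor that does not lie after `u`.
Inherited : (V F → X) → Vec X n → V F → V F → Set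
Inherited {F} {n = n} f ρ u z =
  (Σ (Fin n) λ i → f z ≡ lookup ρ i) ⊎
  (Σ (V F) λ z' → toPos z' ⊑ toPos z × toPos z' ≤T toPos u × f z ≡ f z')

inherited-below : {f : V (node G ∷ F) → X} {ρ : Vec X n} {z : V G} → Inherited f ρ top (inChild z) →
                  Σ (Fin (suc n)) λ i → f (inChild z) ≡ lookup (f top ∷ ρ) i
inherited-below (inj₁ (i , e)) = suc i , e
inherited-below (inj₂ ((zero ▹ root) , _ , _ , e))        = zero , e
inherited-below (inj₂ ((zero ▹ child _ _) , _ , same≤ () , _))
inherited-below (inj₂ ((suc _ ▹ _) , _ , diff≤ () , _))

inherited-beyond : {f : V (τ ∷ F) → X} {ρ : Vec X n} {p : Pos τ} {z : V F} →
                   Inherited f ρ (zero ▹ p) (later z) → Σ (Fin n) λ i → f (later z) ≡ lookup ρ i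
inherited-beyond (inj₁ (i , e)) = i , e
inherited-beyond (inj₂ ((zero ▹ _) , () , _ , _))
inherited-beyond (inj₂ ((suc _ ▹ _) , _ , diff≤ () , _))

inherited-inside : {f : V (node G ∷ F) → X} {ρ : Vec X n} {u z : V G} →
                   Inherited f ρ (inChild u) (inChild z) → Inherited (f ∘ inChild) (f top ∷ ρ) u z
inherited-inside (inj₁ (i , e)) = inj₁ (suc i , e)
inherited-inside (inj₂ ((zero ▹ root) , _ , _ , e)) = inj₁ (zero , e)
inherited-inside (inj₂ ((zero ▹ child k q) , child⊑ h , same≤ le , e)) = inj₂ (k ▹ q , h , le , e)
inherited-inside (inj₂ ((suc _ ▹ _) , () , _ , _))

inherited-later : {f : V (τ ∷ F) → X} {ρ : Vec X n} {u z : V F} →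
                  Inherited f ρ (later u) (later z) → Inherited (f ∘ later) ρ u z
inherited-later (inj₁ e) = inj₁ e
inherited-later (inj₂ ((zero ▹ _) , () , _ , _))
inherited-later {u = u} (inj₂ ((suc k ▹ q) , child⊑ h , le , e)) =
  inj₂ (k ▹ q , child⊑ h , later-≤⁻ {z = k ▹ q} {u} le , e)

next-full : (f : V F → X) (ρ : Vec X n) (u : V F) →
            (∀ z → toPos u <T toPos z → Inherited f ρ u z) →
            Next ρ (tab f u) (f u) nothing (full f)
next-full {F = node G ∷ F} f ρ (zero ▹ root) h =
  past-here (const-full (f top ∷ ρ) _ λ z → inherited-below {f = f} {ρ = ρ} {z = z} (h (inChild z) top<inChild))
            (const-full ρ _ λ z → inherited-beyond {f = f} {ρ = ρ} {z = z} (h (later z) head<later))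
next-full {F = node G ∷ F} f ρ (zero ▹ child k p) h =
  past-down (next-full (f ∘ inChild) (f top ∷ ρ) (k ▹ p) λ z lt →
               inherited-inside {f = f} {ρ = ρ} (h (inChild z) (inChild-< lt)))
            (const-full ρ _ λ z → inherited-beyond {f = f} {ρ = ρ} {z = z} (h (later z) head<later))
next-full {F = node G ∷ F} f ρ (suc k ▹ p) h =
  in-right (next-full (f ∘ later) ρ (k ▹ p) λ z lt →
              inherited-later {f = f} {ρ = ρ} (h (later z) (later-< lt)))

next-past : (f : V F → X) (ρ : Vec X n) (u v : V F) → toPos u <T toPos v →
            (∀ z → toPos u <T toPos z → toPos z <T toPos v → Inherited f ρ u z) →
            meet (toPos u) (toPos v) ≡ root → Next ρ (tab f u) (f u) nothing (tab f v)
next-past {F = node G ∷ F} f ρ (zero ▹ root) (zero ▹ root) lt h ()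
next-past {F = node G ∷ F} f ρ (zero ▹ root) (zero ▹ child k' q) lt h ()
next-past {F = node G ∷ F} f ρ (zero ▹ root) (suc k' ▹ q) lt h e =
  past-here (const-full (f top ∷ ρ) _ λ z →
               inherited-below {f = f} {ρ = ρ} {z = z} (h (inChild z) top<inChild head<later))
            (const-tab ρ _ _ λ z lt' →
               inherited-beyond {f = f} {ρ = ρ} {z = z} (h (later z) head<later (later-< lt')))
next-past {F = node G ∷ F} f ρ (zero ▹ child k p) (zero ▹ root) lt h ()
next-past {F = node G ∷ F} f ρ (zero ▹ child k p) (zero ▹ child k' q) lt h ()
next-past {F = node G ∷ F} f ρ (zero ▹ child k p) (suc k' ▹ q) lt h e =
  past-down (next-full (f ∘ inChild) (f top ∷ ρ) (k ▹ p) λ z lt' →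
               inherited-inside {f = f} {ρ = ρ} (h (inChild z) (inChild-< lt') head<later))
            (const-tab ρ _ _ λ z lt' →
               inherited-beyond {f = f} {ρ = ρ} {z = z} (h (later z) head<later (later-< lt')))
next-past {F = node G ∷ F} f ρ (suc k ▹ p) (zero ▹ q) (diff≤ () , _) h e
next-past {F = node G ∷ F} f ρ (suc k ▹ p) (suc k' ▹ q) lt h e =
  in-right (next-past (f ∘ later) ρ (k ▹ p) (k' ▹ q) (later-<⁻ lt)
    (λ z lt₁ lt₂ → inherited-later {f = f} {ρ = ρ} (h (later z) (later-< lt₁) (later-< lt₂)))
    (unlater (trans (sym (meet-later (k ▹ p) (k' ▹ q))) e)))
  where
  unlater : {x : Pos (node F)} → later₀ x ≡ root → x ≡ root
  unlater {root} _ = refl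

-- The recursion descends to the meet `w`, moving the predecessors of `w` into `ρ`; the hypothesis
-- on `z ⊏ w` keeps `f w` fresh meanwhile. Once the meet is reached with `u` below it, `u` and `v`
-- lie in different trees and `next-past` takes over.
next-at : (f : V F → X) (ρ : Vec X n) (u v w : V F) → toPos u <T toPos v →
          (∀ z → toPos u <T toPos z → toPos z <T toPos v → Inherited f ρ u z) →
          meet (toPos u) (toPos v) ≡ toPos w → Fresh (f w) ρ →
          (∀ z → toPos z ⊏ toPos w → f z ≢ f w) → Next ρ (tab f u) (f u) (just (f w)) (tab f v)
next-at {F = node G ∷ F} f ρ (zero ▹ root) (zero ▹ root) w lt h e fr un = ⊥-elim (<T-irrefl lt)
next-at {F = node G ∷ F} f ρ (zero ▹ root) (zero ▹ child k' q) w lt h refl fr un =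
  below-here fr (const-tab (f top ∷ ρ) _ _ λ z lt' →
    inherited-below {f = f} {ρ = ρ} {z = z} (h (inChild z) top<inChild (inChild-< lt')))
next-at {F = node G ∷ F} f ρ (zero ▹ root) (suc k' ▹ q) w lt h () fr un
next-at {F = node G ∷ F} f ρ (zero ▹ child k p) (zero ▹ root) w (same≤ () , _) h e fr un
next-at {F = node G ∷ F} f ρ (zero ▹ child k p) (zero ▹ child k' q) w lt h e fr un
  with meet (child {G} k p) (child k' q) in eq
next-at {F = node G ∷ F} f ρ (zero ▹ child k p) (zero ▹ child k' q) w lt h refl fr un | root =
  at-down fr (next-past (f ∘ inChild) (f top ∷ ρ) (k ▹ p) (k' ▹ q) (inChild-<⁻ lt)
    (λ z lt₁ lt₂ → inherited-inside {f = f} {ρ = ρ} (h (inChild z) (inChild-< lt₁) (inChild-< lt₂))) eq)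
next-at {F = node G ∷ F} f ρ (zero ▹ child k p) (zero ▹ child k' q) w lt h refl fr un | child k'' s =
  in-down (next-at (f ∘ inChild) (f top ∷ ρ) (k ▹ p) (k' ▹ q) (k'' ▹ s) (inChild-<⁻ lt)
    (λ z lt₁ lt₂ → inherited-inside {f = f} {ρ = ρ} (h (inChild z) (inChild-< lt₁) (inChild-< lt₂))) eq
    (λ { zero → un top (child⊑ root⊑ , λ ()) ; (suc i) → fr i })
    (λ z (le , ne) → un (inChild z) (child⊑ le , ne ∘ child-injective)))
next-at {F = node G ∷ F} f ρ (zero ▹ child k p) (suc k' ▹ q) w lt h () fr un
next-at {F = node G ∷ F} f ρ (suc k ▹ p) (zero ▹ q) w (diff≤ () , _) h e fr un
next-at {F = node G ∷ F} f ρ (suc k ▹ p) (suc k' ▹ q) w lt h e fr un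
  with meet (child {F} k p) (child k' q) in eq
     | trans (sym (meet-later {τ = node G} (k ▹ p) (k' ▹ q))) e
... | root       | ()
... | child k'' s | refl =
  in-right (next-at (f ∘ later) ρ (k ▹ p) (k' ▹ q) (k'' ▹ s) (later-<⁻ lt)
    (λ z lt₁ lt₂ → inherited-later {f = f} {ρ = ρ} (h (later z) (later-< lt₁) (later-< lt₂))) eq fr
    (λ z (le , ne) → un (later z) (later-⊑ {x = z} {k'' ▹ s} le , λ { refl → ne refl })))

unwrap : V (T ∷ []) → Pos T
unwrap (zero ▹ p) = p

tabT : (Pos T → X) → Pos T → Pre X false (T ∷ [])
tabT f v = tab (f ∘ unwrap) (zero ▹ v)

next-T : (f : Pos T → X) (u v w : Pos T) → u <T v →
         (∀ z → u <T z → z <T v → Σ (Pos T) λ z' → z' ⊑ z × z' ≤T u × f z ≡ f z') →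
         meet u v ≡ w → (∀ z → z ⊏ w → f z ≢ f w) →
         Next [] (tabT f u) (f u) (just (f w)) (tabT f v)
next-T f u v w (le , ne) h e un =
  next-at (f ∘ unwrap) [] (zero ▹ u) (zero ▹ v) (zero ▹ w) (same≤ le , ne ∘ child-injective)
    (λ { (zero ▹ z) (same≤ l₁ , n₁) (same≤ l₂ , n₂) →
         let (z' , p , l , e) = h z (l₁ , n₁ ∘ cong (child zero)) (l₂ , n₂ ∘ cong (child zero))
         in inj₂ (zero ▹ z' , child⊑ p , same≤ l , e) })
    (trans (meet-same zero u v) (cong (child zero) e)) (λ ())
    (λ { (zero ▹ z) (child⊑ p , n) → un z (p , n ∘ cong (child zero)) })

-- Vertices in increasing order, and decidability over finite sets of vertices

enumerate : ∀ F → List (V F)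
enumerate []           = []
enumerate (node G ∷ F) =
  top ∷ (List.map inChild (enumerate G) List.++ List.map later (enumerate F))

enumerate-complete : (x : V F) → x ∈ enumerate F
enumerate-complete {node G ∷ F} (zero ▹ root)      = ListAny.here refl
enumerate-complete {node G ∷ F} (zero ▹ child k p) =
  ListAny.there (∈-++⁺ˡ (∈-map⁺ inChild (enumerate-complete (k ▹ p))))
enumerate-complete {node G ∷ F} (suc k ▹ p)        =
  ListAny.there (∈-++⁺ʳ (List.map inChild (enumerate G)) (∈-map⁺ later (enumerate-complete (k ▹ p))))

enumerate-sorted : ∀ F → AllPairs (λ x y → toPos x <T toPos y) (enumerate F)
enumerate-sorted []           = []
enumerate-sorted (node G ∷ F) =
  AllP.++⁺ (AllP.map⁺ (All.universal (λ _ → top<inChild) (enumerate G)))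
           (AllP.map⁺ (All.universal (λ _ → head<later) (enumerate F))) ∷
  AllPairsP.++⁺ (AllPairsP.map⁺ (AllPairs.map inChild-< (enumerate-sorted G)))
    (AllPairsP.map⁺ (AllPairs.map later-< (enumerate-sorted F)))
    (AllP.map⁺ (All.universal (λ _ → AllP.map⁺ (All.universal (λ _ → head<later) (enumerate F)))
                              (enumerate G)))

Greatest : Pos T → Set
Greatest {T} ℓ = (z : Pos T) → z ≤T ℓ

data Walk {T : Tree} (ℓ : Pos T) : Pos T → List (Pos T) → Set where
  stop : Greatest ℓ → Walk ℓ ℓ []
  _∷_  : ∀ {x y ys} → (x <T y × (∀ z → x <T z → y ≤T z)) → Walk ℓ y ys → Walk ℓ x (y ∷ ys)

sorted-walk : (x : Pos T) (xs : List (Pos T)) → AllPairs _<T_ (x ∷ xs) →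
              (∀ z → z <T x ⊎ z ∈ x ∷ xs) → Σ (Pos T) λ ℓ → Walk ℓ x xs
sorted-walk x [] _ cover = x , stop max
  where
  max : Greatest x
  max z with cover z
  ... | inj₁ (le , _)            = le
  ... | inj₂ (ListAny.here refl) = ≤T-refl
sorted-walk x (y ∷ ys) ((x<y ∷ _) ∷ s@(y<ys ∷ _)) cover with sorted-walk y ys s cover'
  where
  cover' : ∀ z → z <T y ⊎ z ∈ y ∷ ys
  cover' z with cover z
  ... | inj₁ z<x                  = inj₁ (<T-trans z<x x<y)
  ... | inj₂ (ListAny.here refl)  = inj₁ x<y
  ... | inj₂ (ListAny.there z∈)   = inj₂ z∈
... | ℓ , w = ℓ , (x<y , least) ∷ w
  where
  least : ∀ z → x <T z → y ≤T z
  least z x<z with cover z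
  ... | inj₁ z<x                                = ⊥-elim (<T-irrefl (<T-trans x<z z<x))
  ... | inj₂ (ListAny.here refl)                = ⊥-elim (<T-irrefl x<z)
  ... | inj₂ (ListAny.there (ListAny.here refl)) = ≤T-refl
  ... | inj₂ (ListAny.there (ListAny.there z∈)) = proj₁ (All.lookup y<ys z∈)

unwrap-≤ : {x y : V (T ∷ [])} → toPos x ≤T toPos y → unwrap x ≤T unwrap y
unwrap-≤ {x = zero ▹ p} {zero ▹ q} (same≤ h) = h

unwrap-< : {x y : V (T ∷ [])} → toPos x <T toPos y → unwrap x <T unwrap y
unwrap-< {x = zero ▹ p} {zero ▹ q} (same≤ h , ne) = h , ne ∘ cong (child zero)

walk : ∀ T → Σ (List (Pos T)) λ xs → Σ (Pos T) λ ℓ → Walk ℓ (rootOf T) xs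
walk (node G) = _ , sorted-walk root _
  (AllPairsP.map⁺ {f = unwrap} (AllPairs.map unwrap-< (enumerate-sorted (node G ∷ []))))
  (λ z → inj₂ (∈-map⁺ unwrap (enumerate-complete (zero ▹ z))))

finite-V : ∀ F → Finite (V F)
finite-V []           = retract (finite-Fin {0}) (λ { (() ▹ _) }) (λ ()) (λ { (() ▹ _) })
finite-V (node G ∷ F) =
  retract (finite-⊎ (finite-Fin {1}) (finite-⊎ (finite-V G) (finite-V F)))
    (λ { (zero ▹ root) → inj₁ zero ; (zero ▹ child k p) → inj₂ (inj₁ (k ▹ p))
       ; (suc k ▹ p) → inj₂ (inj₂ (k ▹ p)) })
    (λ { (inj₁ _) → top ; (inj₂ (inj₁ x)) → inChild x ; (inj₂ (inj₂ x)) → later x })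
    (λ { (zero ▹ root) → refl ; (zero ▹ child k p) → refl ; (suc k ▹ p) → refl })

finite-Pos : Finite (Pos T)
finite-Pos {T} = retract (finite-V (T ∷ [])) (zero ▹_) unwrap (λ _ → refl)

all-dec : Finite A → {P : A → Set} → (∀ x → Dec (P x)) → Dec (∀ x → P x)
all-dec FA {P} P? with FinP.all? (λ k → P? (Finite.elem FA k))
... | yes f = yes λ x → subst P (Finite.elem-index FA x) (f (Finite.index FA x))
... | no f  = no λ g → f (g ∘ Finite.elem FA)

-- Reading the vertex and the labels off a labelled vertex

vertex : Pre X false F → V F
vertex here          = top
vertex (down x p)    = inChild (vertex p)
vertex (right x l p) = later (vertex p)

vertex-tab : (f : V F → X) (v : V F) → vertex (tab f v) ≡ v
vertex-tab {F = node G ∷ F} f (zero ▹ root)      = refl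
vertex-tab {F = node G ∷ F} f (zero ▹ child k p) = cong inChild (vertex-tab (f ∘ inChild) (k ▹ p))
vertex-tab {F = node G ∷ F} f (suc k ▹ p)        = cong later (vertex-tab (f ∘ later) (k ▹ p))

labOf : Pre X b F → V F → Maybe X
labOf here          _                  = nothing
labOf (down x p)    (zero ▹ root)      = just x
labOf (down x p)    (zero ▹ child k q) = labOf p (k ▹ q)
labOf (down x p)    (suc k ▹ q)        = nothing
labOf (right x l p) (zero ▹ root)      = just x
labOf (right x l p) (zero ▹ child k q) = labOf l (k ▹ q)
labOf (right x l p) (suc k ▹ q)        = labOf p (k ▹ q)

labOf-full : (f : V F → X) (z : V F) → labOf (full f) z ≡ just (f z)
labOf-full {F = node G ∷ F} f (zero ▹ root)      = refl
labOf-full {F = node G ∷ F} f (zero ▹ child k p) = labOf-full (f ∘ inChild) (k ▹ p)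
labOf-full {F = node G ∷ F} f (suc k ▹ p)        = labOf-full (f ∘ later) (k ▹ p)

labOf-< : (f : V F → X) (v z : V F) → toPos z <T toPos v → labOf (tab f v) z ≡ just (f z)
labOf-< {F = node G ∷ F} f (zero ▹ root) (zero ▹ root) lt = ⊥-elim (<T-irrefl lt)
labOf-< {F = node G ∷ F} f (zero ▹ root) (zero ▹ child _ _) (same≤ () , _)
labOf-< {F = node G ∷ F} f (zero ▹ root) (suc _ ▹ _) (diff≤ () , _)
labOf-< {F = node G ∷ F} f (zero ▹ child k p) (zero ▹ root) lt = refl
labOf-< {F = node G ∷ F} f (zero ▹ child k p) (zero ▹ child k' q) lt =
  labOf-< (f ∘ inChild) (k ▹ p) (k' ▹ q) (inChild-<⁻ lt)
labOf-< {F = node G ∷ F} f (zero ▹ child k p) (suc _ ▹ _) (diff≤ () , _)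
labOf-< {F = node G ∷ F} f (suc k ▹ p) (zero ▹ root) lt = refl
labOf-< {F = node G ∷ F} f (suc k ▹ p) (zero ▹ child k' q) lt = labOf-full (f ∘ inChild) (k' ▹ q)
labOf-< {F = node G ∷ F} f (suc k ▹ p) (suc k' ▹ q) lt =
  labOf-< (f ∘ later) (k ▹ p) (k' ▹ q) (later-<⁻ lt)

labOf-≥ : (f : V F → X) (v z : V F) → toPos v ≤T toPos z → labOf (tab f v) z ≡ nothing
labOf-≥ {F = node G ∷ F} f (zero ▹ root) z le = refl
labOf-≥ {F = node G ∷ F} f (zero ▹ child k p) (zero ▹ root) (same≤ ())
labOf-≥ {F = node G ∷ F} f (zero ▹ child k p) (zero ▹ child k' q) (same≤ le) =
  labOf-≥ (f ∘ inChild) (k ▹ p) (k' ▹ q) le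
labOf-≥ {F = node G ∷ F} f (zero ▹ child k p) (suc k' ▹ q) le = refl
labOf-≥ {F = node G ∷ F} f (suc k ▹ p) (zero ▹ q) (diff≤ ())
labOf-≥ {F = node G ∷ F} f (suc k ▹ p) (suc k' ▹ q) le =
  labOf-≥ (f ∘ later) (k ▹ p) (k' ▹ q) (later-≤⁻ {z = k ▹ p} {k' ▹ q} le)

search : (V F → Bool) → Maybe (V F)
search {[]}         Q = nothing
search {node G ∷ F} Q =
  if Q top then just top
  else (Maybe.map inChild (search (Q ∘ inChild)) Maybe.<∣> Maybe.map later (search (Q ∘ later)))

search-nothing : (Q : V F → Bool) → (∀ z → Q z ≡ false) → search Q ≡ nothing
search-nothing {[]}         Q h = refl
search-nothing {node G ∷ F} Q h
  rewrite h top | search-nothing (Q ∘ inChild) (h ∘ inChild) | search-nothing (Q ∘ later) (h ∘ later)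
  = refl

search-first : (Q : V F → Bool) (a : V F) → Q a ≡ true →
               (∀ z → toPos z <T toPos a → Q z ≡ false) → search Q ≡ just a
search-first {node G ∷ F} Q (zero ▹ root)      e h rewrite e = refl
search-first {node G ∷ F} Q (zero ▹ child k p) e h
  rewrite h top top<inChild
        | search-first (Q ∘ inChild) (k ▹ p) e (λ z lt → h (inChild z) (inChild-< lt)) = refl
search-first {node G ∷ F} Q (suc k ▹ p)        e h
  rewrite h top head<later
        | search-nothing (Q ∘ inChild) (λ z → h (inChild z) head<later)
        | search-first (Q ∘ later) (k ▹ p) e (λ z lt → h (later z) (later-< lt)) = refl

-- The rigid surjection and the canonical embedding of a copy

module Pure {U T : Tree} (t : FMor 0 (U ∷ []) (T ∷ [])) where

  copy : Pos T → Pos U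
  copy x = unwrap (image t (zero ▹ x))

  project : Pos U → Pos T
  project y = unwrap (induced t [] id (zero ▹ y))

  wrap-unwrap : ∀ {T} (x : V (T ∷ [])) → zero ▹ unwrap x ≡ x
  wrap-unwrap (zero ▹ p) = refl

  project-copy : ∀ x → project (copy x) ≡ x
  project-copy x = cong unwrap
    (trans (cong (induced t [] id) (wrap-unwrap (image t (zero ▹ x)))) (induced-image t [] id (zero ▹ x)))

  copy-project : ∀ y → copy (project y) ⊑ y
  copy-project y with source t [] id (zero ▹ y)
  ... | inj₂ (x , e , h) = subst (_⊑ y)
    (cong (unwrap ∘ image t) (trans (sym e) (sym (wrap-unwrap (induced t [] id (zero ▹ y))))))
    (unwrap-⊑ (image t x) h)
    where
    unwrap-⊑ : (z : V (U ∷ [])) → toPos z ⊑ child zero y → unwrap z ⊑ y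
    unwrap-⊑ (zero ▹ p) (child⊑ h) = h

  copy-mono : ∀ {x y} → x ≤T y → copy x ≤T copy y
  copy-mono {x} {y} h =
    unwrap-≤ {x = image t (zero ▹ x)} {image t (zero ▹ y)} (image-mono t (same≤ h))

  copy-injective : ∀ {x y} → copy x ≡ copy y → x ≡ y
  copy-injective {x} {y} e =
    trans (sym (project-copy x)) (trans (cong project e) (project-copy y))

  copy-< : ∀ {x y} → x <T y → copy x <T copy y
  copy-< (h , ne) = copy-mono h , ne ∘ copy-injective

  copy-meet : ∀ x y → copy (meet x y) ≡ meet (copy x) (copy y)
  copy-meet x y = unwrap-meet (image t (zero ▹ meet x y)) (image t (zero ▹ x)) (image t (zero ▹ y))
    (trans (cong (image₀ t) (sym (meet-same zero x y))) (image-meet t (zero ▹ x) (zero ▹ y)))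
    where
    unwrap-meet : (a b c : V (U ∷ [])) → toPos a ≡ meet (toPos b) (toPos c) →
                  unwrap a ≡ meet (unwrap b) (unwrap c)
    unwrap-meet (zero ▹ a) (zero ▹ b) (zero ▹ c) e = child-injective e

  pev-tabT : (f : Pos T → X) (v : Pos T) → pev [] t (tabT f v) ≡ tabT (f ∘ project) (copy v)
  pev-tabT f v = trans (pev-tab t [] (f ∘ unwrap) (zero ▹ v))
    (trans (tab-cong (λ { z@(zero ▹ p) → sym (induced-map (f ∘ unwrap) t [] id z) }) (image t (zero ▹ v)))
           (cong (tab (f ∘ project ∘ unwrap)) (sym (wrap-unwrap (image t (zero ▹ v))))))

  copy-root : copy (rootOf T) ≡ rootOf U
  copy-root = below-root (⊑-trans (above-root (project (rootOf U))) (copy-project (rootOf U)))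
    where
    below-root : ∀ {T} {x : Pos T} → x ⊑ rootOf T → x ≡ rootOf T
    below-root {node _} root⊑ = refl
    root-meet : ∀ {T} (y : Pos T) → meet (rootOf T) y ≡ rootOf T
    root-meet {node _} y = refl
    above-root : ∀ y → copy (rootOf T) ⊑ copy y
    above-root y = subst (_⊑ copy y)
      (trans (sym (copy-meet (rootOf T) y)) (cong copy (root-meet y)))
      (meet-⊑ʳ (copy (rootOf T)) (copy y))

-- Strong connections as sequences of points

-- e is the embedding of the rigid surjection s and ℓ the greatest vertex of S.
Valid : Pos S → Pos T → (Pos T → Pos S) → (i e : Pos S → Pos T) → Set
Valid ℓ v s i e =
  IsEmbedding (Initial v) e × (∀ x → s (e x) ≡ x) × (∀ y → y ≤T v → e (s y) ⊑ y) ×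
  IsEmbedding (Initial v) i × (∀ x → s (i x) ≡ x) ×
  (∀ x y → y ≤T v → y <T i x → s y ≤T x) × i ℓ ≡ v

isEmbedding? : (v : Pos T) (i : Pos S → Pos T) → Dec (IsEmbedding (Initial v) i)
isEmbedding? v i =
  (i (rootOf _) ≟P rootOf _) ×-dec all-dec finite-Pos (λ x → i x ≤T? v) ×-dec
  all-dec finite-Pos (λ x → all-dec finite-Pos λ y → (x <T? y) →-dec (i x <T? i y)) ×-dec
  all-dec finite-Pos (λ x → all-dec finite-Pos λ y → i (meet x y) ≟P meet (i x) (i y))

-- Needed to colour arbitrary labelled vertices, most of which do not come from a strong connection.
valid? : (ℓ : Pos S) (v : Pos T) (s : Pos T → Pos S) (i e : Pos S → Pos T) → Dec (Valid ℓ v s i e)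
valid? ℓ v s i e =
  isEmbedding? v e ×-dec all-dec finite-Pos (λ x → s (e x) ≟P x) ×-dec
  all-dec finite-Pos (λ y → (y ≤T? v) →-dec (e (s y) ⊑? y)) ×-dec
  isEmbedding? v i ×-dec all-dec finite-Pos (λ x → s (i x) ≟P x) ×-dec
  all-dec finite-Pos (λ x → all-dec finite-Pos λ y →
    (y ≤T? v) →-dec ((y <T? i x) →-dec (s y ≤T? x))) ×-dec
  (i ℓ ≟P v)

embedding-cong : {v : Pos T} {i i' : Pos S → Pos T} → (∀ x → i x ≡ i' x) →
                 IsEmbedding (Initial v) i → IsEmbedding (Initial v) i'
embedding-cong {v = v} eq (r , d , lt , m) =
  trans (sym (eq _)) r , (λ x → subst (_≤T v) (eq x) (d x)) ,
  (λ x y h → subst₂ _<T_ (eq x) (eq y) (lt x y h)) ,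
  (λ x y → trans (sym (eq _)) (trans (m x y) (cong₂ meet (eq x) (eq y))))

valid-cong : {ℓ : Pos S} {v v' : Pos T} {s s' : Pos T → Pos S} {i i' e e' : Pos S → Pos T} →
             v ≡ v' → (∀ y → y ≤T v → s y ≡ s' y) → (∀ x → i x ≡ i' x) → (∀ x → e x ≡ e' x) →
             Valid ℓ v s i e → Valid ℓ v' s' i' e'
valid-cong {s' = s'} {e = e} refl sEq iEq eEq (eE@(_ , eD , _) , se , es , iE@(_ , iD , _) , si , bd , lst) =
  embedding-cong eEq eE ,
  (λ x → trans (trans (cong s' (sym (eEq x))) (sym (sEq _ (eD x)))) (se x)) ,
  (λ y h → subst (_⊑ y) (trans (cong e (sEq y h)) (eEq _)) (es y h)) ,
  embedding-cong iEq iE ,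
  (λ x → trans (trans (cong s' (sym (iEq x))) (sym (sEq _ (iD x)))) (si x)) ,
  (λ x y h lt → subst (_≤T x) (sEq y h) (bd x y h (subst (y <T_) (sym (iEq x)) lt))) ,
  trans (sym (iEq _)) lst

-- A greatest vertex for `≤T` is a leaf, hence the largest leaf. This is what turns the condition on
-- largest leaves into `i ℓ ≡ v`.
initial-leaf : (v : Pos T) → IsLargestLeafIn (Initial v) v
initial-leaf v = (≤T-refl , λ y h g → ≤T-antisym h (⊑⇒≤ g)) , λ y h → proj₁ h

initial-leaf-unique : {v a : Pos T} → IsLargestLeafIn (Initial v) a → a ≡ v
initial-leaf-unique {v = v} ((a≤v , _) , max) = ≤T-antisym a≤v (max v (proj₁ (initial-leaf v)))

greatest-leaf : {ℓ : Pos T} → Greatest ℓ → IsLargestLeafIn Full ℓ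
greatest-leaf g = (tt , λ y _ h → ≤T-antisym (g y) (⊑⇒≤ h)) , λ y _ → g y

greatest-leaf-unique : {ℓ a : Pos T} → Greatest ℓ → IsLargestLeafIn Full a → a ≡ ℓ
greatest-leaf-unique {ℓ = ℓ} g (_ , max) = ≤T-antisym (g _) (max ℓ (proj₁ (greatest-leaf g)))

valid⇒strong : {ℓ : Pos S} {v : Pos T} {s : Pos T → Pos S} {i e : Pos S → Pos T} → Greatest ℓ →
               Valid ℓ v s i e → IsStrongConnection (Initial v) s i
valid⇒strong {v = v} {i = i} g (eE , se , es , iE , si , bd , lst) =
  ((_ , eE , se , es) , iE , si , bd) , λ a h →
  subst (IsLargestLeafIn (Initial v)) (sym (trans (cong i (greatest-leaf-unique g h)) lst))
        (initial-leaf v)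

strong⇒valid : {ℓ : Pos S} {v : Pos T} {s : Pos T → Pos S} {i : Pos S → Pos T} → Greatest ℓ →
               IsStrongConnection (Initial v) s i → Σ (Pos S → Pos T) λ e → Valid ℓ v s i e
strong⇒valid {ℓ = ℓ} g (((e , eE , se , es) , iE , si , bd) , lf) =
  e , eE , se , es , iE , si , bd , initial-leaf-unique (lf ℓ (greatest-leaf g))

valid-id : {ℓ : Pos T} → Greatest ℓ → Valid ℓ ℓ id id id
valid-id g = idE , (λ _ → refl) , (λ _ _ → ⊑-refl) , idE , (λ _ → refl) , (λ _ _ _ → proj₁) , refl
  where idE = refl , g , (λ _ _ h → h) , (λ _ _ → refl)

module _ {U T : Tree} (t : FMor 0 (U ∷ []) (T ∷ [])) where
  open Pure t

  copy-reflects : ∀ {x y} → copy x ≤T copy y → x ≤T y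
  copy-reflects {x} {y} h with ≤T-total x y
  ... | inj₁ g = g
  ... | inj₂ g = subst (_≤T y) (copy-injective (≤T-antisym (copy-mono g) h)) ≤T-refl

  copy-⊑ : ∀ {x y} → x ⊑ y → copy x ⊑ copy y
  copy-⊑ {x} {y} h = subst (_⊑ copy y)
    (trans (sym (copy-meet x y)) (cong copy (⊑⇒meet h))) (meet-⊑ʳ (copy x) (copy y))

  project-≤ : ∀ {y x} → y ≤T copy x → project y ≤T x
  project-≤ {y} h = copy-reflects (≤T-trans (⊑⇒≤ (copy-project y)) h)

  copy-embedding : {v : Pos T} {i : Pos S → Pos T} → IsEmbedding (Initial v) i →
                   IsEmbedding (Initial (copy v)) (copy ∘ i)
  copy-embedding (r , d , lt , m) =
    trans (cong copy r) copy-root , (λ x → copy-mono (d x)) , (λ x y h → copy-< (lt x y h)) ,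
    (λ x y → trans (cong copy (m x y)) (copy-meet _ _))

  valid-copy : {ℓ : Pos S} {v : Pos T} {s : Pos T → Pos S} {i e : Pos S → Pos T} →
               Valid ℓ v s i e → Valid ℓ (copy v) (s ∘ project) (copy ∘ i) (copy ∘ e)
  valid-copy {v = v} {s} {i} {e} (eE , se , es , iE , si , bd , lst) =
    copy-embedding eE , (λ x → trans (cong s (project-copy (e x))) (se x)) ,
    (λ y h → ⊑-trans (copy-⊑ (es (project y) (project-≤ h))) (copy-project y)) ,
    copy-embedding iE , (λ x → trans (cong s (project-copy (i x))) (si x)) , below ,
    cong copy lst
    where
    below : ∀ x y → y ≤T copy v → y <T copy (i x) → s (project y) ≤T x
    below x y h (le , _) with project y ≟P i x
    ... | yes e = subst (_≤T x) (sym (trans (cong s e) (si x))) ≤T-refl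
    ... | no ne = bd x (project y) (project-≤ h) (project-≤ le , ne)

module StrongFacts {S T : Tree} {ℓ : Pos S} {v : Pos T} {s : Pos T → Pos S} {i e : Pos S → Pos T}
                   (valid : Valid ℓ v s i e) where

  e-emb : IsEmbedding (Initial v) e
  e-emb = proj₁ valid

  s-e : ∀ x → s (e x) ≡ x
  s-e = proj₁ (proj₂ valid)

  e-s : ∀ y → y ≤T v → e (s y) ⊑ y
  e-s = proj₁ (proj₂ (proj₂ valid))

  i-emb : IsEmbedding (Initial v) i
  i-emb = proj₁ (proj₂ (proj₂ (proj₂ valid)))

  s-i : ∀ x → s (i x) ≡ x
  s-i = proj₁ (proj₂ (proj₂ (proj₂ (proj₂ valid))))

  s-below : ∀ x y → y ≤T v → y <T i x → s y ≤T x
  s-below = proj₁ (proj₂ (proj₂ (proj₂ (proj₂ (proj₂ valid)))))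

  i-last : i ℓ ≡ v
  i-last = proj₂ (proj₂ (proj₂ (proj₂ (proj₂ (proj₂ valid)))))

  e≤v : ∀ x → e x ≤T v
  e≤v = proj₁ (proj₂ e-emb)

  i≤v : ∀ x → i x ≤T v
  i≤v = proj₁ (proj₂ i-emb)

  i-< : ∀ {x y} → x <T y → i x <T i y
  i-< = proj₁ (proj₂ (proj₂ i-emb)) _ _

  e-< : ∀ {x y} → x <T y → e x <T e y
  e-< = proj₁ (proj₂ (proj₂ e-emb)) _ _

  i-≤ : ∀ {x y} → x ≤T y → i x ≤T i y
  i-≤ {x} {y} h with x ≟P y
  ... | yes refl = ≤T-refl
  ... | no ne    = proj₁ (i-< (h , ne))

  i-meet : ∀ x y → i (meet x y) ≡ meet (i x) (i y)
  i-meet = proj₂ (proj₂ (proj₂ i-emb))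

  e-meet : ∀ x y → e (meet x y) ≡ meet (e x) (e y)
  e-meet = proj₂ (proj₂ (proj₂ e-emb))

  e⊑i : ∀ x → e x ⊑ i x
  e⊑i x = subst (λ z → e z ⊑ i x) (s-i x) (e-s (i x) (i≤v x))

  -- If `e y` came before `i x`, the connection would give `y = s (e y) ≤T x`. This makes the
  -- sequence of points increasing.
  i<e : ∀ {x y} → x <T y → i x <T e y
  i<e {x} {y} x<y = le , ne
    where
    ne : i x ≢ e y
    ne eq = proj₂ x<y (trans (sym (s-i x)) (trans (cong s eq) (s-e y)))
    le : i x ≤T e y
    le with ≤T-total (i x) (e y)
    ... | inj₁ h = h
    ... | inj₂ h = ⊥-elim (≤⇒≯ (subst (_≤T x) (s-e y) (s-below x (e y) (e≤v y) (h , ne ∘ sym))) x<y)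

  -- Both are predecessors of `i y`, hence comparable, and `i<e` excludes the wrong order.
  i⊑e : ∀ {x y} → x ⊏ y → i x ⊑ e y
  i⊑e {x} {y} (h , ne) with ⊑-linear (subst (_⊑ i y) (trans (sym (i-meet x y)) (cong i (⊑⇒meet h)))
                                             (meet-⊑ʳ (i x) (i y))) (e⊑i y)
  ... | inj₁ g = g
  ... | inj₂ g = ⊥-elim (≤⇒≯ (⊑⇒≤ g) (i<e (⊑⇒≤ h , ne)))

  -- The vertex `i (meet x y)` is still below `e y`, by `i⊑e`: since `x` comes before `y`, the meet
  -- is a proper predecessor of `y`.
  meet-i-e : ∀ {x y} → x <T y → meet (i x) (e y) ≡ i (meet x y)
  meet-i-e {x} {y} x<y = ⊑-antisym
    (subst (meet (i x) (e y) ⊑_) (sym (i-meet x y))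
      (meet-greatest (meet-⊑ˡ (i x) (e y)) (⊑-trans (meet-⊑ʳ (i x) (e y)) (e⊑i y))))
    (meet-greatest
      (subst (_⊑ i x) (sym (i-meet x y)) (meet-⊑ˡ (i x) (i y)))
      (i⊑e (meet-⊑ʳ x y , λ eq → ≤⇒≯ (⊑⇒≤ (subst (_⊑ x) eq (meet-⊑ˡ x y))) x<y)))

  bit : Pos S → Bool
  bit x = not (does (e x ≟P i x))

  bit-false : ∀ {x} → bit x ≡ false → e x ≡ i x
  bit-false {x} h with e x ≟P i x
  ... | yes eq = eq
  ... | no _   with () ← h

  bit-true : ∀ {x} → bit x ≡ true → e x ≢ i x
  bit-true {x} h with e x ≟P i x
  ... | no ne = ne
  ... | yes _ with () ← h

  -- The letter `(x , false)` occurs first at `e x`, and `(x , true)` occurs only at `i x`, and only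
  -- if `i x` differs from `e x`.
  letter : Pos T → Pos S × Bool
  letter y = s y , does (y ≟P i (s y)) ∧ bit (s y)

  letter-i : ∀ x → letter (i x) ≡ (x , bit x)
  letter-i x = trans (cong (λ z → z , does (i x ≟P i z) ∧ bit z) (s-i x))
    (cong (λ b → x , b ∧ bit x) (dec-true (i x ≟P i x) refl))

  letter-e : ∀ x → letter (e x) ≡ (x , false)
  letter-e x = trans (cong (λ z → z , does (e x ≟P i z) ∧ bit z) (s-e x)) (cong (x ,_) excluded)
    where
    excluded : does (e x ≟P i x) ∧ bit x ≡ false
    excluded with e x ≟P i x
    ... | yes _ = refl
    ... | no _  = refl

  letter-no-i : ∀ {y} → y ≢ i (s y) → letter y ≡ (s y , false)
  letter-no-i {y} ne = cong (λ b → s y , b ∧ bit (s y)) (dec-false (y ≟P i (s y)) ne)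

  letter-true : ∀ {y x} → letter y ≡ (x , true) → y ≡ i x × bit x ≡ true
  letter-true {y} {x} eq with y ≟P i (s y) | cong proj₁ eq | cong proj₂ eq
  ... | yes p | refl | q = p , q
  ... | no _  | _    | ()

  letter-s : ∀ {y x b} → letter y ≡ (x , b) → s y ≡ x
  letter-s = cong proj₁

-- The points i x in increasing order of x, each preceded by e x if this is
-- another point.
script : (Pos S → Bool) → Pos S → List (Pos S) → Script (Pos S × Bool) → Script (Pos S × Bool)
script bit x []       sc = sc
script bit x (y ∷ ys) sc = script bit y ys
  (if bit y then ((y , false) , (y , false)) ∷ sc' else sc')
  where sc' = ((x , bit x) , (meet x y , bit (meet x y))) ∷ sc

script-cong : {bit bit' : Pos S → Bool} → (∀ x → bit x ≡ bit' x) →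
              ∀ x xs sc → script bit x xs sc ≡ script bit' x xs sc
script-cong eq x []       sc = refl
script-cong {bit' = bit'} eq x (y ∷ ys) sc
  rewrite eq x | eq y | eq (meet x y) = script-cong eq y ys _

module Following {S T : Tree} {ℓ : Pos S} {v : Pos T} {s : Pos T → Pos S} {i e : Pos S → Pos T}
                 (valid : Valid ℓ v s i e) where
  open StrongFacts valid

  -- A vertex `z` between the two points has `s z ≤T x`: values beyond `y` are excluded before
  -- `i y`, the value `y` does not occur before `e y`, and `y` is next after `x`. So `z` comes too
  -- late to be `i (s z)` and repeats the letter of `e (s z)`.
  step-to-e : ∀ {sc x y} → x <T y → (∀ z → x <T z → y ≤T z) → Follows sc (tabT letter (i x)) →
    Follows (((x , bit x) , (meet x y , bit (meet x y))) ∷ sc) (tabT letter (e y))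
  step-to-e {sc} {x} {y} x<y least fol =
    subst₂ (λ a b → Follows ((a , b) ∷ sc) (tabT letter (e y))) (letter-i x) (letter-i w)
      (step fol (next-T letter (i x) (e y) (i w) (i<e x<y) between (meet-i-e x<y) fresh))
    where
    w = meet x y
    between : ∀ z → i x <T z → z <T e y → Σ (Pos T) λ z' → z' ⊑ z × z' ≤T i x × letter z ≡ letter z'
    between z ix<z z<ey = e (s z) , e-s z z≤v , e≤ix ,
      trans (letter-no-i (λ eq → ≤⇒≯ (subst (_≤T i x) (sym eq) (i-≤ sz≤x)) ix<z))
            (sym (letter-e (s z)))
      where
      z≤v : z ≤T v
      z≤v = ≤T-trans (proj₁ z<ey) (e≤v y)
      sz<y : s z <T y
      sz<y = s-below y z z≤v (<≤T-trans z<ey (⊑⇒≤ (e⊑i y))) ,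
        λ eq → ≤⇒≯ (⊑⇒≤ (subst (λ u → e u ⊑ z) eq (e-s z z≤v))) z<ey
      sz≤x : s z ≤T x
      sz≤x = ≮⇒≥ x (s z) (λ lt → ≤⇒≯ (least (s z) lt) sz<y)
      e≤ix : e (s z) ≤T i x
      e≤ix = ≤T-trans (⊑⇒≤ (e⊑i (s z))) (i-≤ sz≤x)
    -- The letter `(w , true)` occurs at `i w` only; if the bit of `w` is `false`, then `i w` is
    -- `e w`, which lies below every vertex with value `w`.
    fresh : ∀ z → z ⊏ i w → letter z ≢ letter (i w)
    fresh z (h , ne) eq with bit w in b | trans eq (letter-i w)
    ... | true  | eq' = ne (proj₁ (letter-true eq'))
    ... | false | eq' = ne (⊑-antisym h (subst (_⊑ z)
      (trans (cong e (letter-s eq')) (bit-false b)) (e-s z (≤T-trans (⊑⇒≤ h) (i≤v w)))))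

  -- Before `i x` the values are at most `x`. A vertex `z` between the points is not `i (s z)`: for
  -- a smaller value that point lies before `e x`, and for `x` itself it is the end of the step.
  step-to-i : ∀ {sc x} → bit x ≡ true → Follows sc (tabT letter (e x)) →
    Follows (((x , false) , (x , false)) ∷ sc) (tabT letter (i x))
  step-to-i {sc} {x} b fol =
    subst₂ (λ a b → Follows ((a , b) ∷ sc) (tabT letter (i x))) (letter-e x) (letter-e x)
      (step fol (next-T letter (e x) (i x) (e x) (⊑⇒≤ (e⊑i x) , bit-true b) between
                        (⊑⇒meet (e⊑i x)) fresh))
    where
    between : ∀ z → e x <T z → z <T i x → Σ (Pos T) λ z' → z' ⊑ z × z' ≤T e x × letter z ≡ letter z'
    between z ex<z z<ix = e (s z) , e-s z z≤v , e≤ex , trans (letter-no-i not-i) (sym (letter-e (s z)))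
      where
      z≤v : z ≤T v
      z≤v = ≤T-trans (proj₁ z<ix) (i≤v x)
      sz≤x : s z ≤T x
      sz≤x = s-below x z z≤v z<ix
      e≤ex : e (s z) ≤T e x
      e≤ex with s z ≟P x
      ... | yes eq = subst (λ w → e w ≤T e x) (sym eq) ≤T-refl
      ... | no ne  = proj₁ (e-< (sz≤x , ne))
      not-i : z ≢ i (s z)
      not-i eq with s z ≟P x
      ... | yes eq' = proj₂ z<ix (trans eq (cong i eq'))
      ... | no ne   = <T-irrefl (<T-trans ex<z (subst (_<T e x) (sym eq) (i<e (sz≤x , ne))))
    fresh : ∀ z → z ⊏ e x → letter z ≢ letter (e x)
    fresh z (h , ne) eq = ne (⊑-antisym h (subst (λ w → e w ⊑ z)
      (letter-s (trans eq (letter-e x))) (e-s z (≤T-trans (⊑⇒≤ h) (e≤v x)))))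

  follow : ∀ {x xs sc} → Walk ℓ x xs → Follows sc (tabT letter (i x)) →
           Follows (script bit x xs sc) (tabT letter v)
  follow (stop _) fol = subst (λ w → Follows _ (tabT letter w)) i-last fol
  follow {x} {y ∷ ys} {sc} ((x<y , least) ∷ w) fol with bit y in b
  ... | true  = follow w (step-to-i b (step-to-e x<y least fol))
  ... | false = follow w (subst (λ z → Follows (((x , bit x) , (meet x y , bit (meet x y))) ∷ sc) (tabT letter z))
                                (bit-false b)
                                (step-to-e x<y least fol))

  follow-root : ∀ {xs} → Walk ℓ (rootOf S) xs → Follows (script bit (rootOf S) xs []) (tabT letter v)
  follow-root w = follow w (subst (λ z → Follows [] (tabT letter z)) (sym (proj₁ i-emb)) (start-root {f = letter}))
    where
    start-root : ∀ {T} {f : Pos T → X} → Follows [] (tabT f (rootOf T))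
    start-root {T = node G} = start

module Bits {S T : Tree} (h : Hom S T) {ℓ : Pos S} {e : Pos S → Pos T}
            (valid : Valid ℓ (pt (rawOf h)) (sur (rawOf h)) (emb (rawOf h)) e) where
  open StrongFacts valid

  private
    i = emb (rawOf h)
    Fibre : Pos S → Pos T → Set
    Fibre x y = y ≤T pt (rawOf h) × sur (rawOf h) y ≡ x

  -- The fibre contains its own lower bound `e x`, so `e` is the canonical embedding `i_s`, and B
  -- can be studied by comparing `e` with `i`.
  meet-of-fibre : ∀ x → IsMeetOf (Fibre x) (e x)
  meet-of-fibre x = (λ { y (le , refl) → e-s y le }) , λ z lower → lower (e x) (e≤v x , s-e x)

  in-B : ∀ {x} → SetB h x → e x ≢ i x
  in-B {x} (_ , ¬meet) eq = ¬meet (subst (IsMeetOf (Fibre x)) eq (meet-of-fibre x))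

  -- At a branching vertex x the meet of the copies e y and e z of two immediate
  -- successors is e x, and i x is below both.
  to-B : ∀ {x} → e x ≢ i x → SetB h x
  to-B {x} ne = ((λ { refl → ne (trans (proj₁ e-emb) (sym (proj₁ i-emb))) }) , single) ,
    λ m → ne (⊑-antisym (proj₂ m (e x) (proj₁ (meet-of-fibre x)))
                        (proj₂ (meet-of-fibre x) (i x) (proj₁ m)))
    where
    single : ∀ y z → ImmSucc x y → ImmSucc x z → y ≡ z
    single y z (x⊏y , onlyY) (x⊏z , onlyZ) with meet y z ≟P x
    ... | no x≢m = trans (sym (onlyY _ x⊏m (meet-⊑ˡ y z))) (onlyZ _ x⊏m (meet-⊑ʳ y z))
      where
      x⊏m : x ⊏ meet y z
      x⊏m = meet-greatest (proj₁ x⊏y) (proj₁ x⊏z) , x≢m ∘ sym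
    ... | yes eq = ⊥-elim (ne (⊑-antisym (e⊑i x)
      (subst (i x ⊑_) (trans (sym (e-meet y z)) (cong e eq)) (meet-greatest (i⊑e x⊏y) (i⊑e x⊏z)))))

same-bits : {S T : Tree} (h h' : Hom S T) {ℓ ℓ' : Pos S} {e e' : Pos S → Pos T}
  (valid : Valid ℓ (pt (rawOf h)) (sur (rawOf h)) (emb (rawOf h)) e)
  (valid' : Valid ℓ' (pt (rawOf h')) (sur (rawOf h')) (emb (rawOf h')) e') →
  SameB h h' → ∀ x → StrongFacts.bit valid x ≡ StrongFacts.bit valid' x
same-bits h h' {e = e} {e'} valid valid' same x
  with e x ≟P emb (rawOf h) x | e' x ≟P emb (rawOf h') x
... | yes _ | yes _ = refl
... | no _  | no _  = refl
... | yes p | no q  = ⊥-elim (Bits.in-B h valid (proj₂ (same x) (Bits.to-B h' valid' q)) p)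
... | no p  | yes q = ⊥-elim (Bits.in-B h' valid' (proj₁ (same x) (Bits.to-B h valid p)) q)

-- Recovering a connection from its letters

_≟L_ : (l l' : Pos S × Bool) → Dec (l ≡ l')
_≟L_ = ProductP.≡-dec _≟P_ Bool._≟_

matches : Pos S × Bool → Maybe (Pos S × Bool) → Bool
matches l nothing   = false
matches l (just l') = does (l' ≟L l)

firstWith : Pos S × Bool → Pos T → Pre (Pos S × Bool) false (T ∷ []) → Pos T
firstWith l d p = Maybe.maybe′ unwrap d (search (λ z → matches l (labOf p z)))

labOf-tabT-< : (f : Pos T → X) {w z : Pos T} → z <T w → labOf (tabT f w) (zero ▹ z) ≡ just (f z)
labOf-tabT-< f {w} {z} (le , ne) =
  labOf-< (f ∘ unwrap) (zero ▹ w) (zero ▹ z) (same≤ le , ne ∘ child-injective)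

labOf-tabT-≥ : (f : Pos T → X) {w z : Pos T} → w ≤T z → labOf (tabT f w) (zero ▹ z) ≡ nothing
labOf-tabT-≥ f {w} {z} le = labOf-≥ (f ∘ unwrap) (zero ▹ w) (zero ▹ z) (same≤ le)

mismatch : (f : Pos T → Pos S × Bool) (l : Pos S × Bool) (w z : Pos T) →
           (z <T w → f z ≢ l) → matches l (labOf (tabT f w) (zero ▹ z)) ≡ false
mismatch f l w z h with z <T? w
... | yes lt rewrite labOf-tabT-< f lt = dec-false (f z ≟L l) (h lt)
... | no ¬lt rewrite labOf-tabT-≥ f (≮⇒≥ z w ¬lt) = refl

firstWith-first : (f : Pos T → Pos S × Bool) (l : Pos S × Bool) (d : Pos T) {w a : Pos T} →
  a <T w → f a ≡ l → (∀ z → f z ≡ l → z ≤T w → a ≤T z) → firstWith l d (tabT f w) ≡ a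
firstWith-first f l d {w} {a} a<w fa least = cong (Maybe.maybe′ unwrap d)
  (search-first (λ z → matches l (labOf (tabT f w) z)) (zero ▹ a)
    (trans (cong (matches l) (labOf-tabT-< f a<w)) (dec-true (f a ≟L l) fa))
    (λ { (zero ▹ z) (same≤ le , ne) → mismatch f l w z λ z<w fz →
           ≤⇒≯ (least z fz (proj₁ z<w)) (le , ne ∘ cong (child zero)) }))

firstWith-none : (f : Pos T → Pos S × Bool) (l : Pos S × Bool) (d : Pos T) {w : Pos T} →
  (∀ z → z <T w → f z ≢ l) → firstWith l d (tabT f w) ≡ d
firstWith-none f l d {w} none = cong (Maybe.maybe′ unwrap d)
  (search-nothing (λ z → matches l (labOf (tabT f w) z))
    (λ { (zero ▹ z) → mismatch f l w z (none z) }))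

-- The end point carries no letter in `p`, and the default values make up for this. It is the image
-- of `ℓ` under the embedding, hence has value `ℓ`; if `(x , false)` is not found, the canonical
-- point of `x` is the end point; if `(x , true)` is not found for `x` other than `ℓ`, the embedding
-- agrees with the canonical one at `x`.
module Decode {S : Tree} (ℓ : Pos S) {U : Tree} (p : Pre (Pos S × Bool) false (U ∷ [])) where

  end-point : Pos U
  end-point = unwrap (vertex p)

  surjection : Pos U → Pos S
  surjection y = Maybe.maybe′ proj₁ ℓ (labOf p (zero ▹ y))

  canonical : Pos S → Pos U
  canonical x = firstWith (x , false) end-point p

  embedding : Pos S → Pos U
  embedding x = if does (x ≟P ℓ) then end-point else firstWith (x , true) (canonical x) p

-- The data of a copy in U of a connection onto S are recovered from its labels.
module Decoding {S U : Tree} {ℓ : Pos S} {w : Pos U} {s : Pos U → Pos S} {i e : Pos S → Pos U}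
  (greatest : Greatest ℓ) (valid : Valid ℓ w s i e) (bit : Pos S → Bool)
  (f : Pos U → Pos S × Bool) (f-s : ∀ y → proj₁ (f y) ≡ s y)
  (f-i : ∀ x → f (i x) ≡ (x , bit x)) (f-e : ∀ x → f (e x) ≡ (x , false))
  (f-true : ∀ {x y} → f y ≡ (x , true) → i x ≤T y × bit x ≡ true)
  (bit-false : ∀ {x} → bit x ≡ false → e x ≡ i x) where

  open StrongFacts valid using (e-s; s-e; e≤v; i-<; i-last)
  open Decode ℓ (tabT f w)

  end-point≡ : end-point ≡ w
  end-point≡ = cong unwrap (vertex-tab (f ∘ unwrap) (zero ▹ w))

  surjection≡ : ∀ y → y ≤T w → surjection y ≡ s y
  surjection≡ y le with y ≟P w
  ... | no ne rewrite labOf-tabT-< f (le , ne) = f-s y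
  ... | yes refl rewrite labOf-tabT-≥ f (≤T-refl {x = y}) =
    trans (sym (StrongFacts.s-i valid ℓ)) (cong s i-last)

  e-first : ∀ x z → f z ≡ (x , false) → z ≤T w → e x ≤T z
  e-first x z fz le =
    ⊑⇒≤ (subst (λ x → e x ⊑ z) (trans (sym (f-s z)) (cong proj₁ fz)) (e-s z le))

  canonical≡ : ∀ x → canonical x ≡ e x
  canonical≡ x with e x ≟P w
  ... | no ne  = firstWith-first f (x , false) end-point (e≤v x , ne) (f-e x) (e-first x)
  ... | yes eq = trans (firstWith-none f (x , false) end-point
      (λ z z<w fz → ≤⇒≯ (subst (_≤T z) eq (e-first x z fz (proj₁ z<w))) z<w))
    (trans end-point≡ (sym eq))

  embedding≡ : ∀ x → embedding x ≡ i x
  embedding≡ x with x ≟P ℓ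
  ... | yes refl = trans end-point≡ (sym i-last)
  ... | no ne with bit x in b
  ...   | true = firstWith-first f (x , true) (canonical x)
          (subst (i x <T_) i-last (i-< (greatest x , ne)))
          (trans (f-i x) (cong (x ,_) b)) (λ z fz _ → proj₁ (f-true fz))
  ...   | false = trans (firstWith-none f (x , true) (canonical x)
            (λ z _ fz → absurd (trans (sym b) (proj₂ (f-true fz)))))
          (trans (canonical≡ x) (bit-false b))
    where
    absurd : false ≢ true
    absurd ()

  decoded-valid : Valid ℓ end-point surjection embedding canonical
  decoded-valid = valid-cong (sym end-point≡) (λ y le → sym (surjection≡ y le))
    (λ x → sym (embedding≡ x)) (λ x → sym (canonical≡ x)) valid

-- With no ancestors there is no label for `skip` or `into`, so the root must be kept.
single-tree : FMor 0 F (T ∷ []) → Σ Tree λ U → F ≡ U ∷ []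
single-tree (keep g nil) = _ , refl

-- Colouring connections by way of labelled vertices

module Conclusion (S T : Tree) (r : ℕ) where

  Letter : Set
  Letter = Pos S × Bool

  open Fusion {Letter} (finite-× finite-Pos finite-Bool) _≟L_ using (fuse-scripts)

  vertices : List (Pos S)
  vertices = proj₁ (walk S)

  ℓ : Pos S
  ℓ = proj₁ (proj₂ (walk S))

  walkS : Walk ℓ (rootOf S) vertices
  walkS = proj₂ (proj₂ (walk S))

  walk-greatest : ∀ {S} {ℓ x : Pos S} {xs} → Walk ℓ x xs → Greatest ℓ
  walk-greatest (stop g) = g
  walk-greatest (_ ∷ w)  = walk-greatest w

  ℓ-greatest : Greatest ℓ
  ℓ-greatest = walk-greatest walkS

  ℓT : Pos T
  ℓT = proj₁ (proj₂ (walk T))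

  ℓT-greatest : Greatest ℓT
  ℓT-greatest = walk-greatest (proj₂ (proj₂ (walk T)))

  FB : Finite (Pos S)
  FB = finite-Pos

  -- One script for each 0-1 function on the vertices of `S`; the set B enters as its indicator
  -- function.
  number-of-bits : ℕ
  number-of-bits = 2 ^ Finite.size FB

  bits : Fin number-of-bits → Pos S → Bool
  bits k x = Finite.elem finite-Bool (decode FB k x)

  bits-code : (bit : Pos S → Bool) → Σ (Fin number-of-bits) λ k → ∀ x → bits k x ≡ bit x
  bits-code bit = code FB (Finite.index finite-Bool ∘ bit) , λ x →
    trans (cong (Finite.elem finite-Bool) (decode-code FB _ x)) (Finite.elem-index finite-Bool (bit x))

  scriptOf : (Pos S → Bool) → Script Letter
  scriptOf bit = script bit (rootOf S) vertices []

  fused : Σ Forest λ F' → (χ : Pre Letter false F' → Fin (suc r)) →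
    Σ (FMor 0 F' (T ∷ [])) λ t → Σ (Fin number-of-bits → Fin (suc r)) λ c →
      ∀ k {p} → Follows (scriptOf (bits k)) p → χ (pev [] t p) ≡ c k
  fused = fuse-scripts number-of-bits (λ k → scriptOf (bits k)) (T ∷ []) r

  module Colouring (U : Tree) (χ : Hom S U → Fin (suc r))
                   (χ-resp : ∀ h h' → h ≈H h' → χ h ≡ χ h') where

    colour : Pre Letter false (U ∷ []) → Fin (suc r)
    colour p = by-validity (valid? ℓ end-point surjection embedding canonical)
      module Colour where
      open Decode ℓ p
      by-validity : Dec (Valid ℓ end-point surjection embedding canonical) → Fin (suc r)
      by-validity (yes v) = χ (raw end-point surjection embedding , valid⇒strong ℓ-greatest v)
      -- A labelled vertex that encodes no strong connection gets a default colour, which exists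
      -- because the number of colours is positive.
      by-validity (no _)  = zero

    module _ (t : FMor 0 (U ∷ []) (T ∷ [])) where
      open Pure t

      raw-copy : RawHom T U
      raw-copy = raw (copy ℓT) project copy

      hom-copy : Hom T U
      hom-copy = raw-copy , valid⇒strong ℓT-greatest (valid-copy t (valid-id ℓT-greatest))

      composite : (si : Hom S T) → Σ (Hom S U) λ h → rawOf h ≈R (raw-copy ∘R rawOf si)
      composite (raw v s i , strong) with strong⇒valid ℓ-greatest strong
      ... | e , valid = (raw-copy ∘R raw v s i , valid⇒strong ℓ-greatest (valid-copy t valid)) ,
        refl , (λ _ _ → refl) , (λ _ → refl)

      -- The letters of `si` on `T` follow the script of its bits. Pulled back along `t`, they
      -- decode to the composite with the copy, so `colour` returns the colour under `χ` of that
      -- composite.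
      colour-eq : (c : Fin number-of-bits → Fin (suc r)) →
        (∀ k {p} → Follows (scriptOf (bits k)) p → colour (pev [] t p) ≡ c k) →
        (si : Hom S T) {e : Pos S → Pos T}
        (valid : Valid ℓ (pt (rawOf si)) (sur (rawOf si)) (emb (rawOf si)) e)
        (k : Fin number-of-bits) → (∀ x → bits k x ≡ StrongFacts.bit valid x) →
        (h : Hom S U) → rawOf h ≈R (raw-copy ∘R rawOf si) → χ h ≡ c k
      colour-eq c mono (raw v s i , strong) {e} valid k bits≡ h (pt≡ , sur≡ , emb≡) =
        trans (χ-agrees (valid? ℓ end-point surjection embedding canonical))
              (trans (cong colour (sym (pev-tabT letter v))) (mono k follows))
        where
        open StrongFacts valid using (letter; bit; letter-i; letter-e; letter-true; bit-false)
        follows : Follows (scriptOf (bits k)) (tabT letter v)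
        follows = subst (λ sc → Follows sc (tabT letter v))
          (script-cong (sym ∘ bits≡) (rootOf S) vertices []) (Following.follow-root valid walkS)
        f : Pos U → Letter
        f = letter ∘ project
        open Decode ℓ (tabT f (copy v))
        open Decoding ℓ-greatest (valid-copy t valid) bit f (λ _ → refl)
          (λ x → trans (cong letter (project-copy (i x))) (letter-i x))
          (λ x → trans (cong letter (project-copy (e x))) (letter-e x))
          (λ {x} {y} fy → subst (_≤T y) (cong copy (proj₁ (letter-true fy))) (⊑⇒≤ (copy-project y)) ,
                          proj₂ (letter-true fy))
          (λ b → cong copy (bit-false b))
        χ-agrees : (d : Dec (Valid ℓ end-point surjection embedding canonical)) →
                   χ h ≡ Colour.by-validity (tabT f (copy v)) d
        χ-agrees (yes v) = χ-resp h _ (trans pt≡ (sym end-point≡) ,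
          (λ y le → trans (sur≡ y le) (sym (surjection≡ y (subst (y ≤T_) pt≡ le)))) ,
          (λ x → trans (emb≡ x) (sym (embedding≡ x))))
        χ-agrees (no ¬v) = ⊥-elim (¬v decoded-valid)

  conclusion : Σ Tree λ U → (χ : Hom S U → Fin (suc r)) → (∀ h h' → h ≈H h' → χ h ≡ χ h') →
    Σ (Hom T U) λ tj →
      (∀ (si : Hom S T) → Σ (Hom S U) λ h → rawOf h ≈R (rawOf tj ∘R rawOf si)) ×
      (∀ (si si' : Hom S T) (h h' : Hom S U) → rawOf h ≈R (rawOf tj ∘R rawOf si) →
        rawOf h' ≈R (rawOf tj ∘R rawOf si') → SameB si si' → χ h ≡ χ h')
  conclusion with fused
  -- Any instance of `fuse` provides a morphism showing that `F'` is a single tree; a constant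
  -- colouring will do.
  ... | F' , fuse with single-tree (proj₁ (fuse (λ _ → zero)))
  ... | U , refl = U , go
    where
    go : (χ : Hom S U → Fin (suc r)) → (∀ h h' → h ≈H h' → χ h ≡ χ h') → _
    go χ χ-resp with fuse (Colouring.colour U χ χ-resp)
    ... | t , c , mono = hom-copy t , composite t , same
      where
      open Colouring U χ χ-resp
      same : (si si' : Hom S T) (h h' : Hom S U) → rawOf h ≈R (rawOf (hom-copy t) ∘R rawOf si) →
        rawOf h' ≈R (rawOf (hom-copy t) ∘R rawOf si') → SameB si si' → χ h ≡ χ h'
      same si@(_ , strong) si'@(_ , strong') h h' h≈ h'≈ sameB
        with strong⇒valid ℓ-greatest strong | strong⇒valid ℓ-greatest strong'
      ... | e , valid | e' , valid' with bits-code (StrongFacts.bit valid)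
      ... | k , bits≡ = trans (colour-eq t c mono si valid k bits≡ h h≈)
        (sym (colour-eq t c mono si' valid' k
          (λ x → trans (bits≡ x) (same-bits si si' valid valid' sameB x)) h' h'≈))

theorem5p3 : (S T : Tree) (r : ℕ) → 0 < r →
    Σ Tree λ V →
    (χ : Hom S V → Fin r) →
    (∀ h h' → h ≈H h' → χ h ≡ χ h') →
    Σ (Hom T V) λ tj →
    (∀ (si : Hom S T) → Σ (Hom S V) λ h → rawOf h ≈R (rawOf tj ∘R rawOf si)) ×
    (∀ (si si' : Hom S T) (h h' : Hom S V) →
    rawOf h ≈R (rawOf tj ∘R rawOf si) →
    rawOf h' ≈R (rawOf tj ∘R rawOf si') →
    SameB si si' → χ h ≡ χ h')
theorem5p3 S T (suc r) _ = Conclusion.conclusion S T r
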